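{- Let $\Upsilon$ be a gain signed graph. An edge set $S\subseteq E$, regarded as the spanning subgraph $(V,S)$, is independent in $M(\Upsilon)$ if and only if it is of one of the following types: (I) (hyperbalanced) every component of $S$ is a tree or a sign-unbalanced unicycle, and $S$ contains no loose edges; (II) (hyperfrustrated) every component is a tree or a sign-unbalanced unicycle, except that there may be one edge component $S_0$ that is either a sign-balanced unicycle, or a loose edge, or a sign-unbalanced theta graph or a handcuff with at least one negative figure, possibly with attached trees; and in each case the unique sign circuit in $S_0$ is non-neutral.
   Context: Let $\mathbb{K}$ be a field of characteristic $\ne2$. A graph $\Gamma=(V,E)$ has vertex set $V=\{v_1,\dots,v_n\}$ and finite edge set $E$; edges are links (two ends at distinct vertices), loops (two ends at one vertex), half edges (one end) or loose edges (no ends); parallel edges allowed. A gain signed graph $\Upsilon=(\Gamma,\sigma,\varphi)$: $\sigma:E\to\{\pm1\}$ (half edges negative, loose edges positive); with an orientation $\tau$ (signs $\tau(v,e)\in\{\pm1\}$ on edge ends, $\tau(v,e)\tau(w,e)=-\sigma(e)$ for a link or loop with ends $v,w$) each edge has gain $\varphi(e)\in\mathbb{K}$, negated on reorientation. Neutral = gain $0$. Walk gain of $W=u_0e_1\cdots e_lu_l$: $\varphi(W)=-\sum_i\varphi(e_i)\sigma(W_{0,i-1})\tau(u_{i-1},e_i)$, $\sigma(W_{0,j})=\prod_{i\le j}\sigma(e_i)$. Ultrawalks may begin with a half edge $e_0$ at $u_0$ and/or end with a half edge $e_{l+1}$ at $u_l$; their gain adds $\tau(u_0,e_0)\varphi(e_0)$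 and/or $-\varphi(e_{l+1})\sigma(W_{0,l})\tau(u_l,e_{l+1})$ to $\varphi(W_{0,l})$. Circles: connected 2-regular subgraphs, sign = product of edge signs; a negative figure is a negative circle or a half edge. A sign circuit is a positive circle, a loose edge, or a handcuff of two negative figures (see below). Its gain: the edge gain for a loose edge; else $\varphi(W)$ for a circuit walk (once around a positive circle; for a handcuff with figures $C_1,C_2$, connecting path $P$ of length $\ge0$: around $C_1$, along $P$, around $C_2$, back along $P$ if both circles; from half edge $C_1$ along $P$, around $C_2$, back, ending with $C_1$ if $C_1$ half edge and $C_2$ circle; from one half edge along $P$ to the other if both half edges); well defined up to sign; neutral if $0$. An edge set is hyperbalanced if all sign circuits in it are neutral, hyperfrustrated otherwise; sign balanced if it has no negative circle and no half edge. Components of $S$: connected components of $(V,S)$ (loose edges excluded; isolated vertices are trivial trees); edge components: each loose edge and each non-trivial component. $M(\Upsilon)$: matroid on $E$ with rank $n-b_\Sigma(S)+\delta(S)$, where $b_\Sigma$ counts sign-balanced components and $\delta=0$ if $S$ hyperbalanced, $1$ otherwise. A handcuff is two figures (each a circle or a half edge) that have at most one common vertex, together with a path (of length $0$ if they share a vertex) joining them and meeting them only at its endpoints. A unicycle is a connected graph consisting of a circle or a half edge with trees attached; it is sign balanced (a positive circle with trees) or sign unbalanced (a negative circle or half edge with trees). A theta graph is the union of three internally disjoint paths with the same two endpoints; it is sign unbalanced if it contains a negative circle. -}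

module Defs where

open import Level using (Level; _⊔_) renaming (suc to lsuc)
open import Algebra.Bundles using (CommutativeRing)
open import Data.Nat using (ℕ; zero; suc; _∸_; _≤_) renaming (_+_ to _+ℕ_)
open import Data.Bool using (Bool; true; false; if_then_else_)
open import Data.Fin using (Fin; toℕ; _≟_)
open import Data.Fin.Subset using (Subset; _∈_; _⊆_; ⁅_⁆; _∪_; _∩_; _─_; ∣_∣; Nonempty; Empty)
open import Data.Vec using (lookup)
open import Data.List using (List; []; _∷_; map; foldr; allFin; _++_)
open import Data.Nat.ListAction using (sum)
open import Data.List.Membership.Propositional using () renaming (_∈_ to _∈ₗ_)
open import Data.List.Relation.Unary.Unique.Propositional using (Unique)
open import Data.Maybe using (Maybe; just; nothing)
open import Data.Product using (Σ; ∃; ∃₂; _×_; _,_; proj₁)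
open import Data.Sum using (_⊎_)
open import Data.Sign using (Sign; opposite) renaming (+ to s+; - to s-; _*_ to _·_)
open import Relation.Nullary using (¬_; does)
open import Relation.Binary.PropositionalEquality using (_≡_; _≢_)
open import Relation.Binary.Construct.Closure.ReflexiveTransitive using (Star)
open import Function.Bundles using (_⇔_)

record Field (c ℓ : Level) : Set (lsuc (c ⊔ ℓ)) where
  field
    commutativeRing : CommutativeRing c ℓ
  open CommutativeRing commutativeRing public
  field
    0≉1     : ¬ (0# ≈ 1#)
    inverse : ∀ x → ¬ (x ≈ 0#) → ∃ λ y → x * y ≈ 1#

CharNot2 : ∀ {c ℓ} → Field c ℓ → Set ℓ
CharNot2 K = ¬ ((1# + 1#) ≈ 0#)
  where open Field K

-- Gain signed graphs with vertices Fin n and edges Fin m.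
-- An edge is
--   link a b τa τb : a link (a ≢ b) or a loop (a ≡ b), with the
--                    orientation signs τ(a,e)=τa, τ(b,e)=τb of its two ends;
--   half a τa      : a half edge with its end at a, τ(a,e)=τa;
--   loose          : a loose edge.
-- The sign σ is determined by the orientation via τ(v,e)τ(w,e) = -σ(e)
-- for links/loops; half edges are negative, loose edges positive.

data EdgeType (n : ℕ) : Set where
  link  : Fin n → Fin n → Sign → Sign → EdgeType n
  half  : Fin n → Sign → EdgeType n
  loose : EdgeType n

record GSG {c ℓ} (K : Field c ℓ) (n m : ℕ) : Set c where
  field
    ends : Fin m → EdgeType n
    φ    : Fin m → Field.Carrier K

module Gain {c ℓ} (K : Field c ℓ) {n m : ℕ} (Υ : GSG K n m) where
  open Field K
  open GSG Υ

  σ : Fin m → Sign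
  σ e with ends e
  ... | link _ _ s t = opposite (s · t)
  ... | half _ _     = s-
  ... | loose        = s+

  sgn : Sign → Carrier → Carrier
  sgn s+ x = x
  sgn s- x = - x

  Loose : Fin m → Set
  Loose e = ends e ≡ loose

  IsHalf : Fin m → Set
  IsHalf e = ∃₂ λ v t → ends e ≡ half v t

  IsLink : Fin m → Set  -- link or loop
  IsLink e = ∃₂ λ a b → ∃₂ λ s t → ends e ≡ link a b s t

  endsAt : Fin m → Fin n → ℕ
  endsAt e v with ends e
  ... | link a b _ _ = (if does (a ≟ v) then 1 else 0) +ℕ (if does (b ≟ v) then 1 else 0)
  ... | half a _     = if does (a ≟ v) then 1 else 0
  ... | loose        = 0

  Inc : Fin m → Fin n → Set
  Inc e v = 1 ≤ endsAt e v

  deg : Subset m → Fin n → ℕ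
  deg X v = sum (map (λ e → if lookup X e then endsAt e v else 0) (allFin m))

  signOf : Subset m → Sign
  signOf X = foldr (λ e s → if lookup X e then σ e · s else s) s+ (allFin m)

  VertexOf : Subset m → Fin n → Set
  VertexOf X v = ∃ λ e → e ∈ X × Inc e v

  Adj : Subset m → Fin n → Fin n → Set
  Adj X a b = ∃ λ e → e ∈ X × ∃₂ λ s t → (ends e ≡ link a b s t ⊎ ends e ≡ link b a s t)

  Conn : Subset m → Fin n → Fin n → Set
  Conn X = Star (Adj X)

  Connected : Subset m → Set
  Connected X = ∀ u v → VertexOf X u → VertexOf X v → Conn X u v

  NoLoose : Subset m → Set
  NoLoose X = ∀ e → e ∈ X → ¬ Loose e

  -- Walks: a step (e , true) traverses the link/loop e = link a b .. from
  -- a to b, leaving through the end at a; (e , false) from b to a.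

  Step : Set
  Step = Fin m × Bool

  stepData : Fin m → Bool → Maybe (Fin n × Fin n × Sign)
  stepData e d with ends e
  ... | link a b s t = if d then just (a , b , s) else just (b , a , t)
  ... | half _ _     = nothing
  ... | loose        = nothing

  stepτ : Fin m → Bool → Sign
  stepτ e d with ends e
  ... | link a b s t = if d then s else t
  ... | half _ t     = t
  ... | loose        = s+

  stepTo : Fin n → Fin m → Bool → Fin n
  stepTo u e d with ends e
  ... | link a b s t = if d then b else a
  ... | half _ _     = u
  ... | loose        = u

  WalkFrom : Fin n → List Step → Fin n → Set
  WalkFrom u [] w = u ≡ w
  WalkFrom u ((e , d) ∷ ws) w = ∃₂ λ v s → stepData e d ≡ just (u , v , s) × WalkFrom v ws w

  walkVerts : Fin n → List Step → List (Fin n)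
  walkVerts u [] = u ∷ []
  walkVerts u ((e , d) ∷ ws) = u ∷ walkVerts (stepTo u e d) ws

  edgesOf : List Step → List (Fin m)
  edgesOf = map proj₁

  walkSign : List Step → Sign
  walkSign ws = foldr (λ e s → σ e · s) s+ (edgesOf ws)

  -- φ(W) = - Σ_i φ(e_i) σ(W_{0,i-1}) τ(u_{i-1}, e_i), accumulating σ(W_{0,i-1})
  gainAcc : Sign → List Step → Carrier
  gainAcc s [] = 0#
  gainAcc s ((e , d) ∷ ws) = (- sgn (s · stepτ e d) (φ e)) + gainAcc (s · σ e) ws

  walkGain : List Step → Carrier
  walkGain = gainAcc s+

  halfτ : Fin m → Sign
  halfτ e with ends e
  ... | half _ t = t
  ... | _        = s+

  -- ultrawalk contributions: initial half edge e₀ adds τ(u₀,e₀)φ(e₀);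
  -- final half edge e_{l+1} adds -φ(e_{l+1}) σ(W_{0,l}) τ(u_l,e_{l+1})
  startTerm : Fin m → Carrier
  startTerm h = sgn (halfτ h) (φ h)

  endTerm : List Step → Fin m → Carrier
  endTerm ws h = - sgn (walkSign ws · halfτ h) (φ h)

  Enumerates : Subset m → List Step → Set
  Enumerates X ws = Unique (edgesOf ws) × (∀ e → (e ∈ X ⇔ e ∈ₗ edgesOf ws))

  Path : Subset m → Fin n → Fin n → Set
  Path P x y = ∃ λ ws → WalkFrom x ws y × Enumerates P ws × Unique (walkVerts x ws)

  Circle : Subset m → Set
  Circle C = Nonempty C × (∀ e → e ∈ C → IsLink e)
           × (∀ v → deg C v ≡ 0 ⊎ deg C v ≡ 2) × Connected C

  PosCircle : Subset m → Set
  PosCircle C = Circle C × signOf C ≡ s+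

  HalfFig : Subset m → Set
  HalfFig F = ∃ λ h → IsHalf h × F ≡ ⁅ h ⁆

  Figure : Subset m → Set
  Figure F = Circle F ⊎ HalfFig F

  NegFigure : Subset m → Set
  NegFigure F = (Circle F × signOf F ≡ s-) ⊎ HalfFig F

  Acyclic : Subset m → Set
  Acyclic X = ∀ F → F ⊆ X → ¬ Figure F

  -- tree (the empty edge set = a trivial tree)
  Tree : Subset m → Set
  Tree X = Connected X × NoLoose X × Acyclic X

  WithTrees : Subset m → Subset m → Set
  WithTrees X H = X ⊆ H × Connected H × NoLoose H × Acyclic (H ─ X)
                × (∀ u v → VertexOf X u → VertexOf X v → Conn (H ─ X) u v → u ≡ v)

  SUUnicycle : Subset m → Set
  SUUnicycle H = ∃ λ F → NegFigure F × WithTrees F H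

  SBUnicycle : Subset m → Set
  SBUnicycle H = ∃ λ F → PosCircle F × WithTrees F H

  record Handcuff (C : Subset m) : Set where
    field
      F1 F2 P : Subset m
      x y     : Fin n
      fig1    : Figure F1
      fig2    : Figure F2
      x∈F1    : VertexOf F1 x
      y∈F2    : VertexOf F2 y
      disj    : Empty (F1 ∩ F2)
      path    : Path P x y
      meet    : (x ≡ y × (∀ v → VertexOf F1 v → VertexOf F2 v → v ≡ x))
              ⊎ ((∀ v → VertexOf F1 v → ¬ VertexOf F2 v)
                 × (∀ v → VertexOf P v → VertexOf F1 v → v ≡ x)
                 × (∀ v → VertexOf P v → VertexOf F2 v → v ≡ y))
      union   : C ≡ F1 ∪ F2 ∪ P
  open Handcuff public

  Theta : Subset m → Set
  Theta T = ∃₂ λ u v → ∃₂ λ P1 P2 → ∃ λ P3 →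
      u ≢ v × Path P1 u v × Path P2 u v × Path P3 u v
    × Empty (P1 ∩ P2) × Empty (P1 ∩ P3) × Empty (P2 ∩ P3)
    × (∀ w → VertexOf P1 w → VertexOf P2 w → w ≡ u ⊎ w ≡ v)
    × (∀ w → VertexOf P1 w → VertexOf P3 w → w ≡ u ⊎ w ≡ v)
    × (∀ w → VertexOf P2 w → VertexOf P3 w → w ≡ u ⊎ w ≡ v)
    × T ≡ P1 ∪ P2 ∪ P3

  SUTheta : Subset m → Set
  SUTheta T = Theta T × ∃ λ C → C ⊆ T × Circle C × signOf C ≡ s-

  SignCircuit : Subset m → Set
  SignCircuit C = PosCircle C ⊎ (∃ λ e → Loose e × C ≡ ⁅ e ⁆)
                ⊎ (Σ (Handcuff C) λ h → NegFigure (F1 h) × NegFigure (F2 h))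

  data CircuitGain (C : Subset m) : Carrier → Set c where
    gLoose  : ∀ e → Loose e → C ≡ ⁅ e ⁆ → CircuitGain C (φ e)
    gCircle : PosCircle C → ∀ u ws → WalkFrom u ws u → Enumerates C ws
            → CircuitGain C (walkGain ws)
    gCC     : (h : Handcuff C) → NegFigure (F1 h) → NegFigure (F2 h)
            → Circle (F1 h) → Circle (F2 h)
            → ∀ w1 wp w2 wq
            → WalkFrom (x h) w1 (x h) → Enumerates (F1 h) w1
            → WalkFrom (x h) wp (y h) → Enumerates (P h) wp
            → WalkFrom (y h) w2 (y h) → Enumerates (F2 h) w2
            → WalkFrom (y h) wq (x h) → Enumerates (P h) wq
            → CircuitGain C (walkGain (w1 ++ wp ++ w2 ++ wq))
    gHC     : (h : Handcuff C) → NegFigure (F1 h) → NegFigure (F2 h)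
            → ∀ e1 → IsHalf e1 → F1 h ≡ ⁅ e1 ⁆ → Circle (F2 h)
            → ∀ wp w2 wq
            → WalkFrom (x h) wp (y h) → Enumerates (P h) wp
            → WalkFrom (y h) w2 (y h) → Enumerates (F2 h) w2
            → WalkFrom (y h) wq (x h) → Enumerates (P h) wq
            → CircuitGain C (startTerm e1 + walkGain (wp ++ w2 ++ wq)
                               + endTerm (wp ++ w2 ++ wq) e1)
    gHH     : (h : Handcuff C)
            → ∀ e1 e2 → IsHalf e1 → IsHalf e2 → F1 h ≡ ⁅ e1 ⁆ → F2 h ≡ ⁅ e2 ⁆
            → ∀ wp → WalkFrom (x h) wp (y h) → Enumerates (P h) wp
            → CircuitGain C (startTerm e1 + walkGain wp + endTerm wp e2)

  Neutral : Subset m → Set (c ⊔ ℓ)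
  Neutral C = ∀ g → CircuitGain C g → g ≈ 0#

  Hyperbalanced : Subset m → Set (c ⊔ ℓ)
  Hyperbalanced S = ∀ C → C ⊆ S → SignCircuit C → Neutral C

  IsCompEdges : Subset m → Fin n → Subset m → Set
  IsCompEdges S v X = ∀ e → (e ∈ X ⇔ (e ∈ S × ¬ Loose e × ∃ λ w → Inc e w × Conn S w v))

  SignBalanced : Subset m → Set
  SignBalanced X = (∀ C → C ⊆ X → Circle C → signOf C ≡ s+) × (∀ e → e ∈ X → ¬ IsHalf e)

  -- v is the least vertex of its component (used to count components)
  IsRep : Subset m → Fin n → Set
  IsRep S v = ∀ u → Conn S u v → toℕ v ≤ toℕ u

  CompBalanced : Subset m → Fin n → Set
  CompBalanced S v = ∀ X → IsCompEdges S v X → SignBalanced X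

  -- r is the rank n - b_Σ(S) + δ(S); b_Σ(S) = ∣ R ∣ where R is the set of
  -- representatives of sign-balanced components
  Rank : Subset m → ℕ → Set (c ⊔ ℓ)
  Rank S r = ∃ λ (R : Subset n) → (∀ v → (v ∈ R ⇔ (IsRep S v × CompBalanced S v)))
           × ∃ λ δ → ((δ ≡ 0 × Hyperbalanced S) ⊎ (δ ≡ 1 × ¬ Hyperbalanced S))
           × r ≡ n ∸ ∣ R ∣ +ℕ δ

  Independent : Subset m → Set (c ⊔ ℓ)
  Independent S = Rank S ∣ S ∣

  TypeI : Subset m → Set
  TypeI S = NoLoose S × (∀ v X → IsCompEdges S v X → Tree X ⊎ SUUnicycle X)

  EdgeComponent : Subset m → Subset m → Set
  EdgeComponent S S0 = (∃ λ e → e ∈ S × Loose e × S0 ≡ ⁅ e ⁆)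
                     ⊎ (∃ λ v → IsCompEdges S v S0 × Nonempty S0)

  SpecialComponent : Subset m → Set (c ⊔ ℓ)
  SpecialComponent S0 =
      (SBUnicycle S0
       ⊎ (∃ λ e → Loose e × S0 ≡ ⁅ e ⁆)
       ⊎ (∃ λ T → SUTheta T × WithTrees T S0)
       ⊎ (∃ λ T → (Σ (Handcuff T) λ h → NegFigure (F1 h) ⊎ NegFigure (F2 h)) × WithTrees T S0))
    × (∀ C → C ⊆ S0 → SignCircuit C → ¬ Neutral C)

  TypeII : Subset m → Set (c ⊔ ℓ)
  TypeII S = ∃ λ S0 → EdgeComponent S S0 × SpecialComponent S0
           × (∀ e → e ∈ S → Loose e → e ∈ S0)
           × (∀ v X → IsCompEdges S v X → X ≡ S0 ⊎ Tree X ⊎ SUUnicycle X)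

{-# OPTIONS --safe #-}
-- Apart from the neutrality of its sign circuits, everything about S is decided by its signs. Over the
-- three-element field consider the vectors x on V with x b = σ(e) x a for each link or loop e of S
-- with ends a, b and x a = 0 for each half edge of S at a. The sign-balanced components of S correspond
-- to the leading positions of the solutions, so b(S) is the dimension of the solution space and
-- deleting an edge e raises b by 0 (if e is redundant, i.e. its equation follows from the others) or
-- by 1. Hence μ(S) = |S| + b(S) ≥ n, with equality iff S has no redundant edge, and if μ(S) = n + 1
-- then deleting a redundant edge leaves none. Independence means that μ(S) = n and S is hyperbalanced,
-- or that μ(S) = n + 1 and S is hyperfrustrated.
-- All edges of a sign circuit are redundant, so there is no sign circuit if μ(S) = n and at most one if
-- μ(S) = n + 1; the gains enter only through the neutrality of that one. An edge whose ends are joined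
-- to a negative figure not containing it is redundant as well, which leaves no room for anything but
-- attached trees around the figures, thetas and handcuffs listed. Conversely, if any two figures in
-- the same component are equal and negative, then no edge except a loose one is redundant; deleting a
-- suitable edge of the sign circuit brings type II into this situation.

module Submission where

open import Defs
open import Algebra.Structures using (IsCommutativeMonoid)
open import Data.Bool using (false; if_then_else_; true)
open import Data.Bool.Properties using (¬-not)
open import Data.Fin using (Fin; _≟_; suc; toℕ; zero)
open import Data.Fin.Properties using (all?; any?; toℕ-injective; toℕ<n)
open import Data.Fin.Subset using (Empty; Nonempty; Subset; _-_; _∈_; _∉_; _∩_; _∪_; _⊆_; _─_; inside; outside; ⁅_⁆; ∣_∣) renaming (⊥ to ∅)
open import Data.Fin.Subset.Properties using (Empty-unique; _∈?_; _⊆?_; nonempty?; p⊂q⇒∣p∣<∣q∣; p⊆q⇒∣p∣≤∣q∣; p─q⊆p; p─⊥≡p; x∈p∧x∉q⇒x∈p─q; x∈p∧x≢y⇒x∈p-y; x∈p∩q⁺; x∈p∩q⁻; x∈p∪q⁺; x∈p∪q⁻; x∈⁅x⁆; x∈⁅y⁆⇒x≡y; ∈⊤; ∉⊥; ∣p∣≤n; ∣⊤∣≡n; ∣⊥∣≡0; ∪-assoc; ∪-comm; ⊆-antisym)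
open import Data.List using (List; []; _∷_; allFin; foldr; map)
open import Data.List.Membership.Propositional using () renaming (_∈_ to _∈ₗ_; _∉_ to _∉ₗ_)
open import Data.List.Membership.Propositional.Properties using (∈-allFin)
open import Data.List.Relation.Unary.All using (All; []; _∷_) renaming (lookup to All-lookup; tabulate to All-tabulate)
open import Data.List.Relation.Unary.AllPairs using ([]; _∷_)
open import Data.List.Relation.Unary.Any using (here; there)
open import Data.List.Relation.Unary.Unique.Propositional using (Unique)
open import Data.List.Relation.Unary.Unique.Propositional.Properties using (allFin⁺)
open import Data.Maybe using (Maybe; fromMaybe; just; nothing)
open import Data.Maybe.Properties using (just-injective)
open import Data.Nat using (_+_; _<?_; _<_; _∸_; _≤?_; _≤_; suc; s≤s; zero; z≤n; ℕ) renaming (_≟_ to _≟ℕ_)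
open import Data.Nat.ListAction using (sum)
open import Data.Nat.Properties using (+-0-isCommutativeMonoid; +-assoc; +-cancelʳ-≡; +-comm; +-identityʳ; +-monoʳ-≤; +-suc; 1+n≰n; <-cmp; <⇒≱; m<1+n⇒m≤n; m∸n+n≡m; m≤m+n; m≤n⇒m≤1+n; suc-injective; ≤-antisym; ≤-refl; ≤-reflexive; ≤-trans; ≤∧≢⇒<; ≮⇒≥; ≰⇒>)
open import Data.Nat.Solver using (module +-*-Solver)
open import Data.Product using (_,_; _×_; proj₁; proj₂; Σ; ∃; ∃₂) renaming (swap to ×-swap)
open import Data.Sign using (Sign; opposite) renaming (+ to s+; - to s-; _*_ to _·_)
open import Data.Sign.Properties using () renaming (*-assoc to ·-assoc; *-comm to ·-comm; *-identityʳ to ·-identityʳ; *-isCommutativeMonoid to ·-isCommutativeMonoid; _≟_ to _≟ₛ_; s*s≡+ to s·s≡+)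
open import Data.Sum using (_⊎_; inj₁; inj₂)
open import Data.Vec using (_∷_; here; lookup; tabulate; there)
open import Data.Vec.Properties using ([]=⇒lookup; lookup⇒[]=; lookup∘tabulate)
open import Function.Base using (_∘_)
open import Function.Bundles using (Equivalence; _⇔_; mk⇔)
open import Relation.Binary.Construct.Closure.ReflexiveTransitive using (_◅_; _◅◅_; ε) renaming (map to Star-map; reverse to Star-reverse)
open import Relation.Binary.Definitions using (tri<; tri>; tri≈)
open import Relation.Binary.PropositionalEquality using (_≡_; _≢_; cong; cong₂; module ≡-Reasoning; refl; subst; sym; trans)
open import Relation.Nullary using (Dec; contradiction; does; no; yes; ¬_)
open import Relation.Nullary.Decidable using (_×-dec_; _→-dec_; _⊎-dec_; dec-true; map′; ¬?)

-- Three elements suit the purpose because the nonzero ones are exactly the signs and 1 differs from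
-- -1: a nowhere-zero solution is a switching function that makes all circles positive, while a
-- negative circle or a half edge forces 0, which spreads to everything connected with it. Equality
-- is decidable there; neutrality is never decided, because `Independent` brings evidence for
-- hyperbalance or against it. Leading positions replace a comparison of the components of S and S -
-- e, where a deletion may split a component or make it balanced: for solutions both are one
-- elimination step. A circle is given as a connected 2-regular edge set, without a cyclic order.
-- Statements about it rest on one parity fact: for signs `y` on the vertices, the product of
-- `y a · y b` over its edges is +, as each vertex is counted twice. With `y` the indicator of a
-- vertex set, this says that cuts are even; with `y` a switching function, it yields the sign of
-- the circle.

-- Finite subsets and induction by deleting an element.

∈─⁻ : ∀ {k} (p q : Subset k) {x} → x ∈ p ─ q → x ∈ p × x ∉ q
∈─⁻ (inside ∷ p) (outside ∷ q) {zero} here = here , λ ()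
∈─⁻ (outside ∷ p) (outside ∷ q) {zero} ()
∈─⁻ (_ ∷ p) (inside ∷ q) {zero} ()
∈─⁻ (_ ∷ p) (_ ∷ q) {suc x} (there i) with ∈─⁻ p q i
... | a , b = there a , λ { (there c) → b c }

∈-⁻ : ∀ {k} (p : Subset k) {x y} → x ∈ p - y → x ∈ p × x ≢ y
∈-⁻ p {x} {y} i with ∈─⁻ p ⁅ y ⁆ i
... | a , b = a , λ { refl → b (x∈⁅x⁆ x) }

p-x⊆p : ∀ {k} (p : Subset k) x → p - x ⊆ p
p-x⊆p p x = p─q⊆p p ⁅ x ⁆

-⊆-mono : ∀ {k} {p q : Subset k} x → p ⊆ q → p - x ⊆ q - x
-⊆-mono {p = p} x p⊆q i with ∈-⁻ p i
... | a , b = x∈p∧x≢y⇒x∈p-y (p⊆q a) b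

⊆-avoid : ∀ {k} {p q : Subset k} {x} → p ⊆ q → x ∉ p → p ⊆ q - x
⊆-avoid p⊆q x∉p {y} i = x∈p∧x≢y⇒x∈p-y (p⊆q i) λ { refl → x∉p i }

x∉p-x : ∀ {k} (p : Subset k) x → x ∉ p - x
x∉p-x p x i = proj₂ (∈-⁻ p i) refl

⁅⁆⊆ : ∀ {k} {p : Subset k} {x} → x ∈ p → ⁅ x ⁆ ⊆ p
⁅⁆⊆ {x = x} i j with x∈⁅y⁆⇒x≡y x j
... | refl = i

∪-lub : ∀ {k} {p q r : Subset k} → p ⊆ r → q ⊆ r → p ∪ q ⊆ r
∪-lub {p = p} {q} a b i with x∈p∪q⁻ p q i
... | inj₁ j = a j
... | inj₂ j = b j

∈∪ˡ : ∀ {k} (p q : Subset k) {x} → x ∈ p → x ∈ p ∪ q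
∈∪ˡ p q i = x∈p∪q⁺ (inj₁ i)

∈∪ʳ : ∀ {k} (p q : Subset k) {x} → x ∈ q → x ∈ p ∪ q
∈∪ʳ p q i = x∈p∪q⁺ (inj₂ i)

∪-─ : ∀ {k} {p q : Subset k} → p ⊆ q → q ≡ p ∪ (q ─ p)
∪-─ {p = p} {q} p⊆q = ⊆-antisym fwd (∪-lub p⊆q (p─q⊆p q p))
  where
  fwd : q ⊆ p ∪ (q ─ p)
  fwd {x} i with x ∈? p
  ... | yes j = ∈∪ˡ p (q ─ p) j
  ... | no j = ∈∪ʳ p (q ─ p) (x∈p∧x∉q⇒x∈p─q i j)

disjoint-─ : ∀ {k} {p q : Subset k} → ∀ x → x ∈ p → x ∉ q ─ p
disjoint-─ {p = p} {q} x i j = proj₂ (∈─⁻ q p j) i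

∈⇒lookup : ∀ {k} {p : Subset k} {x} → x ∈ p → lookup p x ≡ true
∈⇒lookup = []=⇒lookup

∉⇒lookup : ∀ {k} {p : Subset k} {x} → x ∉ p → lookup p x ≡ false
∉⇒lookup {p = p} {x} x∉p = ¬-not λ eq → x∉p (lookup⇒[]= x p eq)

∣p∣≡suc∣p-x∣ : ∀ {k} {p : Subset k} {x} → x ∈ p → ∣ p ∣ ≡ suc ∣ p - x ∣
∣p∣≡suc∣p-x∣ {p = inside ∷ p} here = cong (λ q → suc ∣ q ∣) (sym (p─⊥≡p p))
∣p∣≡suc∣p-x∣ {p = inside ∷ p} (there i) = cong suc (∣p∣≡suc∣p-x∣ i)
∣p∣≡suc∣p-x∣ {p = outside ∷ p} (there i) = ∣p∣≡suc∣p-x∣ i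

-- `X - e` is not structurally smaller than `X`, so the recursion runs on the cardinality.
removal-induction : ∀ {k ℓ} (P : Subset k → Set ℓ) → P ∅ → (∀ X e → e ∈ X → P (X - e) → P X) → ∀ X → P X
removal-induction {k} P base step X = go ∣ X ∣ X refl
  where
  go : ∀ j X → ∣ X ∣ ≡ j → P X
  go j X eq with nonempty? X
  ... | no emp = subst P (sym (Empty-unique emp)) base
  go zero X eq | yes (e , i) = contradiction (trans (sym (∣p∣≡suc∣p-x∣ i)) eq) λ ()
  go (suc j) X eq | yes (e , i) =
    step X e i (go j (X - e) (suc-injective (trans (sym (∣p∣≡suc∣p-x∣ i)) eq)))

separate : ∀ {k ℓ} {P : Fin k → Set ℓ} → (∀ v → Dec (P v)) → ∃ λ (R : Subset k) → ∀ v → (v ∈ R ⇔ P v)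
separate {k} {P = P} P? = R , λ v → mk⇔ (to v) (from v)
  where
  R : Subset k
  R = tabulate λ v → does (P? v)
  to : ∀ v → v ∈ R → P v
  to v i with P? v | trans (sym (lookup∘tabulate (λ v → does (P? v)) v)) ([]=⇒lookup i)
  ... | yes p | _ = p
  ... | no _ | ()
  from : ∀ v → P v → v ∈ R
  from v p = lookup⇒[]= v R (trans (lookup∘tabulate (λ v → does (P? v)) v) (dec-true (P? v) p))

-- The counting form of "the dimension grows by at most one": without its only element outside `q`,
-- `p` lies in `q`.
∣∣≤suc : ∀ {k} {p q : Subset k} → (∀ v w → v ∈ p → w ∈ p → v ∉ q → w ∉ q → v ≡ w) → ∣ p ∣ ≤ suc ∣ q ∣
∣∣≤suc {p = p} {q} uniq with nonempty? (p ─ q)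
... | no emp = m≤n⇒m≤1+n (p⊆q⇒∣p∣≤∣q∣ p⊆q)
  where
  p⊆q : p ⊆ q
  p⊆q {x} i with x ∈? q
  ... | yes j = j
  ... | no j = contradiction (x , x∈p∧x∉q⇒x∈p─q i j) emp
... | yes (v , i) = ≤-trans (≤-reflexive (∣p∣≡suc∣p-x∣ (proj₁ (∈─⁻ p q i)))) (s≤s (p⊆q⇒∣p∣≤∣q∣ rest))
  where
  rest : p - v ⊆ q
  rest {x} j with x ∈? q
  ... | yes l = l
  ... | no l = contradiction (uniq x v (proj₁ (∈-⁻ p j)) (proj₁ (∈─⁻ p q i)) l (proj₂ (∈─⁻ p q i))) (proj₂ (∈-⁻ p j))

-- Sums and products over a subset.

module Fold {M : Set} {_∙_ : M → M → M} {ε : M} (isCM : IsCommutativeMonoid _≡_ _∙_ ε) where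
  open IsCommutativeMonoid isCM using (assoc; comm; identityˡ; identityʳ)

  -- The conditional surrounds the accumulator so that `signOf X` unfolds to `foldOver X σ`;
  -- `foldOn≡foldMap` moves it into a weight that is `ε` outside `X`.
  foldOn : ∀ {k} → Subset k → (Fin k → M) → List (Fin k) → M
  foldOn X f = foldr (λ e s → if lookup X e then f e ∙ s else s) ε

  foldMap : {A : Set} → (A → M) → List A → M
  foldMap f = foldr (λ a s → f a ∙ s) ε

  foldOver : ∀ {k} → Subset k → (Fin k → M) → M
  foldOver {k} X f = foldOn X f (allFin k)

  interchange : ∀ a b c d → (a ∙ b) ∙ (c ∙ d) ≡ (a ∙ c) ∙ (b ∙ d)
  interchange a b c d = begin
    (a ∙ b) ∙ (c ∙ d) ≡⟨ assoc a b (c ∙ d) ⟩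
    a ∙ (b ∙ (c ∙ d)) ≡⟨ cong (a ∙_) (sym (assoc b c d)) ⟩
    a ∙ ((b ∙ c) ∙ d) ≡⟨ cong (λ z → a ∙ (z ∙ d)) (comm b c) ⟩
    a ∙ ((c ∙ b) ∙ d) ≡⟨ cong (a ∙_) (assoc c b d) ⟩
    a ∙ (c ∙ (b ∙ d)) ≡⟨ sym (assoc a c (b ∙ d)) ⟩
    (a ∙ c) ∙ (b ∙ d) ∎
    where open ≡-Reasoning

  foldMap-cong : {A : Set} {f g : A → M} → (∀ a → f a ≡ g a) → ∀ as → foldMap f as ≡ foldMap g as
  foldMap-cong eq [] = refl
  foldMap-cong eq (a ∷ as) = cong₂ _∙_ (eq a) (foldMap-cong eq as)

  foldMap-ε : {A : Set} {f : A → M} → (∀ a → f a ≡ ε) → ∀ as → foldMap f as ≡ ε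
  foldMap-ε eq [] = refl
  foldMap-ε eq (a ∷ as) = trans (cong₂ _∙_ (eq a) (foldMap-ε eq as)) (identityˡ ε)

  foldMap-∙ : {A : Set} (f g : A → M) → ∀ as → foldMap (λ a → f a ∙ g a) as ≡ foldMap f as ∙ foldMap g as
  foldMap-∙ f g [] = sym (identityˡ ε)
  foldMap-∙ f g (a ∷ as) = trans (cong ((f a ∙ g a) ∙_) (foldMap-∙ f g as)) (interchange (f a) (g a) _ _)

  foldMap-single : {A : Set} (f : A → M) (x : A) → ∀ as → Unique as → x ∈ₗ as → (∀ a → a ≢ x → f a ≡ ε) → foldMap f as ≡ f x
  foldMap-single f x (.x ∷ as) (px ∷ _) (here refl) off = trans (cong (f x ∙_) (rest as px)) (identityʳ (f x))
    where
    rest : ∀ as → All (x ≢_) as → foldMap f as ≡ ε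
    rest [] [] = refl
    rest (a ∷ as) (p ∷ ps) = trans (cong₂ _∙_ (off a (λ q → p (sym q))) (rest as ps)) (identityˡ ε)
  foldMap-single f x (a ∷ as) (px ∷ u) (there i) off =
    trans (cong₂ _∙_ (off a (All-lookup px i)) (foldMap-single f x as u i off)) (identityˡ (f x))

  weight : ∀ {k} → Subset k → (Fin k → M) → Fin k → M
  weight X f e = if lookup X e then f e else ε

  foldOn≡foldMap : ∀ {k} (X : Subset k) f es → foldOn X f es ≡ foldMap (weight X f) es
  foldOn≡foldMap X f [] = refl
  foldOn≡foldMap X f (e ∷ es) with lookup X e
  ... | true = cong (f e ∙_) (foldOn≡foldMap X f es)
  ... | false = trans (foldOn≡foldMap X f es) (sym (identityˡ _))

  weight-∈ : ∀ {k} {X : Subset k} (f : Fin k → M) {e} → e ∈ X → weight X f e ≡ f e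
  weight-∈ f i rewrite ∈⇒lookup i = refl

  weight-∉ : ∀ {k} {X : Subset k} (f : Fin k → M) {e} → e ∉ X → weight X f e ≡ ε
  weight-∉ f i rewrite ∉⇒lookup i = refl

  foldOver-∙ : ∀ {k} (X : Subset k) f g → foldOver X (λ e → f e ∙ g e) ≡ foldOver X f ∙ foldOver X g
  foldOver-∙ {k} X f g =
    trans (foldOn≡foldMap X _ (allFin k))
      (trans (foldMap-cong wt (allFin k))
        (trans (foldMap-∙ (weight X f) (weight X g) (allFin k))
          (sym (cong₂ _∙_ (foldOn≡foldMap X f (allFin k)) (foldOn≡foldMap X g (allFin k))))))
    where
    wt : ∀ e → weight X (λ e → f e ∙ g e) e ≡ weight X f e ∙ weight X g e
    wt e with lookup X e
    ... | true = refl
    ... | false = sym (identityˡ ε)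

  foldOver-single : ∀ {k} {X : Subset k} f {x} → x ∈ X → (∀ e → e ∈ X → e ≢ x → f e ≡ ε) → foldOver X f ≡ f x
  foldOver-single {k} {X} f {x} x∈X off =
    trans (foldOn≡foldMap X f (allFin k))
      (trans (foldMap-single (weight X f) x (allFin k) (allFin⁺ k) (∈-allFin x) wt) (weight-∈ f x∈X))
    where
    wt : ∀ e → e ≢ x → weight X f e ≡ ε
    wt e e≢x with e ∈? X
    ... | yes i = trans (weight-∈ f i) (off e i e≢x)
    ... | no i = weight-∉ f i

  foldOver-ε : ∀ {k} {X : Subset k} {f} → (∀ e → e ∈ X → f e ≡ ε) → foldOver X f ≡ ε
  foldOver-ε {k} {X} {f} eq = trans (foldOn≡foldMap X f (allFin k)) (foldMap-ε wt (allFin k))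
    where
    wt : ∀ e → weight X f e ≡ ε
    wt e with e ∈? X
    ... | yes i = trans (weight-∈ f i) (eq e i)
    ... | no i = weight-∉ f i

  foldOver-⁅⁆ : ∀ {k} (x : Fin k) f → foldOver ⁅ x ⁆ f ≡ f x
  foldOver-⁅⁆ x f = foldOver-single f (x∈⁅x⁆ x) λ e i e≢x → contradiction (x∈⁅y⁆⇒x≡y x i) e≢x

  foldOver-∪ : ∀ {k} {X Y : Subset k} f → (∀ e → e ∈ X → e ∉ Y) → foldOver (X ∪ Y) f ≡ foldOver X f ∙ foldOver Y f
  foldOver-∪ {k} {X} {Y} f disj =
    trans (foldOn≡foldMap (X ∪ Y) f (allFin k))
      (trans (foldMap-cong wt (allFin k))
        (trans (foldMap-∙ (weight X f) (weight Y f) (allFin k))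
          (sym (cong₂ _∙_ (foldOn≡foldMap X f (allFin k)) (foldOn≡foldMap Y f (allFin k))))))
    where
    wt : ∀ e → weight (X ∪ Y) f e ≡ weight X f e ∙ weight Y f e
    wt e with e ∈? X | e ∈? Y
    ... | yes i | yes j = contradiction j (disj e i)
    ... | yes i | no j = trans (weight-∈ f (∈∪ˡ X Y i)) (trans (sym (identityʳ (f e))) (sym (cong₂ _∙_ (weight-∈ f i) (weight-∉ f j))))
    ... | no i | yes j = trans (weight-∈ f (∈∪ʳ X Y j)) (trans (sym (identityˡ (f e))) (sym (cong₂ _∙_ (weight-∉ f i) (weight-∈ f j))))
    ... | no i | no j = trans (weight-∉ {X = X ∪ Y} f ∉∪) (trans (sym (identityˡ ε)) (sym (cong₂ _∙_ (weight-∉ f i) (weight-∉ f j))))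
      where
      ∉∪ : e ∉ X ∪ Y
      ∉∪ l with x∈p∪q⁻ X Y l
      ... | inj₁ m = i m
      ... | inj₂ m = j m

-- The three-element field, written as 0 = nothing, ±1 = just ±.
Ternary : Set
Ternary = Maybe Sign

infixr 7 _⋆_
_⋆_ : Sign → Ternary → Ternary
s ⋆ nothing = nothing
s ⋆ just t = just (s · t)

infixl 6 _⊕_
_⊕_ : Ternary → Ternary → Ternary
nothing ⊕ y = y
just s ⊕ nothing = just s
just s+ ⊕ just s+ = just s-
just s+ ⊕ just s- = nothing
just s- ⊕ just s+ = nothing
just s- ⊕ just s- = just s+

⊕-comm : ∀ x y → x ⊕ y ≡ y ⊕ x
⊕-comm nothing nothing = refl
⊕-comm nothing (just _) = refl
⊕-comm (just _) nothing = refl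
⊕-comm (just s+) (just s+) = refl
⊕-comm (just s+) (just s-) = refl
⊕-comm (just s-) (just s+) = refl
⊕-comm (just s-) (just s-) = refl

⊕-assoc : ∀ x y z → (x ⊕ y) ⊕ z ≡ x ⊕ (y ⊕ z)
⊕-assoc nothing y z = refl
⊕-assoc (just s) nothing z = refl
⊕-assoc (just s+) (just s+) nothing = refl
⊕-assoc (just s+) (just s-) nothing = refl
⊕-assoc (just s-) (just s+) nothing = refl
⊕-assoc (just s-) (just s-) nothing = refl
⊕-assoc (just s+) (just s+) (just s+) = refl
⊕-assoc (just s+) (just s+) (just s-) = refl
⊕-assoc (just s+) (just s-) (just s+) = refl
⊕-assoc (just s+) (just s-) (just s-) = refl
⊕-assoc (just s-) (just s+) (just s+) = refl
⊕-assoc (just s-) (just s+) (just s-) = refl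
⊕-assoc (just s-) (just s-) (just s+) = refl
⊕-assoc (just s-) (just s-) (just s-) = refl

⋆-⊕ : ∀ s x y → s ⋆ (x ⊕ y) ≡ s ⋆ x ⊕ s ⋆ y
⋆-⊕ s nothing y = refl
⋆-⊕ s (just t) nothing = refl
⋆-⊕ s+ (just s+) (just s+) = refl
⋆-⊕ s+ (just s+) (just s-) = refl
⋆-⊕ s+ (just s-) (just s+) = refl
⋆-⊕ s+ (just s-) (just s-) = refl
⋆-⊕ s- (just s+) (just s+) = refl
⋆-⊕ s- (just s+) (just s-) = refl
⋆-⊕ s- (just s-) (just s+) = refl
⋆-⊕ s- (just s-) (just s-) = refl

⋆-⋆-comm : ∀ s t x → s ⋆ t ⋆ x ≡ t ⋆ s ⋆ x
⋆-⋆-comm s t nothing = refl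
⋆-⋆-comm s t (just u) = cong just (trans (sym (·-assoc s t u)) (trans (cong (_· u) (·-comm s t)) (·-assoc t s u)))

⊕-interchange : ∀ a b c d → (a ⊕ b) ⊕ (c ⊕ d) ≡ (a ⊕ c) ⊕ (b ⊕ d)
⊕-interchange a b c d = begin
  (a ⊕ b) ⊕ (c ⊕ d) ≡⟨ ⊕-assoc a b (c ⊕ d) ⟩
  a ⊕ (b ⊕ (c ⊕ d)) ≡⟨ cong (a ⊕_) (sym (⊕-assoc b c d)) ⟩
  a ⊕ ((b ⊕ c) ⊕ d) ≡⟨ cong (λ z → a ⊕ (z ⊕ d)) (⊕-comm b c) ⟩
  a ⊕ ((c ⊕ b) ⊕ d) ≡⟨ cong (a ⊕_) (⊕-assoc c b d) ⟩
  a ⊕ (c ⊕ (b ⊕ d)) ≡⟨ sym (⊕-assoc a c (b ⊕ d)) ⟩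
  (a ⊕ c) ⊕ (b ⊕ d) ∎
  where open ≡-Reasoning

-- A pivot is always ±1, so a sign is enough as a multiplier and elimination needs no division.
cancelling : ∀ x y → x ≢ nothing → y ≢ nothing → ∃ λ c → x ⊕ c ⋆ y ≡ nothing
cancelling nothing y x≢0 _ = contradiction refl x≢0
cancelling (just s) nothing _ y≢0 = contradiction refl y≢0
cancelling (just s+) (just s+) _ _ = s- , refl
cancelling (just s+) (just s-) _ _ = s+ , refl
cancelling (just s-) (just s+) _ _ = s+ , refl
cancelling (just s-) (just s-) _ _ = s- , refl

⊕-⋆-cancel : ∀ x c y → y ≡ nothing → x ⊕ c ⋆ y ≡ nothing → x ≡ nothing
⊕-⋆-cancel nothing c _ refl eq = refl

zero? : (x : Ternary) → Dec (x ≡ nothing)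
zero? nothing = yes refl
zero? (just _) = no λ ()

-- Edges, their ends, connections and the ternary equations.

δ : ∀ {n} → Fin n → Fin n → ℕ
δ a v = if does (a ≟ v) then 1 else 0

δ-refl : ∀ {n} (a : Fin n) → δ a a ≡ 1
δ-refl a with a ≟ a
... | yes _ = refl
... | no ¬p = contradiction refl ¬p

δ-≢ : ∀ {n} {a v : Fin n} → a ≢ v → δ a v ≡ 0
δ-≢ {a = a} {v} a≢v with a ≟ v
... | yes p = contradiction p a≢v
... | no _ = refl

δ-pos : ∀ {n} {a v : Fin n} → 1 ≤ δ a v → v ≡ a
δ-pos {a = a} {v} p with a ≟ v
... | yes q = sym q

module Incidence {c ℓ} (K : Field c ℓ) {n m : ℕ} (Υ : GSG K n m) where
  open Gain K Υ hiding (F1; F2; P; x; y; fig1; fig2; x∈F1; y∈F2; disj; path; meet; union)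
  open GSG Υ using (ends)

  Joins : Fin m → Fin n → Fin n → Set
  Joins e a b = ∃₂ λ s t → ends e ≡ link a b s t ⊎ ends e ≡ link b a s t

  data EdgeView (e : Fin m) : Set where
    joins : ∀ a b → Joins e a b → EdgeView e
    isHalf : ∀ a t → ends e ≡ half a t → EdgeView e
    isLoose : Loose e → EdgeView e

  view : ∀ e → EdgeView e
  view e with ends e in eq
  ... | link a b s t = joins a b (s , t , inj₁ eq)
  ... | half a t = isHalf a t eq
  ... | loose = isLoose eq

  joins-sym : ∀ {e a b} → Joins e a b → Joins e b a
  joins-sym (s , t , inj₁ eq) = s , t , inj₂ eq
  joins-sym (s , t , inj₂ eq) = s , t , inj₁ eq

  joins-link : ∀ {e a b} → Joins e a b → IsLink e
  joins-link (s , t , inj₁ eq) = _ , _ , s , t , eq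
  joins-link (s , t , inj₂ eq) = _ , _ , s , t , eq

  link-joins : ∀ {e} → IsLink e → ∃₂ λ a b → Joins e a b
  link-joins (a , b , s , t , eq) = a , b , s , t , inj₁ eq

  ¬link-half : ∀ {e} → IsLink e → ¬ IsHalf e
  ¬link-half (_ , _ , _ , _ , eq) (_ , _ , eq') = contradiction (trans (sym eq) eq') λ ()

  ¬link-loose : ∀ {e} → IsLink e → ¬ Loose e
  ¬link-loose (_ , _ , _ , _ , eq) eq' = contradiction (trans (sym eq) eq') λ ()

  ¬half-loose : ∀ {e} → IsHalf e → ¬ Loose e
  ¬half-loose (_ , _ , eq) eq' = contradiction (trans (sym eq) eq') λ ()

  endsAt-link : ∀ {e a b s t} → ends e ≡ link a b s t → ∀ v → endsAt e v ≡ δ a v + δ b v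
  endsAt-link eq v rewrite eq = refl

  endsAt-half : ∀ {e a t} → ends e ≡ half a t → ∀ v → endsAt e v ≡ δ a v
  endsAt-half eq v rewrite eq = refl

  endsAt-loose : ∀ {e} → Loose e → ∀ v → endsAt e v ≡ 0
  endsAt-loose eq v rewrite eq = refl

  joins-endsAt : ∀ {e a b} → Joins e a b → ∀ v → endsAt e v ≡ δ a v + δ b v
  joins-endsAt (_ , _ , inj₁ eq) v = endsAt-link eq v
  joins-endsAt {a = a} {b} (_ , _ , inj₂ eq) v = trans (endsAt-link eq v) (+-comm (δ b v) (δ a v))

  joins-inc₁ : ∀ {e a b} → Joins e a b → Inc e a
  joins-inc₁ {a = a} {b} j rewrite joins-endsAt j a | δ-refl a = s≤s z≤n

  joins-inc₂ : ∀ {e a b} → Joins e a b → Inc e b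
  joins-inc₂ j = joins-inc₁ (joins-sym j)

  half-inc : ∀ {e a t} → ends e ≡ half a t → Inc e a
  half-inc {a = a} eq rewrite endsAt-half eq a | δ-refl a = s≤s z≤n

  inc-joins : ∀ {e a b w} → Joins e a b → Inc e w → w ≡ a ⊎ w ≡ b
  inc-joins {a = a} {b} {w} j i rewrite joins-endsAt j w with a ≟ w | b ≟ w
  ... | yes p | _ = inj₁ (sym p)
  ... | no _ | yes q = inj₂ (sym q)
  inc-joins {a = a} {b} {w} j () | no _ | no _

  inc-half : ∀ {e a t w} → ends e ≡ half a t → Inc e w → w ≡ a
  inc-half {w = w} eq i rewrite endsAt-half eq w = δ-pos i

  ¬inc-loose : ∀ {e w} → Loose e → ¬ Inc e w
  ¬inc-loose {w = w} eq i rewrite endsAt-loose eq w = contradiction i λ ()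

  inc-link-joins : ∀ {e w} → IsLink e → Inc e w → ∃ λ b → Joins e w b
  inc-link-joins il i with link-joins il
  ... | a , b , j with inc-joins j i
  ... | inj₁ refl = b , j
  ... | inj₂ refl = a , joins-sym j

  joins-unique : ∀ {e a b c d} → Joins e a b → Joins e c d → (a ≡ c × b ≡ d) ⊎ (a ≡ d × b ≡ c)
  joins-unique (_ , _ , inj₁ p) (_ , _ , inj₁ q) with trans (sym p) q
  ... | refl = inj₁ (refl , refl)
  joins-unique (_ , _ , inj₁ p) (_ , _ , inj₂ q) with trans (sym p) q
  ... | refl = inj₂ (refl , refl)
  joins-unique (_ , _ , inj₂ p) (_ , _ , inj₁ q) with trans (sym p) q
  ... | refl = inj₂ (refl , refl)
  joins-unique (_ , _ , inj₂ p) (_ , _ , inj₂ q) with trans (sym p) q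
  ... | refl = inj₁ (refl , refl)

  -- The incidence functional of an edge (up to sign); σ = + exactly when τ(a,e) ≠ τ(b,e), so it
  -- vanishes on a link iff x b = σ(e) x a, and on a half edge at a iff x a = 0.
  residual : EdgeType n → (Fin n → Ternary) → Ternary
  residual (link a b s t) x = s ⋆ x a ⊕ t ⋆ x b
  residual (half a _) x = x a
  residual loose x = nothing

  Sat : Fin m → (Fin n → Ternary) → Set
  Sat e x = residual (ends e) x ≡ nothing

  Sol : Subset m → (Fin n → Ternary) → Set
  Sol S x = ∀ e → e ∈ S → Sat e x

  combine : (Fin n → Ternary) → Sign → (Fin n → Ternary) → Fin n → Ternary
  combine x c y v = x v ⊕ c ⋆ y v

  residual-combine : ∀ e x c y → residual e (combine x c y) ≡ residual e x ⊕ c ⋆ residual e y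
  residual-combine (link a b s t) x c y = begin
    s ⋆ (x a ⊕ c ⋆ y a) ⊕ t ⋆ (x b ⊕ c ⋆ y b)
      ≡⟨ cong₂ _⊕_ (distrib s a) (distrib t b) ⟩
    (s ⋆ x a ⊕ c ⋆ s ⋆ y a) ⊕ (t ⋆ x b ⊕ c ⋆ t ⋆ y b)
      ≡⟨ ⊕-interchange (s ⋆ x a) _ _ _ ⟩
    (s ⋆ x a ⊕ t ⋆ x b) ⊕ (c ⋆ s ⋆ y a ⊕ c ⋆ t ⋆ y b)
      ≡⟨ cong ((s ⋆ x a ⊕ t ⋆ x b) ⊕_) (sym (⋆-⊕ c (s ⋆ y a) (t ⋆ y b))) ⟩
    (s ⋆ x a ⊕ t ⋆ x b) ⊕ c ⋆ (s ⋆ y a ⊕ t ⋆ y b) ∎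
    where
    open ≡-Reasoning
    distrib : ∀ s v → s ⋆ (x v ⊕ c ⋆ y v) ≡ s ⋆ x v ⊕ c ⋆ s ⋆ y v
    distrib s v = trans (⋆-⊕ s (x v) (c ⋆ y v)) (cong (s ⋆ x v ⊕_) (⋆-⋆-comm s c (y v)))
  residual-combine (half a _) x c y = refl
  residual-combine loose x c y = refl

  sol-combine : ∀ {S x y} c → Sol S x → Sol S y → Sol S (combine x c y)
  sol-combine {x = x} {y} c p q e i =
    trans (residual-combine (ends e) x c y) (cong₂ (λ a b → a ⊕ c ⋆ b) (p e i) (q e i))

  sat-difference : ∀ {x y} c e → Sat e y → Sat e (combine x c y) → Sat e x
  sat-difference {x} {y} c e p q =
    ⊕-⋆-cancel _ c _ p (trans (sym (residual-combine (ends e) x c y)) q)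

  sol-mono : ∀ {S T x} → S ⊆ T → Sol T x → Sol S x
  sol-mono S⊆T p e i = p e (S⊆T i)

  sol-remove : ∀ {S x e} → Sol (S - e) x → Sat e x → Sol S x
  sol-remove {S} {x} {e} p q e' i with e' ≟ e
  ... | yes refl = q
  ... | no ne = p e' (x∈p∧x≢y⇒x∈p-y i ne)

  σ-link : ∀ {e a b s t} → ends e ≡ link a b s t → σ e ≡ opposite (s · t)
  σ-link eq rewrite eq = refl

  private
    solve-link : ∀ s t x y → s ⋆ x ⊕ t ⋆ y ≡ nothing → y ≡ opposite (s · t) ⋆ x
    solve-link s t nothing nothing eq = refl
    solve-link s+ s+ (just s+) (just s-) eq = refl
    solve-link s+ s+ (just s-) (just s+) eq = refl
    solve-link s+ s- (just s+) (just s+) eq = refl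
    solve-link s+ s- (just s-) (just s-) eq = refl
    solve-link s- s+ (just s+) (just s+) eq = refl
    solve-link s- s+ (just s-) (just s-) eq = refl
    solve-link s- s- (just s+) (just s-) eq = refl
    solve-link s- s- (just s-) (just s+) eq = refl

    check-link : ∀ s t x → s ⋆ x ⊕ t ⋆ opposite (s · t) ⋆ x ≡ nothing
    check-link s t nothing = refl
    check-link s+ s+ (just s+) = refl
    check-link s+ s+ (just s-) = refl
    check-link s+ s- (just s+) = refl
    check-link s+ s- (just s-) = refl
    check-link s- s+ (just s+) = refl
    check-link s- s+ (just s-) = refl
    check-link s- s- (just s+) = refl
    check-link s- s- (just s-) = refl

    ⋆-involutive : ∀ s x → s ⋆ s ⋆ x ≡ x
    ⋆-involutive s nothing = refl
    ⋆-involutive s+ (just t) = refl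
    ⋆-involutive s- (just s+) = refl
    ⋆-involutive s- (just s-) = refl

  sat-joins : ∀ {e a b x} → Joins e a b → Sat e x → x b ≡ σ e ⋆ x a
  sat-joins {e} {a} {b} {x} (s , t , inj₁ eq) q rewrite σ-link eq | eq = solve-link s t (x a) (x b) q
  sat-joins {e} {a} {b} {x} (s , t , inj₂ eq) q rewrite σ-link eq | eq =
    trans (sym (⋆-involutive (opposite (s · t)) (x b))) (cong (opposite (s · t) ⋆_) (sym (solve-link s t (x b) (x a) q)))

  joins-sat : ∀ {e a b x} → Joins e a b → x b ≡ σ e ⋆ x a → Sat e x
  joins-sat {e} {a} {b} {x} (s , t , inj₁ eq) q rewrite σ-link eq | eq =
    trans (cong (λ z → s ⋆ x a ⊕ t ⋆ z) q) (check-link s t (x a))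
  joins-sat {e} {a} {b} {x} (s , t , inj₂ eq) q rewrite σ-link eq | eq =
    trans (cong (λ z → s ⋆ x b ⊕ t ⋆ z) (trans (sym (⋆-involutive _ (x a))) (cong (opposite (s · t) ⋆_) (sym q)))) (check-link s t (x b))

  sat-half : ∀ {e a t x} → ends e ≡ half a t → Sat e x → x a ≡ nothing
  sat-half eq q rewrite eq = q

  half-sat : ∀ {e a t x} → ends e ≡ half a t → x a ≡ nothing → Sat e x
  half-sat eq q rewrite eq = q

  loose-sat : ∀ {e x} → Loose e → Sat e x
  loose-sat eq rewrite eq = refl

  zeros-sat : ∀ {e x} → (∀ w → Inc e w → x w ≡ nothing) → Sat e x
  zeros-sat {e} {x} z with view e
  ... | joins a b j = joins-sat j (trans (z b (joins-inc₂ j)) (cong (σ e ⋆_) (sym (z a (joins-inc₁ j)))))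
  ... | isHalf a t eq = half-sat eq (z a (half-inc eq))
  ... | isLoose eq = loose-sat eq

  sat? : ∀ e x → Dec (Sat e x)
  sat? e x = zero? _

  conn-sym : ∀ {X u v} → Conn X u v → Conn X v u
  conn-sym = Star-reverse λ { (e , i , j) → e , i , joins-sym j }

  conn-mono : ∀ {X Y u v} → X ⊆ Y → Conn X u v → Conn Y u v
  conn-mono X⊆Y = Star-map λ { (e , i , j) → e , X⊆Y i , j }

  edge-conn : ∀ {X e a b} → e ∈ X → Joins e a b → Conn X a b
  edge-conn {e = e} i j = (e , i , j) ◅ ε

  conn-closed : ∀ {X u v ℓ'} {P : Fin n → Set ℓ'} → (∀ {e a b} → e ∈ X → Joins e a b → P a → P b) → Conn X u v → P u → P v
  conn-closed step ε p = p
  conn-closed step ((e , i , j) ◅ w) p = conn-closed step w (step i j p)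

  -- Every walk can be shortened to cross `e` at most once. If it crosses again, the stretch between
  -- the two crossings is skipped: one crossing remains if their directions agree, and none if they
  -- are opposite.
  conn-split : ∀ {X u v} e → Conn X u v →
    Conn (X - e) u v ⊎ ∃₂ λ a b → Joins e a b × Conn (X - e) u a × Conn (X - e) b v
  conn-split e ε = inj₁ ε
  conn-split {X} {u} {v} e (_◅_ {j = w} (e' , i , j) c) with conn-split e c | e' ≟ e
  ... | inj₁ c' | no ne = inj₁ ((e' , x∈p∧x≢y⇒x∈p-y i ne , j) ◅ c')
  ... | inj₁ c' | yes refl = inj₂ (u , w , j , ε , c')
  ... | inj₂ (a , b , k , p , q) | no ne = inj₂ (a , b , k , (e' , x∈p∧x≢y⇒x∈p-y i ne , j) ◅ p , q)
  ... | inj₂ (a , b , k , p , q) | yes refl with joins-unique j k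
  ... | inj₁ (refl , refl) = inj₂ (a , b , k , ε , q)
  ... | inj₂ (refl , refl) = inj₁ q

  conn-bypass : ∀ {X u v e} → (∀ a b → Joins e a b → Conn (X - e) a b) → Conn X u v → Conn (X - e) u v
  conn-bypass {e = e} by c with conn-split e c
  ... | inj₁ c' = c'
  ... | inj₂ (a , b , j , p , q) = p ◅◅ by a b j ◅◅ q

  -- At most one crossing of the deleted link has to be considered, so reachability in `X` is a
  -- finite combination of reachability questions in `X - e`.
  conn? : ∀ X u v → Dec (Conn X u v)
  conn? = removal-induction (λ X → ∀ u v → Dec (Conn X u v)) base step
    where
    base : ∀ u v → Dec (Conn ∅ u v)
    base u v with u ≟ v
    ... | yes refl = yes ε
    ... | no u≢v = no λ { ε → u≢v refl ; ((e , i , _) ◅ _) → ∉⊥ i }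
    step : ∀ X e → e ∈ X → (∀ u v → Dec (Conn (X - e) u v)) → ∀ u v → Dec (Conn X u v)
    step X e i ih u v with view e
    ... | isHalf a t eq = map′ (conn-mono (p-x⊆p X e)) (conn-bypass λ a b j → contradiction (_ , _ , eq) (¬link-half (joins-link j))) (ih u v)
    ... | isLoose eq = map′ (conn-mono (p-x⊆p X e)) (conn-bypass λ a b j → contradiction eq (¬link-loose (joins-link j))) (ih u v)
    ... | joins a b j = map′ to from (ih u v ⊎-dec ((ih u a ×-dec ih b v) ⊎-dec (ih u b ×-dec ih a v)))
      where
      up : ∀ {u v} → Conn (X - e) u v → Conn X u v
      up = conn-mono (p-x⊆p X e)
      to : Conn (X - e) u v ⊎ (Conn (X - e) u a × Conn (X - e) b v) ⊎ (Conn (X - e) u b × Conn (X - e) a v) → Conn X u v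
      to (inj₁ c) = up c
      to (inj₂ (inj₁ (p , q))) = up p ◅◅ edge-conn i j ◅◅ up q
      to (inj₂ (inj₂ (p , q))) = up p ◅◅ edge-conn i (joins-sym j) ◅◅ up q
      from : Conn X u v → Conn (X - e) u v ⊎ (Conn (X - e) u a × Conn (X - e) b v) ⊎ (Conn (X - e) u b × Conn (X - e) a v)
      from c with conn-split e c
      ... | inj₁ c' = inj₁ c'
      ... | inj₂ (a' , b' , k , p , q) with joins-unique j k
      ... | inj₁ (refl , refl) = inj₂ (inj₁ (p , q))
      ... | inj₂ (refl , refl) = inj₂ (inj₂ (p , q))

  -- A link relates the values at its ends by a sign, so a solution is zero on a whole component or
  -- nowhere on it.
  sol-zero-conn : ∀ {X x u v} → Sol X x → Conn X u v → x u ≡ nothing → x v ≡ nothing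
  sol-zero-conn {X} {x} s = conn-closed λ {e} i j z → trans (sat-joins j (s e i)) (cong (σ e ⋆_) z)

-- Degrees, cuts and signs of circles.

module Products = Fold ·-isCommutativeMonoid
module Sums = Fold +-0-isCommutativeMonoid

infixr 8 _^_
_^_ : Sign → ℕ → Sign
s ^ zero = s+
s ^ suc k = s · s ^ k

^-+ : ∀ s j k → s ^ (j + k) ≡ s ^ j · s ^ k
^-+ s zero k = refl
^-+ s (suc j) k = trans (cong (s ·_) (^-+ s j k)) (sym (·-assoc s (s ^ j) (s ^ k)))

^-2 : ∀ s → s ^ 2 ≡ s+
^-2 s- = refl
^-2 s+ = refl

sign-cases : ∀ s → s ≡ s+ ⊎ s ≡ s-
sign-cases s+ = inj₁ refl
sign-cases s- = inj₂ refl

module Circles {c ℓ} (K : Field c ℓ) {n m : ℕ} (Υ : GSG K n m) where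
  open Gain K Υ hiding (F1; F2; P; x; y; fig1; fig2; x∈F1; y∈F2; disj; path; meet; union)
  open GSG Υ using (ends)
  open Incidence K Υ

  deg≡ : ∀ X v → deg X v ≡ Sums.foldOver X (λ e → endsAt e v)
  deg≡ X v = trans (unmap (allFin m)) (sym (Sums.foldOn≡foldMap X (λ e → endsAt e v) (allFin m)))
    where
    unmap : ∀ es → sum (map (Sums.weight X (λ e → endsAt e v)) es) ≡ Sums.foldMap (Sums.weight X (λ e → endsAt e v)) es
    unmap [] = refl
    unmap (e ∷ es) = cong (Sums.weight X (λ e → endsAt e v) e +_) (unmap es)

  deg-∪ : ∀ {X Y} v → (∀ e → e ∈ X → e ∉ Y) → deg (X ∪ Y) v ≡ deg X v + deg Y v
  deg-∪ {X} {Y} v disj = trans (deg≡ (X ∪ Y) v) (trans (Sums.foldOver-∪ {X = X} {Y = Y} (λ e → endsAt e v) disj) (sym (cong₂ _+_ (deg≡ X v) (deg≡ Y v))))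

  deg-⁅⁆ : ∀ e v → deg ⁅ e ⁆ v ≡ endsAt e v
  deg-⁅⁆ e v = trans (deg≡ ⁅ e ⁆ v) (Sums.foldOver-⁅⁆ e (λ e → endsAt e v))

  deg-⊆ : ∀ {X Y} v → X ⊆ Y → deg Y v ≡ deg X v + deg (Y ─ X) v
  deg-⊆ {X} {Y} v X⊆Y = trans (cong (λ Z → deg Z v) (∪-─ X⊆Y)) (deg-∪ v (λ e → disjoint-─ {p = X} {Y} e))

  deg-pos : ∀ {X e v} → e ∈ X → Inc e v → 1 ≤ deg X v
  deg-pos {X} {e} {v} i inc =
    ≤-trans inc (≤-trans (≤-reflexive (sym (deg-⁅⁆ e v))) (≤-trans (m≤m+n _ _) (≤-reflexive (sym (deg-⊆ v (⁅⁆⊆ i))))))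

  deg-zero : ∀ {X v} → ¬ VertexOf X v → deg X v ≡ 0
  deg-zero {X} {v} nv = trans (deg≡ X v) (Sums.foldOver-ε none)
    where
    none : ∀ e → e ∈ X → endsAt e v ≡ 0
    none e i with endsAt e v in eq
    ... | zero = refl
    ... | suc k = contradiction (e , i , subst (1 ≤_) (sym eq) (s≤s z≤n)) nv

  circle-deg≤2 : ∀ {C} → Circle C → ∀ v → deg C v ≤ 2
  circle-deg≤2 (_ , _ , d , _) v with d v
  ... | inj₁ z = ≤-trans (≤-reflexive z) z≤n
  ... | inj₂ t = ≤-reflexive t

  vertex-mono : ∀ {X Y v} → X ⊆ Y → VertexOf X v → VertexOf Y v
  vertex-mono X⊆Y (e , i , inc) = e , X⊆Y i , inc

  -- A nonempty 2-regular part of a circle absorbs every edge at each of its vertices.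
  subcircle : ∀ {Z F} → Circle F → Z ⊆ F → Nonempty Z → (∀ v → deg Z v ≡ 0 ⊎ deg Z v ≡ 2) → Z ≡ F
  subcircle {Z} {F} cF Z⊆F (e , e∈Z) dZ = ⊆-antisym Z⊆F F⊆Z
    where
    absorb : ∀ {w f} → VertexOf Z w → f ∈ F → Inc f w → f ∈ Z
    absorb {w} {f} (g , g∈Z , g-w) f∈F f-w with f ∈? Z
    ... | yes i = i
    ... | no f∉Z with dZ w
    ... | inj₁ z = contradiction (≤-trans (deg-pos g∈Z g-w) (≤-reflexive z)) λ ()
    ... | inj₂ t = contradiction (≤-trans three (circle-deg≤2 cF w)) 1+n≰n
      where
      three : 3 ≤ deg F w
      three = ≤-trans (+-monoʳ-≤ 2 (deg-pos (x∈p∧x∉q⇒x∈p─q f∈F f∉Z) f-w))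
                (≤-reflexive (trans (cong (_+ deg (F ─ Z) w) (sym t)) (sym (deg-⊆ w Z⊆F))))
    start : ∃₂ λ a b → Joins e a b
    start = link-joins (proj₁ (proj₂ cF) e (Z⊆F e∈Z))
    reach : ∀ {f} → f ∈ F → ∀ {w} → Inc f w → VertexOf Z w
    reach {f} i {w} inc with start
    ... | a , b , j = conn-closed
      (λ {g} g∈F k v → g , absorb v g∈F (joins-inc₁ k) , joins-inc₂ k)
      (proj₂ (proj₂ (proj₂ cF)) a w (e , Z⊆F e∈Z , joins-inc₁ j) (f , i , inc)) (e , e∈Z , joins-inc₁ j)
    F⊆Z : F ⊆ Z
    F⊆Z {f} i with link-joins (proj₁ (proj₂ cF) f i)
    ... | a , b , j = absorb (reach i (joins-inc₁ j)) i (joins-inc₁ j)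

  circle-⊆ : ∀ {C F} → Circle C → Circle F → C ⊆ F → C ≡ F
  circle-⊆ (ne , _ , d , _) cF C⊆F = subcircle cF C⊆F ne d

  -- The multiplicative coboundary of `y`: on a link it is - exactly if `y` separates the two ends.
  endProduct : (Fin n → Sign) → Fin m → Sign
  endProduct y e = go (ends e)
    where
    go : EdgeType n → Sign
    go (link a b _ _) = y a · y b
    go (half a _) = y a
    go loose = s+

  joins-endProduct : ∀ {e a b} y → Joins e a b → endProduct y e ≡ y a · y b
  joins-endProduct {e} y (_ , _ , inj₁ eq) rewrite eq = refl
  joins-endProduct {e} {a} {b} y (_ , _ , inj₂ eq) rewrite eq = ·-comm (y b) (y a)

  vertexProduct : (Fin n → Sign) → Sign
  vertexProduct f = Products.foldMap f (allFin n)

  vertexProduct-δ : ∀ (y : Fin n → Sign) a → vertexProduct (λ v → y v ^ δ a v) ≡ y a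
  vertexProduct-δ y a =
    trans (Products.foldMap-single (λ v → y v ^ δ a v) a (allFin n) (allFin⁺ n) (∈-allFin a) (λ v v≢a → cong (y v ^_) (δ-≢ (v≢a ∘ sym))))
      (trans (cong (y a ^_) (δ-refl a)) (·-identityʳ (y a)))

  endProduct≡ : ∀ y e → endProduct y e ≡ vertexProduct (λ v → y v ^ endsAt e v)
  endProduct≡ y e with view e
  ... | joins a b j = begin
    endProduct y e ≡⟨ joins-endProduct y j ⟩
    y a · y b ≡⟨ sym (cong₂ _·_ (vertexProduct-δ y a) (vertexProduct-δ y b)) ⟩
    vertexProduct (λ v → y v ^ δ a v) · vertexProduct (λ v → y v ^ δ b v)
      ≡⟨ sym (Products.foldMap-∙ (λ v → y v ^ δ a v) (λ v → y v ^ δ b v) (allFin n)) ⟩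
    vertexProduct (λ v → y v ^ δ a v · y v ^ δ b v)
      ≡⟨ Products.foldMap-cong (λ v → trans (sym (^-+ (y v) (δ a v) (δ b v))) (cong (y v ^_) (sym (joins-endsAt j v)))) (allFin n) ⟩
    vertexProduct (λ v → y v ^ endsAt e v) ∎
    where open ≡-Reasoning
  ... | isHalf a t eq =
    trans half-product (trans (sym (vertexProduct-δ y a)) (Products.foldMap-cong (λ v → cong (y v ^_) (sym (endsAt-half eq v))) (allFin n)))
    where
    half-product : endProduct y e ≡ y a
    half-product rewrite eq = refl
  ... | isLoose eq =
    trans loose-product (sym (Products.foldMap-ε (λ v → cong (y v ^_) (endsAt-loose eq v)) (allFin n)))
    where
    loose-product : endProduct y e ≡ s+
    loose-product rewrite eq = refl

  -- Both sides are one product in two orders: the factor `y v` occurs once for each edge end at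
  -- `v`.
  double-count : ∀ X y → Products.foldOver X (endProduct y) ≡ vertexProduct (λ v → y v ^ deg X v)
  double-count X y =
    trans (go (allFin m)) (Products.foldMap-cong (λ v → cong (y v ^_) (sym (deg≡ X v))) (allFin n))
    where
    go : ∀ es → Products.foldOn X (endProduct y) es ≡ vertexProduct (λ v → y v ^ Sums.foldOn X (λ e → endsAt e v) es)
    go [] = sym (Products.foldMap-ε (λ _ → refl) (allFin n))
    go (e ∷ es) with lookup X e
    ... | false = go es
    ... | true = begin
      endProduct y e · Products.foldOn X (endProduct y) es ≡⟨ cong₂ _·_ (endProduct≡ y e) (go es) ⟩
      vertexProduct (λ v → y v ^ endsAt e v) · vertexProduct (λ v → y v ^ Sums.foldOn X (λ e → endsAt e v) es)
        ≡⟨ sym (Products.foldMap-∙ (λ v → y v ^ endsAt e v) (λ v → y v ^ Sums.foldOn X (λ e → endsAt e v) es) (allFin n)) ⟩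
      vertexProduct (λ v → y v ^ endsAt e v · y v ^ Sums.foldOn X (λ e → endsAt e v) es)
        ≡⟨ Products.foldMap-cong (λ v → sym (^-+ (y v) (endsAt e v) _)) (allFin n) ⟩
      vertexProduct (λ v → y v ^ (endsAt e v + Sums.foldOn X (λ e → endsAt e v) es)) ∎
      where open ≡-Reasoning

  circle-product : ∀ {C} → Circle C → ∀ y → Products.foldOver C (endProduct y) ≡ s+
  circle-product {C} (_ , _ , d , _) y = trans (double-count C y) (Products.foldMap-ε even (allFin n))
    where
    even : ∀ v → y v ^ deg C v ≡ s+
    even v with d v
    ... | inj₁ z = cong (y v ^_) z
    ... | inj₂ t = trans (cong (y v ^_) t) (^-2 (y v))

  -- The sign indicator of the component of `u` in `X`. Its coboundary is + on all links of `X`, so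
  -- a cut can only use other links.
  side : ∀ X (u : Fin n) → Fin n → Sign
  side X u v with conn? X u v
  ... | yes _ = s-
  ... | no _ = s+

  side-in : ∀ {X u v} → Conn X u v → side X u v ≡ s-
  side-in {X} {u} {v} p with conn? X u v
  ... | yes _ = refl
  ... | no ¬p = contradiction p ¬p

  side-conn : ∀ {X u v} → side X u v ≡ s- → Conn X u v
  side-conn {X} {u} {v} eq with conn? X u v
  ... | yes q = q

  side-uncut : ∀ {X u e a b} → e ∈ X → Joins e a b → endProduct (side X u) e ≡ s+
  side-uncut {X} {u} {e} {a} {b} i j = trans (joins-endProduct _ j) same
    where
    same : side X u a · side X u b ≡ s+
    same with conn? X u a | conn? X u b
    ... | yes _ | yes _ = refl
    ... | no _ | no _ = refl
    ... | yes p | no q = contradiction (p ◅◅ edge-conn i j) q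
    ... | no p | yes q = contradiction (q ◅◅ edge-conn i (joins-sym j)) p

  -- A circle has no bridge: the component of a in C - e would give a cut crossed by e alone,
  -- while every cut of a circle is even.
  circle-bypass : ∀ {C e a b} → Circle C → e ∈ C → Joins e a b → Conn (C - e) a b
  circle-bypass {C} {e} {a} {b} cC i j = side-conn (cut-even (y b)
    (trans (sym total) (trans (joins-endProduct y j) (cong (_· y b) (side-in {X = C - e} ε)))))
    where
    y : Fin n → Sign
    y = side (C - e) a
    total : endProduct y e ≡ s+
    total = trans (sym (Products.foldOver-single (endProduct y) i λ e' i' ne →
      side-uncut (x∈p∧x≢y⇒x∈p-y i' ne) (proj₂ (proj₂ (link-joins (proj₁ (proj₂ cC) e' i')))))) (circle-product cC y)
    cut-even : ∀ s → s+ ≡ s- · s → s ≡ s-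
    cut-even s- _ = refl

  -- On a link it is + exactly if `just ∘ y` satisfies the equation of the link. The coboundary
  -- multiplies to + over a circle, so the defects multiply to the sign of the circle.
  defect : (Fin n → Sign) → Fin m → Sign
  defect y e = σ e · endProduct y e

  signOf≡defects : ∀ {C} → Circle C → ∀ y → signOf C ≡ Products.foldOver C (defect y)
  signOf≡defects {C} cC y = sym (trans (Products.foldOver-∙ C σ (endProduct y))
    (trans (cong (signOf C ·_) (circle-product cC y)) (·-identityʳ (signOf C))))

  private
    defect-solves : ∀ s a b → b ≡ s · a → s · (a · b) ≡ s+
    defect-solves s+ s+ b refl = refl
    defect-solves s+ s- b refl = refl
    defect-solves s- s+ b refl = refl
    defect-solves s- s- b refl = refl

    solves-defect : ∀ s a b → s · (a · b) ≡ s+ → b ≡ s · a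
    solves-defect s+ s+ s+ refl = refl
    solves-defect s+ s- s- refl = refl
    solves-defect s- s+ s- refl = refl
    solves-defect s- s- s+ refl = refl

  sat-defect : ∀ {e a b} y → Joins e a b → Sat e (just ∘ y) → defect y e ≡ s+
  sat-defect {e} {a} {b} y j q =
    trans (cong (σ e ·_) (joins-endProduct y j)) (defect-solves (σ e) (y a) (y b) (just-injective (sat-joins j q)))

  defect-sat : ∀ {e a b} y → Joins e a b → defect y e ≡ s+ → Sat e (just ∘ y)
  defect-sat {e} {a} {b} y j q =
    joins-sat j (cong just (solves-defect (σ e) (y a) (y b) (trans (cong (σ e ·_) (sym (joins-endProduct y j))) q)))

  -- All edges but `e` have defect +, which leaves the whole sign of the circle to `e`.
  circle-defect : ∀ {C e} y → Circle C → e ∈ C → Sol (C - e) (just ∘ y) → signOf C ≡ defect y e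
  circle-defect {C} {e} y cC i p = trans (signOf≡defects cC y) (Products.foldOver-single (defect y) i λ e' i' ne →
    sat-defect y (proj₂ (proj₂ (link-joins (proj₁ (proj₂ cC) e' i')))) (p e' (x∈p∧x≢y⇒x∈p-y i' ne)))

  balanced-circle : ∀ {C} y → Circle C → Sol C (just ∘ y) → signOf C ≡ s+
  balanced-circle {C} y cC@((e , i) , L , _) p =
    trans (circle-defect y cC i (sol-mono (p-x⊆p C e) p)) (sat-defect y (proj₂ (proj₂ (link-joins (L e i)))) (p e i))

  sat-local : ∀ {e a b x x'} → Joins e a b → x a ≡ x' a → x b ≡ x' b → Sat e x → Sat e x'
  sat-local {e} j p q s = joins-sat j (trans (sym q) (trans (sat-joins j s) (cong (σ e ⋆_) p)))

  private
    -- `C - e` still connects all vertices of the circle, so a solution on it that is nonzero at one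
    -- of them is nonzero at all and acts as a sign function there.
    module Nonvanishing {C e a} (cC : Circle C) (e∈C : e ∈ C) (e-a : Inc e a) {x} (p : Sol (C - e) x) (xa≢0 : x a ≢ nothing) where
      y : Fin n → Sign
      -- The default is read only off the circle, where its value does not affect any equation in
      -- use.
      y v = fromMaybe s+ (x v)

      conn : ∀ {v} → VertexOf C v → Conn (C - e) a v
      conn {v} vv = conn-bypass (λ _ _ → circle-bypass cC e∈C) (proj₂ (proj₂ (proj₂ cC)) a v (e , e∈C , e-a) vv)

      x≡y : ∀ {v} → VertexOf C v → x v ≡ just (y v)
      x≡y {v} vv with x v in eq
      ... | just s = refl
      ... | nothing = contradiction (sol-zero-conn p (conn-sym (conn vv)) eq) xa≢0

      x≡y-on : ∀ {e' b d} → e' ∈ C → Joins e' b d → x b ≡ just (y b) × x d ≡ just (y d)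
      x≡y-on i j = x≡y (_ , i , joins-inc₁ j) , x≡y (_ , i , joins-inc₂ j)

      y-sol : Sol (C - e) (just ∘ y)
      y-sol e' i' with link-joins (proj₁ (proj₂ cC) e' (p-x⊆p C e i'))
      ... | b , d , j with x≡y-on (p-x⊆p C e i') j
      ... | q , r = sat-local j q r (p e' i')

      e-defect : signOf C ≡ defect y e
      e-defect = circle-defect y cC e∈C y-sol

  -- A zero at one end of `e` reaches the other end along the rest of the circle. Without zeros, `x`
  -- is a sign function and the defect of `e` is the sign of the circle.
  positive-circle-implies : ∀ {C e} → PosCircle C → e ∈ C → ∀ x → Sol (C - e) x → Sat e x
  positive-circle-implies {C} {e} (cC , pos) i x p with link-joins (proj₁ (proj₂ cC) e i)
  ... | a , b , j with zero? (x a)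
  ... | yes z = joins-sat j (trans (sol-zero-conn p (circle-bypass cC i j) z) (cong (σ e ⋆_) (sym z)))
  ... | no nz = sat-local j (sym q) (sym r) (defect-sat y j (trans (sym e-defect) pos))
    where
    open Nonvanishing cC i (joins-inc₁ j) p nz
    q = proj₁ (x≡y-on i j)
    r = proj₂ (x≡y-on i j)

  -- A nonzero value would turn `x` into a sign function without defects on the circle, whose sign
  -- would then be +.
  negative-circle-forces : ∀ {C} → Circle C → signOf C ≡ s- → ∀ x → Sol C x → ∀ v → VertexOf C v → x v ≡ nothing
  negative-circle-forces {C} cC neg x p v (e , i , inc) with zero? (x v)
  ... | yes z = z
  ... | no nz with inc-link-joins (proj₁ (proj₂ cC) e i) inc
  ... | b , j = contradiction (trans (sym neg) (trans e-defect (sat-defect y j (sat-local j q r (p e i))))) λ ()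
    where
    open Nonvanishing cC i inc (sol-mono (p-x⊆p C e) p) nz
    q = proj₁ (x≡y-on i j)
    r = proj₂ (x≡y-on i j)

  negative-figure-forces : ∀ {F} → NegFigure F → ∀ x → Sol F x → ∀ v → VertexOf F v → x v ≡ nothing
  negative-figure-forces (inj₁ (cF , neg)) x p v vv = negative-circle-forces cF neg x p v vv
  negative-figure-forces (inj₂ (h , (a , t , eq) , refl)) x p v (e , i , inc) with x∈⁅y⁆⇒x≡y h i
  ... | refl with inc-half eq inc
  ... | refl = sat-half eq (p h i)

  neg-figure : ∀ {F} → NegFigure F → Figure F
  neg-figure (inj₁ (cF , _)) = inj₁ cF
  neg-figure (inj₂ hF) = inj₂ hF

  figure-sign : ∀ {F} → Figure F → PosCircle F ⊎ NegFigure F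
  figure-sign (inj₂ hF) = inj₂ (inj₂ hF)
  figure-sign {F} (inj₁ cF) with sign-cases (signOf F)
  ... | inj₁ eq = inj₁ (cF , eq)
  ... | inj₂ eq = inj₂ (inj₁ (cF , eq))

  figure-nonempty : ∀ {F} → Figure F → Nonempty F
  figure-nonempty (inj₁ (ne , _)) = ne
  figure-nonempty (inj₂ (h , _ , refl)) = h , x∈⁅x⁆ h

  figure-edge : ∀ {F e} → Figure F → e ∈ F → IsLink e ⊎ IsHalf e
  figure-edge (inj₁ (_ , L , _)) i = inj₁ (L _ i)
  figure-edge (inj₂ (h , H , refl)) i with x∈⁅y⁆⇒x≡y h i
  ... | refl = inj₂ H

  figure-connected : ∀ {F} → Figure F → Connected F
  figure-connected (inj₁ (_ , _ , _ , con)) = con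
  figure-connected (inj₂ (h , (a , t , eq) , refl)) u v (e , i , p) (e' , i' , q) with x∈⁅y⁆⇒x≡y h i | x∈⁅y⁆⇒x≡y h i'
  ... | refl | refl with inc-half eq p | inc-half eq q
  ... | refl | refl = ε

  figure-vertex : ∀ {F} → Figure F → ∃ λ v → VertexOf F v
  figure-vertex fF with figure-nonempty fF
  ... | e , i with figure-edge fF i
  ... | inj₁ l = _ , e , i , joins-inc₁ (proj₂ (proj₂ (link-joins l)))
  ... | inj₂ (a , t , eq) = a , e , i , half-inc eq

  -- No edge of a figure is a bridge: a circle edge has the rest of its circle as a detour, and a
  -- half edge carries no connection.
  figure-bypass : ∀ {F e Y u v} → Figure F → e ∈ F → F ⊆ Y → Conn Y u v → Conn (Y - e) u v
  figure-bypass {F} {e} {Y} fF i F⊆Y = conn-bypass (by fF)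
    where
    by : Figure F → ∀ a b → Joins e a b → Conn (Y - e) a b
    by (inj₁ cF) a b j = conn-mono (-⊆-mono e F⊆Y) (circle-bypass cF i j)
    by (inj₂ (h , H , refl)) a b j with x∈⁅y⁆⇒x≡y h i
    ... | refl = contradiction H (¬link-half (joins-link j))

  figure-⊆ : ∀ {C F} → Figure C → Figure F → C ⊆ F → C ≡ F
  figure-⊆ (inj₁ cC) (inj₁ cF) C⊆F = circle-⊆ cC cF C⊆F
  figure-⊆ (inj₁ ((e , i) , L , _)) (inj₂ (h , H , refl)) C⊆F with x∈⁅y⁆⇒x≡y h (C⊆F i)
  ... | refl = contradiction H (¬link-half (L e i))
  figure-⊆ (inj₂ (h , H , refl)) (inj₁ (_ , L , _)) C⊆F = contradiction H (¬link-half (L h (C⊆F (x∈⁅x⁆ h))))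
  figure-⊆ (inj₂ (h , H , refl)) (inj₂ (h' , _ , refl)) C⊆F with x∈⁅y⁆⇒x≡y h' (C⊆F (x∈⁅x⁆ h))
  ... | refl = refl

-- Trails, paths, and the circles closed or cut by them.

-- Opaque, so that es can be recovered from toSet es by unification.
opaque
  toSet : ∀ {k} → List (Fin k) → Subset k
  toSet = foldr (λ e X → ⁅ e ⁆ ∪ X) ∅

  toSet-[] : ∀ {k} → toSet {k} [] ≡ ∅
  toSet-[] = refl

  toSet-∷ : ∀ {k} (e : Fin k) es → toSet (e ∷ es) ≡ ⁅ e ⁆ ∪ toSet es
  toSet-∷ e es = refl

toSet⁺ : ∀ {k} {es : List (Fin k)} {e} → e ∈ₗ es → e ∈ toSet es
toSet⁺ {es = e' ∷ es} {e} i rewrite toSet-∷ e' es with i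
... | here refl = ∈∪ˡ ⁅ e ⁆ (toSet es) (x∈⁅x⁆ e)
... | there j = ∈∪ʳ ⁅ e' ⁆ (toSet es) (toSet⁺ j)

toSet⁻ : ∀ {k} {es : List (Fin k)} {e} → e ∈ toSet es → e ∈ₗ es
toSet⁻ {es = []} {e} i = contradiction (subst (e ∈_) toSet-[] i) ∉⊥
toSet⁻ {es = e' ∷ es} {e} i with x∈p∪q⁻ ⁅ e' ⁆ (toSet es) (subst (e ∈_) (toSet-∷ e' es) i)
... | inj₁ j = here (x∈⁅y⁆⇒x≡y e' j)
... | inj₂ j = there (toSet⁻ j)

toSet-disjoint : ∀ {k} {es : List (Fin k)} {e} → e ∉ₗ es → ∀ e' → e' ∈ ⁅ e ⁆ → e' ∉ toSet es
toSet-disjoint {e = e} e∉ e' i j with x∈⁅y⁆⇒x≡y e i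
... | refl = e∉ (toSet⁻ j)

unique-head : {A : Set} {a : A} {as : List A} → Unique (a ∷ as) → a ∉ₗ as
unique-head (p ∷ _) i = All-lookup p i refl

unique-tail : {A : Set} {a : A} {as : List A} → Unique (a ∷ as) → Unique as
unique-tail (_ ∷ u) = u

unique-cons : {A : Set} {a : A} {as : List A} → a ∉ₗ as → Unique as → Unique (a ∷ as)
unique-cons a∉ u = All-tabulate (λ { i refl → a∉ i }) ∷ u

count : ∀ {n} → Fin n → List (Fin n) → ℕ
count v [] = 0
count v (u ∷ us) = δ u v + count v us

count-∉ : ∀ {n} {v : Fin n} us → v ∉ₗ us → count v us ≡ 0
count-∉ [] _ = refl
count-∉ {v = v} (u ∷ us) v∉ rewrite δ-≢ {a = u} {v} (λ { refl → v∉ (here refl) }) = count-∉ us (v∉ ∘ there)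

count-∈ : ∀ {n} {v : Fin n} {us} → Unique us → v ∈ₗ us → count v us ≡ 1
count-∈ {us = u ∷ us} uq (here refl) rewrite δ-refl u = cong suc (count-∉ us (unique-head uq))
count-∈ {v = v} {us = u ∷ us} uq (there i) rewrite δ-≢ {a = u} {v} (λ { refl → unique-head uq i }) = count-∈ (unique-tail uq) i

_∈ₗ?_ : ∀ {n} (v : Fin n) us → Dec (v ∈ₗ us)
v ∈ₗ? us with v ∈? toSet us
... | yes i = yes (toSet⁻ i)
... | no ¬i = no (¬i ∘ toSet⁺)

module Trails {c ℓ} (K : Field c ℓ) {n m : ℕ} (Υ : GSG K n m) where
  open Gain K Υ hiding (F1; F2; P; x; y; fig1; fig2; x∈F1; y∈F2; disj; path; meet; union)
  open GSG Υ using (ends)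
  open Incidence K Υ
  open Circles K Υ

  -- Walks with their edges and vertices as indices and the directions of the steps forgotten;
  -- freedom from repetition is a separate `Unique` hypothesis.
  data Trail : Fin n → List (Fin m) → List (Fin n) → Fin n → Set where
    [] : ∀ {u} → Trail u [] (u ∷ []) u
    _∷_ : ∀ {u v w e es vs} → Joins e u v → Trail v es vs w → Trail u (e ∷ es) (u ∷ vs) w

  private
    step-joins : ∀ e d {u v s} → stepData e d ≡ just (u , v , s) → Joins e u v × stepTo u e d ≡ v
    step-joins e d eq with ends e in eq'
    step-joins e true refl | link a b s t = (s , t , inj₁ refl) , refl
    step-joins e false refl | link a b s t = (s , t , inj₂ refl) , refl

    joins-step : ∀ {e u v} → Joins e u v → ∃₂ λ d s → stepData e d ≡ just (u , v , s)
    joins-step (s , t , inj₁ eq) rewrite eq = true , s , refl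
    joins-step (s , t , inj₂ eq) rewrite eq = false , t , refl

  walk-trail : ∀ {u w} ws → WalkFrom u ws w → Trail u (edgesOf ws) (walkVerts u ws) w
  walk-trail [] refl = []
  walk-trail ((e , d) ∷ ws) (v , s , eq , W) with step-joins e d eq
  ... | j , refl = j ∷ walk-trail ws W

  trail-walk : ∀ {u es vs w} → Trail u es vs w → ∃ λ ws → WalkFrom u ws w × edgesOf ws ≡ es × walkVerts u ws ≡ vs
  trail-walk [] = [] , refl , refl , refl
  trail-walk (_∷_ {u} {v} {e = e} j t) with joins-step j | trail-walk t
  ... | d , s , eq | ws , W , refl , refl =
    (e , d) ∷ ws , (v , s , eq , W) , refl , cong (λ z → u ∷ walkVerts z ws) (proj₂ (step-joins e d eq))

  start∈ : ∀ {u es vs w} → Trail u es vs w → u ∈ₗ vs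
  start∈ [] = here refl
  start∈ (_ ∷ _) = here refl

  end∈ : ∀ {u es vs w} → Trail u es vs w → w ∈ₗ vs
  end∈ [] = here refl
  end∈ (_ ∷ t) = there (end∈ t)

  trail-inc : ∀ {u es vs w e z} → Trail u es vs w → e ∈ₗ es → Inc e z → z ∈ₗ vs
  trail-inc (j ∷ t) (here refl) inc with inc-joins j inc
  ... | inj₁ refl = here refl
  ... | inj₂ refl = there (start∈ t)
  trail-inc (j ∷ t) (there i) inc = there (trail-inc t i inc)

  trail-vertex : ∀ {u es vs w z} → Trail u es vs w → VertexOf (toSet es) z → z ∈ₗ vs
  trail-vertex t (e , i , inc) = trail-inc t (toSet⁻ i) inc

  trail-links : ∀ {u es vs w e} → Trail u es vs w → e ∈ₗ es → IsLink e
  trail-links (j ∷ t) (here refl) = joins-link j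
  trail-links (j ∷ t) (there i) = trail-links t i

  -- The hypothesis `u ≢ w` excludes the trivial trail, whose vertex meets no edge. It is not
  -- inherited by the tail, so the recursion goes through `inner`, which asks for a nonempty edge
  -- list instead.
  vertex-trail : ∀ {u es vs w z} → Trail u es vs w → u ≢ w → z ∈ₗ vs → VertexOf (toSet es) z
  vertex-trail [] u≢w _ = contradiction refl u≢w
  vertex-trail {es = e ∷ es} (j ∷ t) _ (here refl) = e , toSet⁺ (here refl) , joins-inc₁ j
  vertex-trail {es = e ∷ .[]} (j ∷ []) _ (there (here refl)) = e , toSet⁺ (here refl) , joins-inc₂ j
  vertex-trail {es = e ∷ es} (j ∷ (k ∷ t)) _ (there (here refl)) = e , toSet⁺ (here refl) , joins-inc₂ j
  vertex-trail {es = e ∷ e' ∷ es} (j ∷ (k ∷ [])) _ (there (there (here refl))) = e' , toSet⁺ (there (here refl)) , joins-inc₂ k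
  vertex-trail {es = e ∷ e' ∷ es} (j ∷ (k ∷ t@(l ∷ t'))) _ (there (there i)) = lift (inner t i)
    where
    lift : ∀ {z} → VertexOf (toSet es) z → VertexOf (toSet (e ∷ e' ∷ es)) z
    lift (f , i , inc) = f , toSet⁺ (there (there (toSet⁻ i))) , inc
    inner : ∀ {u f es vs w z} → Trail u (f ∷ es) vs w → z ∈ₗ vs → VertexOf (toSet (f ∷ es)) z
    inner {f = f} (j ∷ t) (here refl) = f , toSet⁺ (here refl) , joins-inc₁ j
    inner {f = f} (j ∷ []) (there (here refl)) = f , toSet⁺ (here refl) , joins-inc₂ j
    inner {f = f} (j ∷ t@(_ ∷ _)) (there i) with inner t i
    ... | g , k , inc = g , toSet⁺ (there (toSet⁻ k)) , inc

  trail-conn : ∀ {X u es vs w z} → Trail u es vs w → (∀ {e} → e ∈ₗ es → e ∈ X) → z ∈ₗ vs → Conn X u z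
  trail-conn [] _ (here refl) = ε
  trail-conn (j ∷ t) _ (here refl) = ε
  trail-conn (j ∷ t) sub (there i) = (_ , sub (here refl) , j) ◅ trail-conn t (sub ∘ there) i

  trail-edges-unique : ∀ {u es vs w} → Trail u es vs w → Unique vs → Unique es
  trail-edges-unique [] _ = []
  trail-edges-unique (j ∷ t) uq =
    unique-cons (λ i → unique-head uq (trail-inc t i (joins-inc₁ j))) (trail-edges-unique t (unique-tail uq))

  record Simple (X : Subset m) (u v : Fin n) : Set where
    constructor simple
    field
      {es} : List (Fin m)
      {vs} : List (Fin n)
      trail : Trail u es vs v
      distinct : Unique vs
      within : ∀ {e} → e ∈ₗ es → e ∈ X

  simple-suffix : ∀ {X u es vs w z} → Trail u es vs w → Unique vs → (∀ {e} → e ∈ₗ es → e ∈ X) → z ∈ₗ vs → Simple X z w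
  simple-suffix [] d s (here refl) = simple [] d s
  simple-suffix (j ∷ t) d s (here refl) = simple (j ∷ t) d s
  simple-suffix (j ∷ t) d s (there i) = simple-suffix t (unique-tail d) (s ∘ there) i

  simplify : ∀ {X u v} → Conn X u v → Simple X u v
  simplify ε = simple [] ([] ∷ []) λ ()
  simplify {u = u} ((e , i , j) ◅ c) with simplify c
  ... | simple {vs = vs} t d s with u ∈ₗ? vs
  ... | yes u∈ = simple-suffix t d s u∈
  ... | no u∉ = simple (j ∷ t) (unique-cons u∉ d) λ { (here refl) → i ; (there k) → s k }

  path-simple : ∀ {P u v} → Path P u v → Σ (Simple P u v) λ p → P ≡ toSet (Simple.es p)
  path-simple {P} (ws , W , (uq , mem) , d) =
    simple (walk-trail ws W) d (Equivalence.from (mem _)) ,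
    ⊆-antisym (toSet⁺ ∘ Equivalence.to (mem _)) (λ i → Equivalence.from (mem _) (toSet⁻ i))

  trail-path : ∀ {u es vs w} → Trail u es vs w → Unique vs → Path (toSet es) u w
  trail-path t d with trail-walk t
  ... | ws , W , refl , refl = ws , W , (trail-edges-unique t d , λ e → mk⇔ toSet⁻ toSet⁺) , d

  deg-[] : ∀ v → deg (toSet []) v ≡ 0
  deg-[] v = deg-zero λ { (_ , i , _) → contradiction (toSet⁻ i) λ () }

  deg-cons : ∀ {e es} v → e ∉ₗ es → deg (toSet (e ∷ es)) v ≡ endsAt e v + deg (toSet es) v
  deg-cons {e} {es} v e∉ = trans (cong (λ X → deg X v) (toSet-∷ e es)) (trans (deg-∪ v (toSet-disjoint e∉)) (cong (_+ deg (toSet es) v) (deg-⁅⁆ e v)))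

  -- Each visit to `v` uses two edge ends, except that one is missing at the start and one at the
  -- end. Adding these on the left avoids subtraction.
  trail-deg : ∀ {u es vs w} v → Trail u es vs w → Unique es → deg (toSet es) v + (δ u v + δ w v) ≡ count v vs + count v vs
  trail-deg {u} v [] _ rewrite deg-[] v | +-identityʳ (δ u v) = refl
  trail-deg v (_∷_ {u} {u'} {w} {e} {es} {vs} j t) d = begin
    deg (toSet (e ∷ es)) v + (δ u v + δ w v)
      ≡⟨ cong (_+ (δ u v + δ w v)) (trans (deg-cons v (unique-head d)) (cong (_+ deg (toSet es) v) (joins-endsAt j v))) ⟩
    δ u v + δ u' v + deg (toSet es) v + (δ u v + δ w v)
      ≡⟨ solve 4 (λ a b d c → a :+ b :+ d :+ (a :+ c) := a :+ a :+ (d :+ (b :+ c))) refl (δ u v) (δ u' v) (deg (toSet es) v) (δ w v) ⟩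
    δ u v + δ u v + (deg (toSet es) v + (δ u' v + δ w v))
      ≡⟨ cong (δ u v + δ u v +_) (trail-deg v t (unique-tail d)) ⟩
    δ u v + δ u v + (count v vs + count v vs)
      ≡⟨ solve 2 (λ a b → a :+ a :+ (b :+ b) := a :+ b :+ (a :+ b)) refl (δ u v) (count v vs) ⟩
    δ u v + count v vs + (δ u v + count v vs) ∎
    where
    open ≡-Reasoning
    open +-*-Solver

  -- The product telescopes, since each inner vertex contributes a square.
  trail-product : ∀ {u es vs w} (y : Fin n → Sign) → Trail u es vs w → Unique es → Products.foldOver (toSet es) (endProduct y) ≡ y u · y w
  trail-product {u} y [] _ = trans (Products.foldOver-ε {X = toSet []} {f = endProduct y} λ e i → contradiction (toSet⁻ i) λ ()) (sym (s·s≡+ (y u)))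
  trail-product y (_∷_ {u} {v} {w} {e} {es} j t) d = begin
    Products.foldOver (toSet (e ∷ es)) (endProduct y)
      ≡⟨ cong (λ X → Products.foldOver X (endProduct y)) (toSet-∷ e es) ⟩
    Products.foldOver (⁅ e ⁆ ∪ toSet es) (endProduct y)
      ≡⟨ Products.foldOver-∪ {X = ⁅ e ⁆} {Y = toSet es} (endProduct y) (toSet-disjoint (unique-head d)) ⟩
    Products.foldOver ⁅ e ⁆ (endProduct y) · Products.foldOver (toSet es) (endProduct y)
      ≡⟨ cong₂ _·_ (trans (Products.foldOver-⁅⁆ e (endProduct y)) (joins-endProduct y j)) (trail-product y t (unique-tail d)) ⟩
    y u · y v · (y v · y w)
      ≡⟨ ·-assoc (y u) (y v) _ ⟩
    y u · (y v · (y v · y w))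
      ≡⟨ cong (y u ·_) (trans (sym (·-assoc (y v) (y v) (y w))) (cong (_· y w) (s·s≡+ (y v)))) ⟩
    y u · y w ∎
    where open ≡-Reasoning

  ∅-or-two : ∀ {d} (v : Fin n) vs → Unique vs → d ≡ count v vs + count v vs → d ≡ 0 ⊎ d ≡ 2
  ∅-or-two v vs uq eq with v ∈ₗ? vs
  ... | yes i = inj₂ (trans eq (cong (λ z → z + z) (count-∈ uq i)))
  ... | no ni = inj₁ (trans eq (cong (λ z → z + z) (count-∉ vs ni)))

  circle-close : ∀ {a b e es vs} → Trail b es vs a → Unique vs → Joins e a b → e ∉ₗ es → Circle (toSet (e ∷ es))
  circle-close {a} {b} {e} {es} {vs} t d j e∉ = (e , toSet⁺ (here refl)) , links , degs , con
    where
    links : ∀ f → f ∈ toSet (e ∷ es) → IsLink f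
    links f i with toSet⁻ {es = e ∷ es} i
    ... | here refl = joins-link j
    ... | there k = trail-links t k
    degs : ∀ v → deg (toSet (e ∷ es)) v ≡ 0 ⊎ deg (toSet (e ∷ es)) v ≡ 2
    -- The ends of `e` are exactly the two that the trail lacks at `a` and `b`.
    degs v = ∅-or-two v vs d (trans (deg-cons v e∉) (trans
      (trans (cong (_+ deg (toSet es) v) (trans (joins-endsAt j v) (+-comm (δ a v) (δ b v)))) (+-comm _ (deg (toSet es) v)))
      (trail-deg v t (trail-edges-unique t d))))
    vertex : ∀ {z} → VertexOf (toSet (e ∷ es)) z → z ∈ₗ vs
    vertex (f , i , inc) with toSet⁻ {es = e ∷ es} i
    ... | there k = trail-inc t k inc
    ... | here refl with inc-joins j inc
    ... | inj₁ refl = end∈ t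
    ... | inj₂ refl = start∈ t
    con : Connected (toSet (e ∷ es))
    con u v vu vv = conn-sym (reach (vertex vu)) ◅◅ reach (vertex vv)
      where
      reach : ∀ {z} → z ∈ₗ vs → Conn (toSet (e ∷ es)) b z
      reach = trail-conn t (toSet⁺ ∘ there)

  circle-through : ∀ {X e a b} → e ∈ X → Joins e a b → Conn (X - e) a b → ∃ λ C → Circle C × C ⊆ X × e ∈ C
  circle-through {X} {e} i j c with simplify (conn-sym c)
  ... | simple {es} t d s = toSet (e ∷ es) , circle-close t d j (λ k → proj₂ (∈-⁻ X (s k)) refl) , sub , toSet⁺ (here refl)
    where
    sub : toSet (e ∷ es) ⊆ X
    sub k with toSet⁻ {es = e ∷ es} k
    ... | here refl = i
    ... | there l = p-x⊆p X e (s l)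

  -- Each path lacks one edge end at `u` and one at `v`, which makes the joint degree there 4 - 2;
  -- any other vertex lies on at most one of the paths.
  circle-join : ∀ {P Q u v} → Path P u v → Path Q u v → u ≢ v → Empty (P ∩ Q)
    → (∀ w → VertexOf P w → VertexOf Q w → w ≡ u ⊎ w ≡ v) → Circle (P ∪ Q)
  circle-join {P} {Q} {u} {v} pathP pathQ u≢v disj int with path-simple pathP | path-simple pathQ
  ... | simple {es} {vs} t d s , refl | simple {es'} {vs'} t' d' s' , refl = nonempty t , links , degs , con
    where
    nonempty : ∀ {es vs} → Trail u es vs v → Nonempty (toSet es ∪ Q)
    nonempty [] = contradiction refl u≢v
    nonempty {e ∷ es} (_ ∷ _) = e , ∈∪ˡ (toSet (e ∷ es)) Q (toSet⁺ (here refl))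
    links : ∀ e → e ∈ P ∪ Q → IsLink e
    links e i with x∈p∪q⁻ P Q i
    ... | inj₁ k = trail-links t (toSet⁻ k)
    ... | inj₂ k = trail-links t' (toSet⁻ k)
    degrees : ∀ w → deg (P ∪ Q) w + (δ u w + δ v w + (δ u w + δ v w)) ≡ count w vs + count w vs + (count w vs' + count w vs')
    degrees w = trans (cong (_+ (δ u w + δ v w + (δ u w + δ v w))) (deg-∪ w (λ e i k → disj (e , x∈p∩q⁺ (i , k)))))
      (trans (Sums.interchange (deg P w) (deg Q w) (δ u w + δ v w) (δ u w + δ v w))
      (cong₂ _+_ (trail-deg w t (trail-edges-unique t d)) (trail-deg w t' (trail-edges-unique t' d'))))
    degs : ∀ w → deg (P ∪ Q) w ≡ 0 ⊎ deg (P ∪ Q) w ≡ 2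
    degs w with u ≟ w | v ≟ w | degrees w
    ... | yes refl | yes refl | _ = contradiction refl u≢v
    ... | yes refl | no _ | eq rewrite count-∈ d (start∈ t) | count-∈ d' (start∈ t') = inj₂ (+-cancelʳ-≡ 2 _ 2 eq)
    ... | no _ | yes refl | eq rewrite count-∈ d (end∈ t) | count-∈ d' (end∈ t') = inj₂ (+-cancelʳ-≡ 2 _ 2 eq)
    ... | no u≢w | no v≢w | eq rewrite +-identityʳ (deg (P ∪ Q) w) with w ∈ₗ? vs | w ∈ₗ? vs'
    ... | no ni | no ni' rewrite count-∉ vs ni | count-∉ vs' ni' = inj₁ eq
    ... | yes i | no ni' rewrite count-∈ d i | count-∉ vs' ni' = inj₂ eq
    ... | no ni | yes i' rewrite count-∉ vs ni | count-∈ d' i' = inj₂ eq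
    ... | yes i | yes i' with int w (vertex-trail t u≢v i) (vertex-trail t' u≢v i')
    ... | inj₁ w≡u = contradiction (sym w≡u) u≢w
    ... | inj₂ w≡v = contradiction (sym w≡v) v≢w
    reach : ∀ {z} → VertexOf (P ∪ Q) z → Conn (P ∪ Q) u z
    reach (e , i , inc) with x∈p∪q⁻ P Q i
    ... | inj₁ k = trail-conn t (∈∪ˡ P Q ∘ s) (trail-inc t (toSet⁻ k) inc)
    ... | inj₂ k = trail-conn t' (∈∪ʳ P Q ∘ s') (trail-inc t' (toSet⁻ k) inc)
    con : Connected (P ∪ Q)
    con a b va vb = conn-sym (reach va) ◅◅ reach vb

  -- For the first arc `P`, any simple path in `F` will do. If `y` marks the component of `u` in
  -- `F ─ P`, then `F ─ P` contributes + to the product over the circle and `P` contributes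
  -- `y u · y v`; hence `y v` equals `y u`, and a second arc exists in `F ─ P`. The two arcs form a
  -- circle inside `F`, so they are all of it.
  circle-split : ∀ {F u v} → Circle F → u ≢ v → VertexOf F u → VertexOf F v
    → ∃₂ λ P Q → Path P u v × Path Q u v × Empty (P ∩ Q) × (∀ w → VertexOf P w → VertexOf Q w → w ≡ u ⊎ w ≡ v) × F ≡ P ∪ Q
  circle-split {F} {u} {v} cF u≢v vu vv with simplify (proj₂ (proj₂ (proj₂ cF)) u v vu vv)
  ... | simple {es} {vs} t d s with simplify rest-conn
    where
    P : Subset m
    P = toSet es
    y : Fin n → Sign
    y = side (F ─ P) u
    uncut : Products.foldOver (F ─ P) (endProduct y) ≡ s+
    uncut = Products.foldOver-ε λ e i → side-uncut i (proj₂ (proj₂ (link-joins (proj₁ (proj₂ cF) e (p─q⊆p F P i)))))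
    total : y u · y v ≡ s+
    total = begin
      y u · y v ≡⟨ sym (trail-product y t (trail-edges-unique t d)) ⟩
      Products.foldOver P (endProduct y) ≡⟨ sym (·-identityʳ _) ⟩
      Products.foldOver P (endProduct y) · s+ ≡⟨ cong (Products.foldOver P (endProduct y) ·_) (sym uncut) ⟩
      Products.foldOver P (endProduct y) · Products.foldOver (F ─ P) (endProduct y)
        ≡⟨ sym (Products.foldOver-∪ {X = P} {Y = F ─ P} (endProduct y) (λ e → disjoint-─ {p = P} {F} e)) ⟩
      Products.foldOver (P ∪ (F ─ P)) (endProduct y)
        ≡⟨ cong (λ X → Products.foldOver X (endProduct y)) (sym (∪-─ (λ i → s (toSet⁻ i)))) ⟩
      Products.foldOver F (endProduct y) ≡⟨ circle-product cF y ⟩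
      s+ ∎
      where open ≡-Reasoning
    flip : ∀ s → s- · s ≡ s+ → s ≡ s-
    flip s- _ = refl
    rest-conn : Conn (F ─ P) u v
    rest-conn = side-conn (flip (y v) (trans (cong (_· y v) (sym (side-in {X = F ─ P} ε))) total))
  ... | simple {es'} {vs'} t' d' s' =
    toSet es , toSet es' , trail-path t d , trail-path t' d' , disj , int , sym (circle-⊆ cPQ cF PQ⊆F)
    where
    P Q : Subset m
    P = toSet es
    Q = toSet es'
    P⊆F : P ⊆ F
    P⊆F i = s (toSet⁻ i)
    Q⊆F : Q ⊆ F
    Q⊆F i = p─q⊆p F P (s' (toSet⁻ i))
    PQ⊆F : P ∪ Q ⊆ F
    PQ⊆F = ∪-lub P⊆F Q⊆F
    disj : Empty (P ∩ Q)
    disj (e , i) with x∈p∩q⁻ P Q i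
    ... | k , l = proj₂ (∈─⁻ F P (s' (toSet⁻ l))) k
    two : ∀ {es vs w} → Trail u es vs v → Unique vs → VertexOf (toSet es) w → u ≢ w → v ≢ w → deg (toSet es) w ≡ 2
    two {es} {vs} {w} t d vw u≢w v≢w with trail-deg w t (trail-edges-unique t d)
    ... | eq rewrite δ-≢ u≢w | δ-≢ v≢w | +-identityʳ (deg (toSet es) w) | count-∈ d (trail-vertex t vw) = eq
    int : ∀ w → VertexOf P w → VertexOf Q w → w ≡ u ⊎ w ≡ v
    int w vP vQ with u ≟ w | v ≟ w
    ... | yes p | _ = inj₁ (sym p)
    ... | no _ | yes q = inj₂ (sym q)
    -- An inner vertex of both arcs would have degree 4 in a 2-regular set.
    ... | no u≢w | no v≢w = contradiction four (λ le → 1+n≰n (≤-trans (s≤s (s≤s (s≤s z≤n))) (≤-trans le (circle-deg≤2 cF w))))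
      where
      four : 4 ≤ deg F w
      four = ≤-trans (≤-reflexive (sym (cong₂ _+_ (two t d vP u≢w v≢w) (two t' d' vQ u≢w v≢w))))
        (≤-trans (≤-reflexive (sym (deg-∪ w (λ e i k → disj (e , x∈p∩q⁺ (i , k))))))
          (≤-trans (m≤m+n _ _) (≤-reflexive (sym (deg-⊆ w PQ⊆F)))))
    cPQ : Circle (P ∪ Q)
    cPQ = circle-join (trail-path t d) (trail-path t' d') u≢v disj int

  private
    opposite-≢ : ∀ s → s ≢ s+ → s ≡ s-
    opposite-≢ s- _ = refl
    opposite-≢ s+ p = contradiction refl p

    flip-solves : ∀ s a b → ¬ (just b ≡ s ⋆ just a) → just b ≡ s ⋆ just (opposite a)
    flip-solves s+ s+ s+ p = contradiction refl p
    flip-solves s+ s+ s- p = refl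
    flip-solves s+ s- s+ p = refl
    flip-solves s+ s- s- p = contradiction refl p
    flip-solves s- s+ s+ p = refl
    flip-solves s- s+ s- p = contradiction refl p
    flip-solves s- s- s+ p = contradiction refl p
    flip-solves s- s- s- p = refl

    both-flip : ∀ s a b → just b ≡ s ⋆ just a → just (opposite b) ≡ s ⋆ just (opposite a)
    both-flip s+ a b refl = refl
    both-flip s- s+ b refl = refl
    both-flip s- s- b refl = refl

  Potential : Subset m → (Fin n → Sign) → Set
  Potential X y = Sol X (just ∘ y)

  -- Harary's balance criterion as a dichotomy with witnesses on both sides. If the potential of
  -- `X - e` fails on a link `e` whose ends are connected in `X - e`, then `e` closes a circle whose
  -- sign is the defect of `e`.
  potential-or-negative : ∀ X → (∃ λ y → Potential X y) ⊎ (∃ λ F → NegFigure F × F ⊆ X)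
  potential-or-negative = removal-induction _ (inj₁ ((λ _ → s+) , λ e i → contradiction i ∉⊥)) step
    where
    step : ∀ X e → e ∈ X → (∃ λ y → Potential (X - e) y) ⊎ (∃ λ F → NegFigure F × F ⊆ X - e)
      → (∃ λ y → Potential X y) ⊎ (∃ λ F → NegFigure F × F ⊆ X)
    step X e i (inj₂ (F , nF , sub)) = inj₂ (F , nF , λ k → p-x⊆p X e (sub k))
    step X e i (inj₁ (y , p)) with view e
    ... | isLoose eq = inj₁ (y , sol-remove p (loose-sat eq))
    ... | isHalf a t eq = inj₂ (⁅ e ⁆ , inj₂ (e , (a , t , eq) , refl) , ⁅⁆⊆ i)
    ... | joins a b j with sat? e (just ∘ y)
    ... | yes q = inj₁ (y , sol-remove p q)
    ... | no nq with conn? (X - e) a b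
    ... | yes con with circle-through i j con
    ... | C , cC , C⊆X , e∈C = inj₂ (C , inj₁ (cC , opposite-≢ _ λ pos →
            nq (defect-sat y j (trans (sym (circle-defect y cC e∈C (sol-mono (-⊆-mono e C⊆X) p))) pos))) , C⊆X)
    -- Here `e` is a bridge. Switching `y` on the side of `a` preserves all equations of `X - e` and
    -- repairs that of `e`.
    step X e i (inj₁ (y , p)) | joins a b j | no nq | no ncon = inj₁ (y' , sol-remove p' q')
      where
      y' : Fin n → Sign
      y' v with conn? (X - e) a v
      ... | yes _ = opposite (y v)
      ... | no _ = y v
      y'-in : ∀ {v} → Conn (X - e) a v → y' v ≡ opposite (y v)
      y'-in {v} c with conn? (X - e) a v
      ... | yes _ = refl
      ... | no nc = contradiction c nc
      y'-out : ∀ {v} → ¬ Conn (X - e) a v → y' v ≡ y v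
      y'-out {v} nc with conn? (X - e) a v
      ... | yes c = contradiction c nc
      ... | no _ = refl
      q' : Sat e (just ∘ y')
      q' = joins-sat j (trans (cong just (y'-out ncon))
        (trans (flip-solves (σ e) (y a) (y b) (nq ∘ joins-sat j)) (cong (λ s → σ e ⋆ just s) (sym (y'-in ε)))))
      p' : Sol (X - e) (just ∘ y')
      p' f k with view f
      ... | isLoose eq = loose-sat eq
      ... | isHalf _ _ eq = contradiction (sat-half eq (p f k)) λ ()
      ... | joins u v l with conn? (X - e) a u
      ... | yes c = joins-sat l (trans (cong just (y'-in (c ◅◅ edge-conn k l)))
              (trans (both-flip (σ f) (y u) (y v) (sat-joins l (p f k))) (cong (λ s → σ f ⋆ just s) (sym (y'-in c)))))
      ... | no nc = joins-sat l (trans (cong just (y'-out λ c → nc (c ◅◅ edge-conn k (joins-sym l))))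
              (trans (sat-joins l (p f k)) (cong (λ s → σ f ⋆ just s) (sym (y'-out nc)))))

-- Components and solutions supported on one of them.

module Components {c ℓ} (K : Field c ℓ) {n m : ℕ} (Υ : GSG K n m) where
  open Gain K Υ hiding (F1; F2; P; x; y; fig1; fig2; x∈F1; y∈F2; disj; path; meet; union)
  open Incidence K Υ
  open Circles K Υ
  open Trails K Υ

  loose? : ∀ e → Dec (Loose e)
  loose? e with view e
  ... | joins a b j = no (¬link-loose (joins-link j))
  ... | isHalf a t eq = no (¬half-loose (a , t , eq))
  ... | isLoose eq = yes eq

  -- Opaque, like leads below, because unfolding the decision procedures makes type checking blow up.
  opaque
    component : ∀ S v → ∃ λ X → IsCompEdges S v X
    component S v = separate λ e → (e ∈? S) ×-dec (¬? (loose? e) ×-dec any? λ w → (1 ≤? endsAt e w) ×-dec conn? S w v)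

  inc-conn : ∀ {X e u w} → e ∈ X → Inc e u → Inc e w → Conn X u w
  inc-conn {e = e} i p q with view e
  ... | isLoose eq = contradiction p (¬inc-loose eq)
  ... | isHalf a t eq with inc-half eq p | inc-half eq q
  ... | refl | refl = ε
  inc-conn {e = e} i p q | joins a b j with inc-joins j p | inc-joins j q
  ... | inj₁ refl | inj₁ refl = ε
  ... | inj₂ refl | inj₂ refl = ε
  ... | inj₁ refl | inj₂ refl = edge-conn i j
  ... | inj₂ refl | inj₁ refl = edge-conn i (joins-sym j)

  nonloose-inc : ∀ {e} → ¬ Loose e → ∃ (Inc e)
  nonloose-inc {e} nl with view e
  ... | joins a b j = a , joins-inc₁ j
  ... | isHalf a t eq = a , half-inc eq
  ... | isLoose eq = contradiction eq nl

  conn-start : ∀ {X u v} → Conn X u v → u ≢ v → VertexOf X u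
  conn-start ε u≢v = contradiction refl u≢v
  conn-start ((e , i , j) ◅ _) _ = e , i , joins-inc₁ j

  figure-noloose : ∀ {F} → Figure F → NoLoose F
  figure-noloose fF e i with figure-edge fF i
  ... | inj₁ l = ¬link-loose l
  ... | inj₂ h = ¬half-loose h

  module Comp {S v X} (isC : IsCompEdges S v X) where
    member : ∀ {e} → e ∈ X → e ∈ S × ¬ Loose e × ∃ λ w → Inc e w × Conn S w v
    member {e} = Equivalence.to (isC e)

    ⊆S : X ⊆ S
    ⊆S i = proj₁ (member i)

    noloose : NoLoose X
    noloose e i = proj₁ (proj₂ (member i))

    absorb : ∀ {e w} → e ∈ S → Inc e w → Conn S w v → e ∈ X
    absorb {e} {w} i inc c = Equivalence.from (isC e) (i , (λ l → ¬inc-loose l inc) , w , inc , c)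

    conn-in : ∀ {w} → Conn S w v → Conn X w v
    conn-in ε = ε
    conn-in c@((e , i , j) ◅ c') = (e , absorb i (joins-inc₁ j) c , j) ◅ conn-in c'

    vertex-in : ∀ {u} → VertexOf X u → Conn S u v
    vertex-in (e , i , inc) with member i
    ... | e∈S , _ , w , inc' , c = inc-conn e∈S inc inc' ◅◅ c

    connected : Connected X
    connected u w vu vw = conn-in (vertex-in vu) ◅◅ conn-sym (conn-in (vertex-in vw))

    figure-in : ∀ {F w} → Figure F → F ⊆ S → VertexOf F w → Conn S w v → F ⊆ X
    figure-in {F} {w} fF F⊆S vw c {e} i with nonloose-inc (figure-noloose fF e i)
    ... | u , inc = absorb (F⊆S i) inc (conn-mono F⊆S (figure-connected fF u w (e , i , inc) vw) ◅◅ c)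

  component-unique : ∀ {S v X Y} → IsCompEdges S v X → IsCompEdges S v Y → X ≡ Y
  component-unique p q = ⊆-antisym (λ {e} → Equivalence.from (q e) ∘ Equivalence.to (p e)) (λ {e} → Equivalence.from (p e) ∘ Equivalence.to (q e))

  components-meet : ∀ {S v w X Y e} → IsCompEdges S v X → IsCompEdges S w Y → e ∈ X → e ∈ Y → X ≡ Y
  components-meet {S} {v} {w} {X} {Y} {e} p q i j = ⊆-antisym (transfer p q join) (transfer q p (conn-sym join))
    where
    join : Conn S v w
    join with nonloose-inc (Comp.noloose p e i)
    ... | u , inc = conn-sym (Comp.vertex-in p (e , i , inc)) ◅◅ Comp.vertex-in q (e , j , inc)
    transfer : ∀ {v w X Y} → IsCompEdges S v X → IsCompEdges S w Y → Conn S v w → X ⊆ Y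
    transfer p q c i with Comp.member p i
    ... | e∈S , _ , u , inc , c' = Comp.absorb q e∈S inc (c' ◅◅ c)

  Supported : Subset m → Fin n → Set
  Supported S a = ∃ λ x → Sol S x × x a ≢ nothing × (∀ u → ¬ Conn S u a → x u ≡ nothing)

  NegativeAt : Subset m → Fin n → Set
  NegativeAt S a = ∃ λ F → NegFigure F × F ⊆ S × ∃ λ w → VertexOf F w × Conn S w a

  -- A potential of the component of `a` extends by 0 to a solution on `S`, since no edge leaves the
  -- component.
  supported-or-negative : ∀ S a → Supported S a ⊎ NegativeAt S a
  supported-or-negative S a with component S a
  ... | X , isC with potential-or-negative X
  ... | inj₂ (F , nF , F⊆X) with figure-vertex (neg-figure nF)
  ... | w , vw = inj₂ (F , nF , (λ i → Comp.⊆S isC (F⊆X i)) , w , vw , Comp.vertex-in isC (vertex-mono F⊆X vw))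
  supported-or-negative S a | X , isC | inj₁ (y , p) = inj₁ (x , sol , (λ eq → contradiction (trans (sym (x-in ε)) eq) λ ()) , λ _ → x-out)
    where
    x : Fin n → Ternary
    x u with conn? S u a
    ... | yes _ = just (y u)
    ... | no _ = nothing
    x-in : ∀ {u} → Conn S u a → x u ≡ just (y u)
    x-in {u} k with conn? S u a
    ... | yes _ = refl
    ... | no nk = contradiction k nk
    x-out : ∀ {u} → ¬ Conn S u a → x u ≡ nothing
    x-out {u} nk with conn? S u a
    ... | yes k = contradiction k nk
    ... | no _ = refl
    sol : Sol S x
    sol e i with view e
    ... | isLoose eq = loose-sat eq
    ... | isHalf b t eq with conn? S b a
    ... | yes k = contradiction (sat-half eq (p e (Comp.absorb isC i (half-inc eq) k))) λ ()
    ... | no nk = half-sat eq (x-out nk)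
    sol e i | joins b d j with conn? S b a
    ... | yes k = sat-local j (sym (x-in k)) (sym (x-in (edge-conn i (joins-sym j) ◅◅ k))) (p e (Comp.absorb isC i (joins-inc₁ j) k))
    ... | no nk = zeros-sat λ w inc → x-out λ k → nk (inc-conn i (joins-inc₁ j) inc ◅◅ k)

-- Leading positions, redundancy and the count `μ`.

module Ranks {c ℓ} (K : Field c ℓ) {n m : ℕ} (Υ : GSG K n m) where
  open Gain K Υ hiding (F1; F2; P; x; y; fig1; fig2; x∈F1; y∈F2; disj; path; meet; union)
  open GSG Υ using (ends)
  open Incidence K Υ
  open Circles K Υ
  open Components K Υ

  Lead : Subset m → Fin n → Set
  Lead S v = ∃ λ x → Sol S x × x v ≢ nothing × (∀ u → toℕ u < toℕ v → x u ≡ nothing)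

  lead-rep : ∀ {S v} → Lead S v → IsRep S v
  lead-rep {S} {v} (x , p , nz , z) u c with toℕ u <? toℕ v
  ... | yes lt = contradiction (sol-zero-conn p c (z u lt)) nz
  ... | no nlt = ≮⇒≥ nlt

  lead-¬negative : ∀ {S v} → Lead S v → ¬ NegativeAt S v
  lead-¬negative (x , p , nz , z) (F , nF , F⊆S , w , vw , c) =
    nz (sol-zero-conn p c (negative-figure-forces nF x (sol-mono F⊆S p) w vw))

  supported-lead : ∀ {S v} → IsRep S v → Supported S v → Lead S v
  supported-lead rep (x , p , nz , z) = x , p , nz , λ u lt → z u λ c → <⇒≱ lt (rep u c)

  -- No solutions are enumerated: `supported-or-negative` provides either a solution or an
  -- obstruction to all of them.
  lead? : ∀ S v → Dec (Lead S v)
  lead? S v with all? (λ u → conn? S u v →-dec (toℕ v ≤? toℕ u)) | supported-or-negative S v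
  ... | no nrep | _ = no λ l → nrep λ u c → lead-rep l u c
  ... | yes rep | inj₁ s = yes (supported-lead rep s)
  ... | yes rep | inj₂ neg = no λ l → lead-¬negative l neg

  -- A solution that leads at `v` is nonzero on the whole component of `v`, so no earlier vertex and
  -- no negative figure belongs to it. Conversely, a solution supported on a balanced component
  -- leads at its least vertex.
  lead-spec : ∀ S v → Lead S v ⇔ (IsRep S v × CompBalanced S v)
  lead-spec S v = mk⇔ (λ l → lead-rep l , balanced l) from
    where
    balanced : Lead S v → CompBalanced S v
    balanced l X isC = positive , λ { e i (a , t , eq) → at ⁅ e ⁆ (⁅⁆⊆ i) (inj₂ (e , (a , t , eq) , refl)) }
      where
      at : ∀ F → F ⊆ X → ¬ NegFigure F
      at F F⊆X nF with figure-vertex (neg-figure nF)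
      ... | w , vw = lead-¬negative l (F , nF , (λ i → Comp.⊆S isC (F⊆X i)) , w , vw , Comp.vertex-in isC (vertex-mono F⊆X vw))
      positive : ∀ C → C ⊆ X → Circle C → signOf C ≡ s+
      positive C C⊆X cC with figure-sign (inj₁ cC)
      ... | inj₁ (_ , pos) = pos
      ... | inj₂ nC = contradiction nC (at C C⊆X)
    from : IsRep S v × CompBalanced S v → Lead S v
    from (rep , bal) with supported-or-negative S v
    ... | inj₁ s = supported-lead rep s
    ... | inj₂ (F , nF , F⊆S , w , vw , k) with component S v
    ... | X , isC with Comp.figure-in isC (neg-figure nF) F⊆S vw k | bal X isC | nF
    ... | F⊆X | pos , _ | inj₁ (cF , neg) = contradiction (trans (sym neg) (pos F F⊆X cF)) λ ()
    ... | F⊆X | _ , nohalf | inj₂ (h , H , refl) = contradiction H (nohalf h (F⊆X (x∈⁅x⁆ h)))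

  opaque
    leads : Subset m → Subset n
    leads S = proj₁ (separate (lead? S))

    leads⁻ : ∀ {S v} → v ∈ leads S → Lead S v
    leads⁻ {S} {v} = Equivalence.to (proj₂ (separate (lead? S)) v)

    leads⁺ : ∀ {S v} → Lead S v → v ∈ leads S
    leads⁺ {S} {v} = Equivalence.from (proj₂ (separate (lead? S)) v)

  reps≡leads : ∀ {S R} → (∀ v → (v ∈ R ⇔ (IsRep S v × CompBalanced S v))) → R ≡ leads S
  reps≡leads {S} spec = ⊆-antisym (λ {v} i → leads⁺ (Equivalence.from (lead-spec S v) (Equivalence.to (spec v) i)))
    (λ {v} i → Equivalence.from (spec v) (Equivalence.to (lead-spec S v) (leads⁻ i)))

  leads-spec : ∀ S v → (v ∈ leads S ⇔ (IsRep S v × CompBalanced S v))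
  leads-spec S v = mk⇔ (Equivalence.to (lead-spec S v) ∘ leads⁻) (leads⁺ ∘ Equivalence.from (lead-spec S v))

  leads-mono : ∀ {S T} → S ⊆ T → leads T ⊆ leads S
  leads-mono S⊆T i with leads⁻ i
  ... | x , p , nz , z = leads⁺ (x , sol-mono S⊆T p , nz , z)

  Redundant : Subset m → Fin m → Set
  Redundant S e = ∀ x → Sol (S - e) x → Sat e x

  redundant-mono : ∀ {S T e} → S ⊆ T → Redundant S e → Redundant T e
  redundant-mono {e = e} S⊆T r x p = r x (sol-mono (-⊆-mono e S⊆T) p)

  leads-redundant : ∀ {S e} → Redundant S e → leads (S - e) ≡ leads S
  leads-redundant {S} {e} r = ⊆-antisym grow (leads-mono (p-x⊆p S e))
    where
    grow : leads (S - e) ⊆ leads S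
    grow i with leads⁻ i
    ... | x , p , nz , z = leads⁺ (x , sol-remove p (r x p) , nz , z)

  -- Two new leads would come from solutions `x` and `y` of `S - e` that both violate `e`. Adding to
  -- `x` the multiple of `y` that cancels the residual of `e` gives a solution of `S`. If `x` leads
  -- earlier, the sum leads where `x` does, because `y` is still zero there.
  leads-drop : ∀ S e → ∣ leads (S - e) ∣ ≤ suc ∣ leads S ∣
  leads-drop S e = ∣∣≤suc new
    where
    bad : ∀ {v x} → v ∉ leads S → Sol (S - e) x → x v ≢ nothing → (∀ u → toℕ u < toℕ v → x u ≡ nothing) → ¬ Sat e x
    bad ni p nz z q = ni (leads⁺ (_ , sol-remove p q , nz , z))
    earlier : ∀ {v w} → toℕ v < toℕ w → v ∈ leads (S - e) → w ∈ leads (S - e) → w ∉ leads S → v ∈ leads S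
    earlier {v} {w} lt i j nj with leads⁻ i | leads⁻ j
    ... | x , p , nz , z | y , q , nz' , z' with sat? e x
    ... | yes r = leads⁺ (x , sol-remove p r , nz , z)
    ... | no nr with cancelling (residual (ends e) x) (residual (ends e) y) nr (bad nj q nz' z')
    ... | k , eq = leads⁺ (combine x k y , sol-remove (sol-combine k p q) (trans (residual-combine (ends e) x k y) eq)
          , (λ eq' → nz (⊕-⋆-cancel _ k _ (z' v lt) eq'))
          , λ u lt' → trans (cong₂ (λ a b → a ⊕ k ⋆ b) (z u lt') (z' u (≤-trans (m≤n⇒m≤1+n lt') lt))) refl)
    new : ∀ v w → v ∈ leads (S - e) → w ∈ leads (S - e) → v ∉ leads S → w ∉ leads S → v ≡ w
    new v w i j ni nj with <-cmp (toℕ v) (toℕ w)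
    ... | tri< lt _ _ = contradiction (earlier lt i j nj) ni
    ... | tri≈ _ eq _ = toℕ-injective eq
    ... | tri> _ _ gt = contradiction (earlier gt j i ni) nj

  -- Clearing the entries of a solution from left to right by solutions of S leaves 0.
  leads-⊆⇒redundant : ∀ {S e} → e ∈ S → leads (S - e) ⊆ leads S → Redundant S e
  leads-⊆⇒redundant {S} {e} i sub x p = clear n 0 (+-identityʳ n) x p λ _ ()
    where
    clear : ∀ k j → k + j ≡ n → ∀ x → Sol (S - e) x → (∀ u → toℕ u < j → x u ≡ nothing) → Sat e x
    clear zero j refl x p z = zeros-sat λ w _ → z w (toℕ<n w)
    clear (suc k) j eq x p z with any? (λ u → toℕ u ≟ℕ j)
    -- This case cannot occur, since j < n, but moving on is shorter than refuting it.
    ... | no none = clear k (suc j) (trans (+-suc k j) eq) x p λ u lt → z u (≤∧≢⇒< (m<1+n⇒m≤n lt) λ q → none (u , q))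
    ... | yes (u , refl) with zero? (x u)
    ... | yes xu≡0 = clear k (suc (toℕ u)) (trans (+-suc k (toℕ u)) eq) x p next
      where
      next : ∀ w → toℕ w < suc (toℕ u) → x w ≡ nothing
      next w lt with w ≟ u
      ... | yes refl = xu≡0
      ... | no ne = z w (≤∧≢⇒< (m<1+n⇒m≤n lt) (ne ∘ toℕ-injective))
    ... | no nz with leads⁻ (sub (leads⁺ (x , p , nz , z)))
    ... | y , q , nz' , z' with cancelling (x u) (y u) nz nz'
    ... | c , cancel = sat-difference c e (q e i)
      (clear k (suc (toℕ u)) (trans (+-suc k (toℕ u)) eq) (combine x c y) (sol-combine c p (sol-mono (p-x⊆p S e) q)) next)
      where
      next : ∀ w → toℕ w < suc (toℕ u) → combine x c y w ≡ nothing
      next w lt with w ≟ u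
      ... | yes refl = cancel
      ... | no ne = cong₂ (λ a b → a ⊕ c ⋆ b) (z w lt') (z' w lt')
        where
        lt' : toℕ w < toℕ u
        lt' = ≤∧≢⇒< (m<1+n⇒m≤n lt) (ne ∘ toℕ-injective)

  -- If `leads` grows at all, monotonicity makes the growth at least one and `leads-drop` at most
  -- one.
  redundant? : ∀ {S e} → e ∈ S → Redundant S e ⊎ ∣ leads (S - e) ∣ ≡ suc ∣ leads S ∣
  redundant? {S} {e} i with leads (S - e) ⊆? leads S
  ... | yes sub = inj₁ (leads-⊆⇒redundant i sub)
  ... | no nsub = inj₂ (≤-antisym (leads-drop S e) (≰⇒> λ le → nsub (full-card le)))
    where
    full-card : ∣ leads (S - e) ∣ ≤ ∣ leads S ∣ → leads (S - e) ⊆ leads S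
    full-card le {v} j with v ∈? leads S
    ... | yes k = k
    ... | no nk = contradiction le (<⇒≱ (p⊂q⇒∣p∣<∣q∣ (leads-mono (p-x⊆p S e) , v , j , nk)))

  μ : Subset m → ℕ
  μ S = ∣ S ∣ + ∣ leads S ∣

  μ-redundant : ∀ {S e} → e ∈ S → Redundant S e → μ S ≡ suc (μ (S - e))
  μ-redundant i r = cong₂ _+_ (∣p∣≡suc∣p-x∣ i) (cong ∣_∣ (sym (leads-redundant r)))

  μ-irredundant : ∀ {S e} → e ∈ S → ∣ leads (S - e) ∣ ≡ suc ∣ leads S ∣ → μ S ≡ μ (S - e)
  μ-irredundant {S} {e} i eq = trans (cong (_+ ∣ leads S ∣) (∣p∣≡suc∣p-x∣ i)) (trans (sym (+-suc ∣ S - e ∣ ∣ leads S ∣)) (cong (∣ S - e ∣ +_) (sym eq)))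

  μ-∅ : μ ∅ ≡ n
  μ-∅ = trans (cong₂ _+_ (∣⊥∣≡0 m) (cong ∣_∣ (⊆-antisym (λ _ → ∈⊤) (λ {v} _ → leads⁺ (unit v))))) (∣⊤∣≡n n)
    where
    unit : ∀ v → Lead ∅ v
    unit v = x , (λ e i → contradiction i ∉⊥) , xv , xu
      where
      x : Fin n → Ternary
      x u with u ≟ v
      ... | yes _ = just s+
      ... | no _ = nothing
      xv : x v ≢ nothing
      xv eq with v ≟ v
      ... | no ne = ne refl
      xu : ∀ u → toℕ u < toℕ v → x u ≡ nothing
      xu u lt with u ≟ v
      ... | no _ = refl
      ... | yes refl = contradiction lt 1+n≰n

  Irredundant : Subset m → Set
  Irredundant S = ∀ e → e ∈ S → ¬ Redundant S e

  μ-of-irredundant : ∀ S → Irredundant S → μ S ≡ n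
  μ-of-irredundant = removal-induction _ (λ _ → μ-∅) step
    where
    step : ∀ S e → e ∈ S → (Irredundant (S - e) → μ (S - e) ≡ n) → Irredundant S → μ S ≡ n
    step S e i ih irr with redundant? i
    ... | inj₁ r = contradiction r (irr e i)
    ... | inj₂ eq = trans (μ-irredundant i eq) (ih λ f j r → irr f (p-x⊆p S e j) (redundant-mono (p-x⊆p S e) r))

  n≤μ : ∀ S → n ≤ μ S
  n≤μ = removal-induction _ (≤-reflexive (sym μ-∅)) step
    where
    step : ∀ S e → e ∈ S → n ≤ μ (S - e) → n ≤ μ S
    step S e i le with redundant? i
    ... | inj₁ r = ≤-trans le (≤-trans (m≤n⇒m≤1+n ≤-refl) (≤-reflexive (sym (μ-redundant i r))))
    ... | inj₂ eq = ≤-trans le (≤-reflexive (sym (μ-irredundant i eq)))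

  μ≡n⇒irredundant : ∀ {S} → μ S ≡ n → Irredundant S
  μ≡n⇒irredundant {S} eq e i r = 1+n≰n (≤-trans (s≤s (n≤μ (S - e))) (≤-reflexive (trans (sym (μ-redundant i r)) eq)))

  -- States without counting that `μ S` exceeds `n` by at most one, in a form that passes to
  -- subsets.
  OnceRedundant : Subset m → Set
  OnceRedundant S = ∀ e → e ∈ S → Redundant S e → Irredundant (S - e)

  μ≡1+n⇒once-redundant : ∀ {S} → μ S ≡ suc n → OnceRedundant S
  μ≡1+n⇒once-redundant {S} eq e i r = μ≡n⇒irredundant (suc-injective (trans (sym (μ-redundant i r)) eq))

  once-redundant-mono : ∀ {S T} → S ⊆ T → OnceRedundant T → OnceRedundant S
  once-redundant-mono S⊆T once e i r f j r' =
    once e (S⊆T i) (redundant-mono S⊆T r) f (-⊆-mono e S⊆T j) (redundant-mono (-⊆-mono e S⊆T) r')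

-- Figures, attached trees and handcuffs.

∪-─⊆ : ∀ {k} (p q : Subset k) → (p ∪ q) ─ p ⊆ q
∪-─⊆ p q i with ∈─⁻ (p ∪ q) p i
... | j , ni with x∈p∪q⁻ p q j
... | inj₁ l = contradiction l ni
... | inj₂ l = l

module Structure {c ℓ} (K : Field c ℓ) {n m : ℕ} (Υ : GSG K n m) where
  open Gain K Υ hiding (F1; F2; P; x; y; fig1; fig2; x∈F1; y∈F2; disj; path; meet; union)
  open Incidence K Υ
  open Circles K Υ
  open Trails K Υ
  open Components K Υ
  open Ranks K Υ

  -- The last clause of `WithTrees`, separated because it locates circles before anything is known
  -- about acyclicity.
  UniqueContact : Subset m → Subset m → Set
  UniqueContact T H = ∀ u v → VertexOf T u → VertexOf T v → Conn (H ─ T) u v → u ≡ v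

  ReachesAvoiding : Subset m → Subset m → Fin m → Set
  ReachesAvoiding X T e = ∀ w → Inc e w → ∃ λ t → VertexOf T t × Conn (X - e) w t

  -- Only the parts of the walk before its first and after its last edge in `T` are kept.
  excursion : ∀ {Y a b} T → Conn Y a b →
    Conn (Y ─ T) a b ⊎ ∃₂ λ u v → VertexOf T u × VertexOf T v × Conn (Y ─ T) a u × Conn (Y ─ T) v b
  excursion T ε = inj₁ ε
  excursion T ((e , i , j) ◅ w) with e ∈? T | excursion T w
  ... | no ni | inj₁ k = inj₁ ((e , x∈p∧x∉q⇒x∈p─q i ni , j) ◅ k)
  ... | yes e∈T | inj₁ k = inj₂ (_ , _ , (e , e∈T , joins-inc₁ j) , (e , e∈T , joins-inc₂ j) , ε , k)
  ... | no ni | inj₂ (u , v , vu , vv , k , l) = inj₂ (u , v , vu , vv , (e , x∈p∧x∉q⇒x∈p─q i ni , j) ◅ k , l)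
  ... | yes e∈T | inj₂ (u , v , vu , vv , k , l) = inj₂ (_ , v , (e , e∈T , joins-inc₁ j) , vv , ε , l)

  -- A circle with an edge `e` outside `T` can touch `T` in one vertex at most, so it already closes
  -- up within `G ─ T`; a circle inside a circle is all of it.
  figure-in-or-out : ∀ {T H G} → UniqueContact T H → Figure G → G ⊆ H → G ⊆ T ⊎ G ⊆ H ─ T
  figure-in-or-out {T} {H} contact (inj₂ (h , _ , refl)) G⊆H with h ∈? T
  ... | yes i = inj₁ (⁅⁆⊆ i)
  ... | no ni = inj₂ (⁅⁆⊆ (x∈p∧x∉q⇒x∈p─q (G⊆H (x∈⁅x⁆ h)) ni))
  figure-in-or-out {T} {H} {G} contact (inj₁ cG) G⊆H with nonempty? (G ─ T)
  ... | no emp = inj₁ inside-T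
    where
    inside-T : G ⊆ T
    inside-T {e} i with e ∈? T
    ... | yes k = k
    ... | no nk = contradiction (e , x∈p∧x∉q⇒x∈p─q i nk) emp
  ... | yes (e , i) with ∈─⁻ G T i
  ... | e∈G , e∉T with link-joins (proj₁ (proj₂ cG) e e∈G)
  ... | a , b , j = inj₂ λ k → ─-mono (subst (_ ∈_) (sym whole) k)
    where
    ─-mono : G ─ T ⊆ H ─ T
    ─-mono k with ∈─⁻ G T k
    ... | p , q = x∈p∧x∉q⇒x∈p─q (G⊆H p) q
    swap : (G - e) ─ T ⊆ (G ─ T) - e
    swap k with ∈─⁻ (G - e) T k
    ... | p , q with ∈-⁻ G p
    ... | p' , ne = x∈p∧x≢y⇒x∈p-y (x∈p∧x∉q⇒x∈p─q p' q) ne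
    outer : ∀ {u v} → Conn ((G - e) ─ T) u v → Conn (H ─ T) u v
    outer = conn-mono (λ k → ─-mono (p-x⊆p (G ─ T) e (swap k)))
    bypass : Conn ((G ─ T) - e) a b
    bypass with excursion T (circle-bypass cG e∈G j)
    ... | inj₁ k = conn-mono swap k
    -- The vertices where the circle enters and leaves `T` are connected through `e` outside `T`, so
    -- they coincide and the stretch between them can be skipped.
    ... | inj₂ (u , v , vu , vv , k , l) with contact u v vu vv (conn-sym (outer k) ◅◅ edge-conn (─-mono i) j ◅◅ conn-sym (outer l))
    ... | refl = conn-mono swap (k ◅◅ l)
    whole : G ─ T ≡ G
    whole with circle-through i j bypass
    ... | C , cC , C⊆ , _ = ⊆-antisym (p─q⊆p G T) (λ k → C⊆ (subst (_ ∈_) (sym (circle-⊆ cC cG (λ l → p─q⊆p G T (C⊆ l)))) k))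

  figure-within : ∀ {T H G} → WithTrees T H → Figure G → G ⊆ H → G ⊆ T
  figure-within (_ , _ , _ , acyclic , contact) fG G⊆H with figure-in-or-out contact fG G⊆H
  ... | inj₁ k = k
  ... | inj₂ k = contradiction fG (acyclic _ k)

  -- A figure outside `T` and a connection outside `T` between two of its vertices both contain an
  -- edge whose ends reach `T` without it. Excluding such edges thus gives both conditions on the
  -- trees.
  with-trees : ∀ {T X} → T ⊆ X → Connected X → NoLoose X → ∃ (VertexOf T)
    → (∀ e → e ∈ X → e ∉ T → ¬ ReachesAvoiding X T e) → WithTrees T X
  with-trees {T} {X} T⊆X con nl (t , vt) no-return = T⊆X , con , nl , acyclic , contact
    where
    acyclic : Acyclic (X ─ T)
    acyclic G G⊆ fG with figure-nonempty fG
    ... | e , i with ∈─⁻ X T (G⊆ i)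
    ... | e∈X , e∉T = no-return e e∈X e∉T λ w inc → t , vt ,
      figure-bypass fG i (λ k → p─q⊆p X T (G⊆ k)) (con w t (e , e∈X , inc) (vertex-mono T⊆X vt))
    contact : UniqueContact T X
    contact u v vu vv k with simplify k
    ... | simple [] _ _ = refl
    ... | simple (_∷_ {e = e} {es = es} j tr) d s with ∈─⁻ X T (s (here refl))
    ... | e∈X , e∉T = contradiction reach (no-return e e∈X e∉T)
      where
      rest : ∀ {f} → f ∈ₗ es → f ∈ X - e
      rest i = x∈p∧x≢y⇒x∈p-y (p─q⊆p X T (s (there i))) λ { refl → unique-head (trail-edges-unique (j ∷ tr) d) i }
      reach : ReachesAvoiding X T e
      reach w inc with inc-joins j inc
      ... | inj₁ refl = w , vu , ε
      ... | inj₂ refl = v , vv , trail-conn tr rest (end∈ tr)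

  forced-redundant : ∀ {F X e} → NegFigure F → F ⊆ X - e → ReachesAvoiding X F e → Redundant X e
  forced-redundant nF F⊆ reach x p = zeros-sat λ w inc → zero-at w (reach w inc)
    where
    zero-at : ∀ w → _ → x w ≡ nothing
    zero-at w (t , vt , k) = sol-zero-conn p (conn-sym k) (negative-figure-forces nF x (sol-mono F⊆ p) t vt)

  figure-reaches : ∀ {F T X e} → Figure F → e ∈ F → F ⊆ X → Connected X → T ⊆ X → ∃ (VertexOf T) → ReachesAvoiding X T e
  figure-reaches {e = e} fF i F⊆X con T⊆X (t , vt) w inc =
    t , vt , figure-bypass fF i F⊆X (con w t (e , F⊆X i , inc) (vertex-mono T⊆X vt))

  reaches-shrink : ∀ {F T X e} → F ⊆ T → Connected T → T ⊆ X - e → ∃ (VertexOf F) → ReachesAvoiding X T e → ReachesAvoiding X F e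
  reaches-shrink F⊆T con T⊆ (f , vf) reach w inc with reach w inc
  ... | t , vt , k = f , vf , k ◅◅ conn-mono T⊆ (con t f vt (vertex-mono F⊆T vf))

  trail-cut : ∀ {u es vs w e} → Trail u es vs w → Unique es → e ∈ₗ es
    → ∃₂ λ a b → Joins e a b × Conn (toSet es - e) u a × Conn (toSet es - e) b w
  trail-cut (j ∷ t) uq (here refl) = _ , _ , j , ε ,
    trail-conn t (λ k → x∈p∧x≢y⇒x∈p-y (toSet⁺ (there k)) λ { refl → unique-head uq k }) (end∈ t)
  trail-cut {e = e} (_∷_ {es = es} j t) uq (there i) with trail-cut t (unique-tail uq) i
  ... | a , b , k , p , q = a , b , k , (_ , x∈p∧x≢y⇒x∈p-y (toSet⁺ (here refl)) (λ { refl → unique-head uq i }) , j) ◅ up p , up q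
    where
    up : ∀ {u v} → Conn (toSet es - e) u v → Conn (toSet (_ ∷ es) - e) u v
    up = conn-mono (-⊆-mono e (λ k → toSet⁺ (there (toSet⁻ k))))

  -- The first edge lies on no circle, which would need another edge of the trail at the first
  -- vertex, and this vertex is not visited again.
  trail-acyclic : ∀ {u es vs w} → Trail u es vs w → Unique vs → Acyclic (toSet es)
  trail-acyclic [] _ G G⊆ fG with figure-nonempty fG
  ... | e , i = contradiction (toSet⁻ (G⊆ i)) λ ()
  trail-acyclic t@(_ ∷ _) _ G G⊆ (inj₂ (h , H , refl)) = ¬link-half (trail-links t (toSet⁻ (G⊆ (x∈⁅x⁆ h)))) H
  trail-acyclic (_∷_ {u} {v} {e = e} {es = es} j t) d G G⊆ (inj₁ cG) = trail-acyclic t (unique-tail d) G avoid (inj₁ cG)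
    where
    e∉G : e ∉ G
    e∉G i with circle-bypass cG i j
    ... | ε = unique-head d (start∈ t)
    ... | (f , k , l) ◅ _ with ∈-⁻ G k
    ... | f∈G , ne with toSet⁻ (G⊆ f∈G)
    ... | here refl = ne refl
    ... | there f∈es = unique-head d (trail-inc t f∈es (joins-inc₁ l))
    avoid : G ⊆ toSet es
    avoid {f} i with toSet⁻ (G⊆ i)
    ... | here refl = contradiction i e∉G
    ... | there k = toSet⁺ k

  path-cut : ∀ {P u v e} → Path P u v → e ∈ P → ∃₂ λ a b → Joins e a b × Conn (P - e) u a × Conn (P - e) b v
  path-cut pP i with path-simple pP
  ... | simple t d _ , refl = trail-cut t (trail-edges-unique t d) (toSet⁻ i)

  path-acyclic : ∀ {P u v} → Path P u v → Acyclic P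
  path-acyclic pP with path-simple pP
  ... | simple t d _ , refl = trail-acyclic t d

  path-conn : ∀ {P u v} → Path P u v → Conn P u v
  path-conn pP with path-simple pP
  ... | simple t d _ , refl = trail-conn t toSet⁺ (end∈ t)

  path-vertex-conn : ∀ {P u v w} → Path P u v → VertexOf P w → Conn P u w
  path-vertex-conn pP vw with path-simple pP
  ... | simple t d _ , refl = trail-conn t toSet⁺ (trail-vertex t vw)

  path-closed : ∀ {P u} → Path P u u → Empty P
  path-closed pP (e , i) with path-simple pP
  ... | simple [] _ _ , refl = contradiction (toSet⁻ i) λ ()
  ... | simple (_ ∷ t) d _ , refl = unique-head d (end∈ t)

  path-end : ∀ {P u v} → Path P u v → u ≢ v → Nonempty P × VertexOf P u × VertexOf P v
  path-end pP u≢v with path-simple pP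
  ... | simple t d _ , refl with vertex-trail t u≢v (start∈ t)
  ... | vu@(e , i , _) = (e , i) , vu , vertex-trail t u≢v (end∈ t)

  path-bridge : ∀ {P u v e} → Path P u v → e ∈ P → ¬ Conn (P - e) u v
  path-bridge pP i k with path-cut pP i
  ... | a , b , j , p , q with circle-through i j (conn-sym p ◅◅ k ◅◅ conn-sym q)
  ... | C , cC , C⊆P , _ = path-acyclic pP C C⊆P (inj₁ cC)

  shared-contact : ∀ {T Y t} → (∀ {v} → VertexOf T v → VertexOf Y v → v ≡ t) → UniqueContact T (T ∪ Y)
  shared-contact {T} {Y} only u v vu vv k with u ≟ v
  ... | yes eq = eq
  ... | no ne = trans (only vu (leave k ne)) (sym (only vv (leave (conn-sym k) (ne ∘ sym))))
    where
    leave : ∀ {u v} → Conn ((T ∪ Y) ─ T) u v → u ≢ v → VertexOf Y u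
    leave k ne = vertex-mono (∪-─⊆ T Y) (conn-start k ne)

  module Handcuffs {C} (h : Handcuff C) where
    open Handcuff h

    F1⊆C : F1 ⊆ C
    F1⊆C i = subst (_ ∈_) (sym union) (∈∪ˡ F1 (F2 ∪ P) i)

    F2⊆C : F2 ⊆ C
    F2⊆C i = subst (_ ∈_) (sym union) (∈∪ʳ F1 (F2 ∪ P) (∈∪ˡ F2 P i))

    P⊆C : P ⊆ C
    P⊆C i = subst (_ ∈_) (sym union) (∈∪ʳ F1 (F2 ∪ P) (∈∪ʳ F2 P i))

    edge-cases : ∀ {e} → e ∈ C → e ∈ F1 ⊎ e ∈ F2 ⊎ e ∈ P
    edge-cases i with x∈p∪q⁻ F1 (F2 ∪ P) (subst (_ ∈_) union i)
    ... | inj₁ k = inj₁ k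
    ... | inj₂ k = inj₂ (x∈p∪q⁻ F2 P k)

    reach : ∀ {v} → VertexOf C v → Conn C x v
    reach {v} (e , i , inc) with edge-cases i
    ... | inj₁ k = conn-mono F1⊆C (figure-connected fig1 x v x∈F1 (e , k , inc))
    ... | inj₂ (inj₁ k) = conn-mono P⊆C (path-conn path) ◅◅ conn-mono F2⊆C (figure-connected fig2 y v y∈F2 (e , k , inc))
    ... | inj₂ (inj₂ k) = conn-mono P⊆C (path-vertex-conn path (e , k , inc))

    connected : Connected C
    connected u v vu vv = conn-sym (reach vu) ◅◅ reach vv

    disjoint : ∀ {e} → e ∈ F1 → e ∉ F2
    disjoint i j = disj (_ , x∈p∩q⁺ (i , j))

    redundant₁ : NegFigure F1 → ∀ {e} → e ∈ F2 → Redundant C e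
    redundant₁ nF i = forced-redundant nF (⊆-avoid F1⊆C (λ k → disjoint k i)) (figure-reaches fig2 i F2⊆C connected F1⊆C (x , x∈F1))

    redundant₂ : NegFigure F2 → ∀ {e} → e ∈ F1 → Redundant C e
    redundant₂ nF i = forced-redundant nF (⊆-avoid F2⊆C (disjoint i)) (figure-reaches fig1 i F1⊆C connected F2⊆C (y , y∈F2))

    redundant : NegFigure F1 → NegFigure F2 → ∀ {e} → e ∈ C → Redundant C e
    redundant n1 n2 {e} i with e ∈? F1 | e ∈? F2 | edge-cases i
    ... | yes k | _ | _ = redundant₂ n2 k
    ... | no _ | yes k | _ = redundant₁ n1 k
    ... | no ni | no _ | inj₁ k = contradiction k ni
    ... | no _ | no ni | inj₂ (inj₁ k) = contradiction k ni
    -- The two remainders of the path join one end of the edge to the first figure and the other end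
    -- to the second, so both values are forced to be 0.
    ... | no ni | no nj | inj₂ (inj₂ k) with path-cut path k
    ... | a , b , j , p , q = λ z sol → zeros-sat λ w inc → zero-at z sol w (inc-joins j inc)
      where
      in-C : ∀ {u v} → Conn (P - e) u v → Conn (C - e) u v
      in-C = conn-mono (-⊆-mono e P⊆C)
      zero-at : ∀ z → Sol (C - e) z → ∀ w → w ≡ a ⊎ w ≡ b → z w ≡ nothing
      zero-at z sol w (inj₁ refl) = sol-zero-conn sol (in-C p) (negative-figure-forces n1 z (sol-mono (⊆-avoid F1⊆C ni) sol) x x∈F1)
      zero-at z sol w (inj₂ refl) = sol-zero-conn sol (conn-sym (in-C q)) (negative-figure-forces n2 z (sol-mono (⊆-avoid F2⊆C nj) sol) y y∈F2)

    private
      shared₁ : ∀ {v} → VertexOf F1 v → VertexOf (F2 ∪ P) v → v ≡ x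
      shared₁ {v} v1 (e , i , inc) with x∈p∪q⁻ F2 P i | meet
      ... | inj₁ k | inj₁ (_ , only) = only v v1 (e , k , inc)
      ... | inj₁ k | inj₂ (apart , _) = contradiction (e , k , inc) (apart v v1)
      ... | inj₂ k | inj₁ (refl , _) = contradiction (e , k) (path-closed path)
      ... | inj₂ k | inj₂ (_ , only , _) = only v (e , k , inc) v1

      shared₂ : ∀ {v} → VertexOf F2 v → VertexOf P v → v ≡ y
      shared₂ {v} v2 (e , k , inc) with meet
      ... | inj₁ (refl , _) = contradiction (e , k) (path-closed path)
      ... | inj₂ (_ , _ , only) = only v (e , k , inc) v2

    -- Split off `F1`, then `F2`: each touches the rest in one vertex at most, and the remaining
    -- path is acyclic.
    figures : ∀ {G} → Figure G → G ⊆ C → G ≡ F1 ⊎ G ≡ F2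
    figures {G} fG G⊆C with figure-in-or-out {F1} {F1 ∪ (F2 ∪ P)} (shared-contact shared₁) fG (λ i → subst (_ ∈_) union (G⊆C i))
    ... | inj₁ G⊆F1 = inj₁ (figure-⊆ fG fig1 G⊆F1)
    ... | inj₂ G⊆rest with figure-in-or-out {F2} {F2 ∪ P} (shared-contact shared₂) fG (λ i → ∪-─⊆ F1 (F2 ∪ P) (G⊆rest i))
    ... | inj₁ G⊆F2 = inj₂ (figure-⊆ fG fig2 G⊆F2)
    ... | inj₂ G⊆P = contradiction fG (path-acyclic path G (λ i → ∪-─⊆ F2 P (G⊆P i)))

-- From the two types to the value of `μ`.

module Independence {c ℓ} (K : Field c ℓ) {n m : ℕ} (Υ : GSG K n m) where
  open Gain K Υ hiding (F1; F2; P; x; y; fig1; fig2; x∈F1; y∈F2; disj; path; meet; union)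
  open Incidence K Υ
  open Circles K Υ
  open Trails K Υ
  open Components K Υ
  open Ranks K Υ
  open Structure K Υ

  circuit-redundant : ∀ {C e} → SignCircuit C → e ∈ C → Redundant C e
  circuit-redundant (inj₁ pC) i = positive-circle-implies pC i
  circuit-redundant (inj₂ (inj₁ (l , L , refl))) i x p with x∈⁅y⁆⇒x≡y l i
  ... | refl = loose-sat L
  circuit-redundant (inj₂ (inj₂ (h , n1 , n2))) i = Handcuffs.redundant h n1 n2 i

  circuit-nonempty : ∀ {C} → SignCircuit C → Nonempty C
  circuit-nonempty (inj₁ ((ne , _) , _)) = ne
  circuit-nonempty (inj₂ (inj₁ (l , _ , refl))) = l , x∈⁅x⁆ l
  circuit-nonempty (inj₂ (inj₂ (h , n1 , _))) with figure-nonempty (Handcuff.fig1 h)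
  ... | e , i = e , Handcuffs.F1⊆C h i

  irredundant⇒no-circuit : ∀ {S C} → Irredundant S → C ⊆ S → ¬ SignCircuit C
  irredundant⇒no-circuit irr C⊆S sC with circuit-nonempty sC
  ... | e , i = irr e (C⊆S i) (redundant-mono C⊆S (circuit-redundant sC i))

  -- Deleting an edge of `C` outside `D` leaves nothing redundant, yet `D` would survive.
  circuit-unique : ∀ {S C D} → OnceRedundant S → C ⊆ S → D ⊆ S → SignCircuit C → SignCircuit D → C ≡ D
  circuit-unique {S} once C⊆S D⊆S sC sD = ⊆-antisym (sub C⊆S D⊆S sC sD) (sub D⊆S C⊆S sD sC)
    where
    sub : ∀ {C D} → C ⊆ S → D ⊆ S → SignCircuit C → SignCircuit D → C ⊆ D
    sub {C} {D} C⊆S D⊆S sC sD {e} i with e ∈? D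
    ... | yes k = k
    ... | no nk = contradiction sD (irredundant⇒no-circuit (once e (C⊆S i) (redundant-mono C⊆S (circuit-redundant sC i))) (⊆-avoid D⊆S nk))

  -- The case of a figure paired with itself is included on purpose: it excludes positive circles.
  OneNegative : Subset m → Set
  OneNegative S = ∀ {F G u v} → Figure F → Figure G → F ⊆ S → G ⊆ S → VertexOf F u → VertexOf G v → Conn S u v → F ≡ G × NegFigure F

  -- In each case there is a solution of `S - e` that violates `e`: one supported on the component
  -- of an end of `e` without a negative figure in `S - e`.
  one-negative-irredundant : ∀ {S e} → OneNegative S → e ∈ S → ¬ Loose e → ¬ Redundant S e
  one-negative-irredundant {S} {e} one i nl r with view e
  ... | isLoose eq = nl eq
  ... | isHalf a t eq with supported-or-negative (S - e) a
  ... | inj₁ (x , p , nz , _) = nz (sat-half eq (r x p))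
  ... | inj₂ (F , nF , F⊆ , w , vw , k) with one (neg-figure nF) (inj₂ (e , (a , t , eq) , refl)) (λ j → p-x⊆p S e (F⊆ j)) (⁅⁆⊆ i) vw (e , x∈⁅x⁆ e , half-inc eq) (conn-mono (p-x⊆p S e) k)
  ... | refl , _ = x∉p-x S e (F⊆ (x∈⁅x⁆ e))
  one-negative-irredundant {S} {e} one i nl r | joins a b j with conn? (S - e) b a | supported-or-negative (S - e) a | supported-or-negative (S - e) b
  -- For a bridge, `x` lives on the side of `a` only, so it cannot satisfy `e`.
  ... | no nk | inj₁ (x , p , nz , z) | _ = nz (trans (sat-joins (joins-sym j) (r x p)) (cong (σ e ⋆_) (z b nk)))
  ... | no nk | inj₂ _ | inj₁ (x , p , nz , z) = nz (trans (sat-joins j (r x p)) (cong (σ e ⋆_) (z a (nk ∘ conn-sym))))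
  -- Negative figures on both sides of the bridge would be the same figure, which would connect the
  -- sides.
  ... | no nk | inj₂ (F , nF , F⊆ , w , vw , k) | inj₂ (G , nG , G⊆ , u , vu , l)
    with one (neg-figure nF) (neg-figure nG) (λ q → p-x⊆p S e (F⊆ q)) (λ q → p-x⊆p S e (G⊆ q)) vw vu
           (conn-mono (p-x⊆p S e) k ◅◅ edge-conn i j ◅◅ conn-sym (conn-mono (p-x⊆p S e) l))
  ... | refl , _ = nk (conn-sym l ◅◅ conn-mono F⊆ (figure-connected (neg-figure nF) u w vu vw) ◅◅ k)
  -- Now `e` lies on a circle, which must be negative and the only figure nearby. A solution of
  -- `S - e` that satisfies `e` would vanish on it.
  one-negative-irredundant {S} {e} one i nl r | joins a b j | yes k | d | _ with circle-through i j (conn-sym k)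
  ... | C , cC , C⊆S , e∈C with d
  ... | inj₂ (F , nF , F⊆ , w , vw , l) with one (neg-figure nF) (inj₁ cC) (λ q → p-x⊆p S e (F⊆ q)) C⊆S vw (e , e∈C , joins-inc₁ j) (conn-mono (p-x⊆p S e) l)
  ... | refl , _ = x∉p-x S e (F⊆ e∈C)
  one-negative-irredundant {S} {e} one i nl r | joins a b j | yes k | d | _ | C , cC , C⊆S , e∈C | inj₁ (x , p , nz , _)
    with one (inj₁ cC) (inj₁ cC) C⊆S C⊆S (e , e∈C , joins-inc₁ j) (e , e∈C , joins-inc₁ j) ε
  ... | _ , nC = nz (negative-figure-forces nC x (sol-mono C⊆S (sol-remove p (r x p))) a (e , e∈C , joins-inc₁ j))

  figures-of-tree-or-unicycle : ∀ {X F G} → Tree X ⊎ SUUnicycle X → Figure F → Figure G → F ⊆ X → G ⊆ X → F ≡ G × NegFigure F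
  figures-of-tree-or-unicycle (inj₁ (_ , _ , acyclic)) fF _ F⊆X _ = contradiction fF (acyclic _ F⊆X)
  figures-of-tree-or-unicycle (inj₂ (N , nN , trees)) fF fG F⊆X G⊆X
    with figure-⊆ fF (neg-figure nN) (figure-within trees fF F⊆X) | figure-⊆ fG (neg-figure nN) (figure-within trees fG G⊆X)
  ... | refl | refl = refl , nN

  type-I⇒irredundant : ∀ {S} → TypeI S → Irredundant S
  type-I⇒irredundant {S} (nl , comps) e i = one-negative-irredundant one i (nl e i)
    where
    one : OneNegative S
    one {u = u} {v} fF fG F⊆S G⊆S vu vv k with component S v
    ... | X , isC = figures-of-tree-or-unicycle (comps v X isC) fF fG (Comp.figure-in isC fF F⊆S vu k) (Comp.figure-in isC fG G⊆S vv ε)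

  module Thetas {u v : Fin n} (u≢v : u ≢ v) where
    record Arcs (T : Subset m) : Set where
      field
        {P Q R} : Subset m
        pathP : Path P u v
        pathQ : Path Q u v
        pathR : Path R u v
        disjPQ : Empty (P ∩ Q)
        disjPR : Empty (P ∩ R)
        disjQR : Empty (Q ∩ R)
        meetPQ : ∀ w → VertexOf P w → VertexOf Q w → w ≡ u ⊎ w ≡ v
        meetPR : ∀ w → VertexOf P w → VertexOf R w → w ≡ u ⊎ w ≡ v
        meetQR : ∀ w → VertexOf Q w → VertexOf R w → w ≡ u ⊎ w ≡ v
        whole : T ≡ P ∪ Q ∪ R

    module Circles3 {T} (arcs : Arcs T) where
      open Arcs arcs

      P⊆T : P ⊆ T
      P⊆T i = subst (_ ∈_) (sym whole) (∈∪ˡ P (Q ∪ R) i)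

      Q⊆T : Q ⊆ T
      Q⊆T i = subst (_ ∈_) (sym whole) (∈∪ʳ P (Q ∪ R) (∈∪ˡ Q R i))

      circlePQ : Circle (P ∪ Q)
      circlePQ = circle-join pathP pathQ u≢v disjPQ meetPQ

      circleQR : Circle (Q ∪ R)
      circleQR = circle-join pathQ pathR u≢v disjQR meetQR

      signPQ : signOf (P ∪ Q) ≡ signOf P · signOf Q
      signPQ = Products.foldOver-∪ {X = P} {Y = Q} σ λ e i j → disjPQ (e , x∈p∩q⁺ (i , j))

      signPR : signOf (P ∪ R) ≡ signOf P · signOf R
      signPR = Products.foldOver-∪ {X = P} {Y = R} σ λ e i j → disjPR (e , x∈p∩q⁺ (i , j))

      signQR : signOf (Q ∪ R) ≡ signOf Q · signOf R
      signQR = Products.foldOver-∪ {X = Q} {Y = R} σ λ e i j → disjQR (e , x∈p∩q⁺ (i , j))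

      edge-cases : ∀ {e} → e ∈ T → e ∈ P ⊎ e ∈ Q ∪ R
      edge-cases i = x∈p∪q⁻ P (Q ∪ R) (subst (_ ∈_) whole i)

      -- Removing e from the arc P leaves the circle of Q and R with trees attached.
      missing : ∀ {e G} → e ∈ P → Figure G → G ⊆ T → e ∉ G → G ≡ Q ∪ R
      missing {e} {G} e∈P fG G⊆T e∉G with figure-in-or-out {Q ∪ R} {(Q ∪ R) ∪ (P - e)} contact fG G⊆arcs
        where
        G⊆arcs : G ⊆ (Q ∪ R) ∪ (P - e)
        G⊆arcs {f} i with edge-cases (G⊆T i)
        ... | inj₁ k = ∈∪ʳ (Q ∪ R) (P - e) (x∈p∧x≢y⇒x∈p-y k λ { refl → e∉G i })
        ... | inj₂ k = ∈∪ˡ (Q ∪ R) (P - e) k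
        meet : ∀ {w} → VertexOf (Q ∪ R) w → VertexOf P w → w ≡ u ⊎ w ≡ v
        meet {w} (f , i , inc) vP with x∈p∪q⁻ Q R i
        ... | inj₁ k = meetPQ w vP (f , k , inc)
        ... | inj₂ k = meetPR w vP (f , k , inc)
        contact : UniqueContact (Q ∪ R) ((Q ∪ R) ∪ (P - e))
        contact w z vw vz k with w ≟ z
        ... | yes eq = eq
        ... | no ne with meet vw (vertex-mono (p-x⊆p P e) (conn-start k' ne)) | meet vz (vertex-mono (p-x⊆p P e) (conn-start (conn-sym k') (ne ∘ sym)))
          where
          k' : Conn (P - e) w z
          k' = conn-mono (∪-─⊆ (Q ∪ R) (P - e)) k
        ... | inj₁ refl | inj₁ refl = refl
        ... | inj₂ refl | inj₂ refl = refl
        ... | inj₁ refl | inj₂ refl = contradiction (conn-mono (∪-─⊆ (Q ∪ R) (P - e)) k) (path-bridge pathP e∈P)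
        ... | inj₂ refl | inj₁ refl = contradiction (conn-sym (conn-mono (∪-─⊆ (Q ∪ R) (P - e)) k)) (path-bridge pathP e∈P)
      ... | inj₁ G⊆ = figure-⊆ fG (inj₁ circleQR) G⊆
      ... | inj₂ G⊆ = contradiction fG (path-acyclic pathP G λ i → p-x⊆p P e (∪-─⊆ (Q ∪ R) (P - e) (G⊆ i)))

    swap : ∀ {T} → Arcs T → Arcs T
    swap {T} arcs = record
      { pathP = pathQ ; pathQ = pathP ; pathR = pathR
      ; disjPQ = λ { (e , i) → disjPQ (e , x∈p∩q⁺ (×-swap (x∈p∩q⁻ Q P i))) } ; disjPR = disjQR ; disjQR = disjPR
      ; meetPQ = λ w a b → meetPQ w b a ; meetPR = meetQR ; meetQR = meetPR
      ; whole = trans whole (trans (sym (∪-assoc P Q R)) (trans (cong (_∪ R) (∪-comm P Q)) (∪-assoc Q P R))) }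
      where
      open Arcs arcs

    -- Together with `swap` it generates all orders of the arcs, so statements are proved for one
    -- order only.
    rotate : ∀ {T} → Arcs T → Arcs T
    rotate {T} arcs = record
      { pathP = pathP ; pathQ = pathR ; pathR = pathQ
      ; disjPQ = disjPR ; disjPR = disjPQ ; disjQR = λ { (e , i) → disjQR (e , x∈p∩q⁺ (×-swap (x∈p∩q⁻ R Q i))) }
      ; meetPQ = meetPR ; meetPR = meetPQ ; meetQR = λ w a b → meetQR w b a
      ; whole = trans whole (cong (P ∪_) (∪-comm Q R)) }
      where
      open Arcs arcs

    private
      -- The circle either misses an edge of `P` or `Q`, and then it consists of the other two arcs,
      -- or it is `P ∪ Q`. Arcs of equal sign make it positive.
      not-all-equal : ∀ {T C} (arcs : Arcs T) → (let open Arcs arcs) → C ⊆ T → Circle C → signOf C ≡ s-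
        → ¬ (signOf P ≡ signOf Q × signOf Q ≡ signOf R)
      not-all-equal {T} {C} arcs C⊆T cC neg (pq , qr) = contradiction (trans (sym neg) positive) λ ()
        where
        open Arcs arcs
        open Circles3 arcs
        same : ∀ {s t} → s ≡ t → s · t ≡ s+
        same {s} refl = s·s≡+ s
        positive : signOf C ≡ s+
        positive with nonempty? (P ─ C) | nonempty? (Q ─ C)
        ... | yes (e , i) | _ with ∈─⁻ P C i
        ... | e∈P , e∉C = trans (cong signOf (missing e∈P (inj₁ cC) C⊆T e∉C)) (trans signQR (same qr))
        positive | no _ | yes (e , i) with ∈─⁻ Q C i
        ... | e∈Q , e∉C = trans (cong signOf (Circles3.missing (swap arcs) e∈Q (inj₁ cC) C⊆T e∉C)) (trans signPR (same (trans pq qr)))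
        positive | no emP | no emQ = trans (cong signOf (sym (circle-⊆ circlePQ cC (∪-lub (covered emP) (covered emQ))))) (trans signPQ (same pq))
          where
          covered : ∀ {A} → Empty (A ─ C) → A ⊆ C
          covered {A} em {e} i with e ∈? C
          ... | yes k = k
          ... | no nk = contradiction (e , x∈p∧x∉q⇒x∈p─q i nk) em

    -- Deleting `e` destroys the positive circle `C` and leaves the negative figure `N` as the only
    -- possible figure.
    Resolution : Subset m → Set
    Resolution T = ∃₂ λ C e → ∃ λ N → PosCircle C × C ⊆ T × e ∈ C × NegFigure N × (∀ {G} → Figure G → G ⊆ T → e ∉ G → G ≡ N)

    private
      resolve-at : ∀ {T} (arcs : Arcs T) → (let open Arcs arcs) → signOf P ≡ signOf Q → signOf Q ≢ signOf R → Resolution T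
      resolve-at arcs pq qr with path-end pathP u≢v
        where open Arcs arcs
      -- Equal signs make `P ∪ Q` positive. Without an edge of `P`, only `Q ∪ R` remains, negative
      -- because its arcs differ in sign.
      ... | (e , i) , _ = P ∪ Q , e , Q ∪ R , (circlePQ , trans signPQ (trans (cong (signOf P ·_) (sym pq)) (s·s≡+ (signOf P))))
          , ∪-lub P⊆T Q⊆T , ∈∪ˡ P Q i , inj₁ (circleQR , trans signQR (differ qr)) , missing i
        where
        open Arcs arcs
        open Circles3 arcs
        differ : ∀ {s t} → s ≢ t → s · t ≡ s-
        differ { s+ } { s+ } ne = contradiction refl ne
        differ { s+ } { s- } _ = refl
        differ { s- } { s+ } _ = refl
        differ { s- } { s- } ne = contradiction refl ne

    resolve : ∀ {T C} → Arcs T → C ⊆ T → Circle C → signOf C ≡ s- → Resolution T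
    resolve arcs C⊆T cC neg with signOf P ≟ₛ signOf Q | signOf Q ≟ₛ signOf R | signOf P ≟ₛ signOf R
      where open Arcs arcs
    ... | yes pq | yes qr | _ = contradiction (pq , qr) (not-all-equal arcs C⊆T cC neg)
    ... | yes pq | no qr | _ = resolve-at arcs pq qr
    ... | no pq | _ | yes pr = resolve-at (rotate arcs) pr (λ eq → pq (trans pr eq))
    ... | no pq | yes qr | no pr = resolve-at (rotate (swap arcs)) qr (λ eq → pr (sym eq))
    ... | no pq | no qr | no pr = contradiction pr (third pq qr)
      where
      third : ∀ {p q r} → p ≢ q → q ≢ r → ¬ (p ≢ r)
      third { s+ } { s+ } pq _ _ = pq refl
      third { s- } { s- } pq _ _ = pq refl
      third { s+ } { s- } { s+ } _ _ pr = pr refl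
      third { s+ } { s- } { s- } _ qr _ = qr refl
      third { s- } { s+ } { s+ } _ qr _ = qr refl
      third { s- } { s+ } { s- } _ _ pr = pr refl

  theta-resolution : ∀ {T} (θ : SUTheta T) → ∃₂ λ C e → ∃ λ N → PosCircle C × C ⊆ T × e ∈ C × NegFigure N × (∀ {G} → Figure G → G ⊆ T → e ∉ G → G ≡ N)
  theta-resolution ((u , v , P , Q , R , u≢v , p , q , r , pq , pr , qr , mpq , mpr , mqr , eq) , C , C⊆T , cC , neg) =
    Thetas.resolve u≢v arcs C⊆T cC neg
    where
    arcs : Thetas.Arcs u≢v _
    arcs = record { pathP = p ; pathQ = q ; pathR = r ; disjPQ = pq ; disjPR = pr ; disjQR = qr ; meetPQ = mpq ; meetPR = mpr ; meetQR = mqr ; whole = eq }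

  -- What all special components share: after deletion of one edge of a sign circuit, they have only
  -- such figures as a tree or an unbalanced unicycle has.
  Curable : Subset m → Set
  Curable H = ∃₂ λ C e → SignCircuit C × C ⊆ H × e ∈ C
    × (∀ {F G} → Figure F → Figure G → F ⊆ H - e → G ⊆ H - e → F ≡ G × NegFigure F)

  curable-at : ∀ {T H C e N} → WithTrees T H → SignCircuit C → C ⊆ T → e ∈ C → NegFigure N
    → (∀ {G} → Figure G → G ⊆ T → e ∉ G → G ≡ N) → Curable H
  curable-at {T} {H} {C} {e} {N} trees sC C⊆T i nN only = C , e , sC , (λ k → proj₁ trees (C⊆T k)) , i , unique
    where
    is-N : ∀ {G} → Figure G → G ⊆ H - e → G ≡ N
    is-N fG G⊆ = only fG (figure-within trees fG (λ k → p-x⊆p H e (G⊆ k))) (λ k → x∉p-x H e (G⊆ k))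
    unique : ∀ {F G} → Figure F → Figure G → F ⊆ H - e → G ⊆ H - e → F ≡ G × NegFigure F
    unique fF fG F⊆ G⊆ with is-N fF F⊆ | is-N fG G⊆
    ... | refl | refl = refl , nN

  special-curable : ∀ {H} → SpecialComponent H → Curable H
  special-curable {H} (inj₁ (C , pC , trees) , _) with circuit-nonempty (inj₁ pC)
  ... | e , i = C , e , inj₁ pC , proj₁ trees , i , λ fF _ F⊆ _ → contradiction (F⊆ (e∈ fF F⊆)) (x∉p-x H e)
    where
    e∈ : ∀ {F} → Figure F → F ⊆ H - e → e ∈ F
    e∈ fF F⊆ = subst (e ∈_) (sym (figure-⊆ fF (inj₁ (proj₁ pC)) (figure-within trees fF (λ k → p-x⊆p H e (F⊆ k))))) i
  special-curable (inj₂ (inj₁ (e , L , refl)) , _) =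
    ⁅ e ⁆ , e , inj₂ (inj₁ (e , L , refl)) , (λ i → i) , x∈⁅x⁆ e , λ fF _ F⊆ _ → contradiction fF (none F⊆)
    where
    none : ∀ {F} → F ⊆ ⁅ e ⁆ - e → ¬ Figure F
    none F⊆ fF with figure-nonempty fF
    ... | f , i with ∈-⁻ ⁅ e ⁆ (F⊆ i)
    ... | k , ne = ne (x∈⁅y⁆⇒x≡y e k)
  special-curable (inj₂ (inj₂ (inj₁ (T , θ , trees))) , _) with theta-resolution θ
  ... | C , e , N , pC , C⊆T , i , nN , only = curable-at trees (inj₁ pC) C⊆T i nN only
  special-curable {H} (inj₂ (inj₂ (inj₂ (T , (h , neg) , trees))) , _) = go neg
    where
    open Handcuff h
    open Handcuffs h
    -- The edge is taken from the figure opposite to the one known to be negative. Its sign circuit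
    -- is that figure if it is positive, and the whole handcuff otherwise.
    go : NegFigure F1 ⊎ NegFigure F2 → Curable H
    go (inj₁ n1) with figure-nonempty fig2 | figure-sign fig2
    ... | e , i | d = at d
      where
      only : ∀ {G} → Figure G → G ⊆ T → e ∉ G → G ≡ F1
      only fG G⊆T e∉G with figures fG G⊆T
      ... | inj₁ eq = eq
      ... | inj₂ refl = contradiction i e∉G
      at : PosCircle F2 ⊎ NegFigure F2 → Curable H
      at (inj₁ p2) = curable-at trees (inj₁ p2) F2⊆C i n1 only
      at (inj₂ n2) = curable-at trees (inj₂ (inj₂ (h , n1 , n2))) (λ k → k) (F2⊆C i) n1 only
    go (inj₂ n2) with figure-nonempty fig1 | figure-sign fig1
    ... | e , i | d = at d
      where
      only : ∀ {G} → Figure G → G ⊆ T → e ∉ G → G ≡ F2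
      only fG G⊆T e∉G with figures fG G⊆T
      ... | inj₂ eq = eq
      ... | inj₁ refl = contradiction i e∉G
      at : PosCircle F1 ⊎ NegFigure F1 → Curable H
      at (inj₁ p1) = curable-at trees (inj₁ p1) F1⊆C i n2 only
      at (inj₂ n1) = curable-at trees (inj₂ (inj₂ (h , n1 , n2))) (λ k → k) (F1⊆C i) n2 only

  edge-component-⊆ : ∀ {S S0} → EdgeComponent S S0 → S0 ⊆ S
  edge-component-⊆ (inj₁ (e , i , _ , refl)) = ⁅⁆⊆ i
  edge-component-⊆ (inj₂ (v , isC , _)) = Comp.⊆S isC

  loose-alone : ∀ {S S0 e f} → EdgeComponent S S0 → f ∈ S0 → Loose f → e ∈ S0 → f ≡ e
  loose-alone (inj₁ (l , _ , _ , refl)) i _ j = trans (x∈⁅y⁆⇒x≡y l i) (sym (x∈⁅y⁆⇒x≡y l j))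
  loose-alone (inj₂ (v , isC , _)) i L _ = contradiction L (Comp.noloose isC _ i)

  μ-type-I : ∀ {S} → TypeI S → μ S ≡ n
  μ-type-I {S} tI = μ-of-irredundant S (type-I⇒irredundant tI)

  type-II-¬hyperbalanced : ∀ {S} → TypeII S → ¬ Hyperbalanced S
  type-II-¬hyperbalanced (S0 , ec , sp , _) hb with special-curable sp
  ... | C , e , sC , C⊆S0 , _ = proj₂ sp C C⊆S0 sC (hb C (λ i → edge-component-⊆ ec (C⊆S0 i)) sC)

  μ-type-II : ∀ {S} → TypeII S → μ S ≡ suc n
  μ-type-II {S} (S0 , ec , sp , looses , comps) with special-curable sp
  ... | C , e , sC , C⊆S0 , i , cured = trans (μ-redundant e∈S (redundant-mono C⊆S (circuit-redundant sC i)))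
      (cong suc (μ-of-irredundant (S - e) λ f j → one-negative-irredundant one j (not-loose f j)))
    where
    C⊆S : C ⊆ S
    C⊆S k = edge-component-⊆ ec (C⊆S0 k)
    e∈S : e ∈ S
    e∈S = C⊆S i
    -- A loose edge belongs to `S0` and is then its only edge, which is `e`.
    not-loose : ∀ f → f ∈ S - e → ¬ Loose f
    not-loose f j L with ∈-⁻ S j
    ... | f∈S , ne = ne (loose-alone ec (looses f f∈S L) L (C⊆S0 i))
    one : OneNegative (S - e)
    one {F} {G} {u} {v} fF fG F⊆ G⊆ vu vv k with component S v
    ... | X , isC with Comp.figure-in isC fF (λ q → p-x⊆p S e (F⊆ q)) vu (conn-mono (p-x⊆p S e) k)
                     | Comp.figure-in isC fG (λ q → p-x⊆p S e (G⊆ q)) vv ε | comps v X isC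
    ... | F⊆X | G⊆X | inj₂ simple-type = figures-of-tree-or-unicycle simple-type fF fG F⊆X G⊆X
    ... | F⊆X | G⊆X | inj₁ refl = cured fF fG (⊆-avoid F⊆X (λ q → x∉p-x S e (F⊆ q))) (⊆-avoid G⊆X (λ q → x∉p-x S e (G⊆ q)))

-- The shape of a component, and from the value of `μ` back to the types.

all-or-some : ∀ {k} {A B : Fin k → Set} → (∀ i → A i ⊎ B i) → (∀ i → A i) ⊎ ∃ B
all-or-some {zero} _ = inj₁ λ ()
all-or-some {suc k} f with f zero | all-or-some (f ∘ suc)
... | inj₂ b | _ = inj₂ (zero , b)
... | inj₁ _ | inj₂ (i , b) = inj₂ (suc i , b)
... | inj₁ a | inj₁ as = inj₁ λ { zero → a ; (suc i) → as i }

module Classification {c ℓ} (K : Field c ℓ) {n m : ℕ} (Υ : GSG K n m) where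
  open Gain K Υ hiding (F1; F2; P; x; y; fig1; fig2; x∈F1; y∈F2; disj; path; meet; union)
  open Incidence K Υ
  open Circles K Υ
  open Trails K Υ
  open Components K Υ
  open Ranks K Υ
  open Structure K Υ
  open Independence K Υ

  vertex? : ∀ X v → Dec (VertexOf X v)
  vertex? X v = any? λ e → (e ∈? X) ×-dec (1 ≤? endsAt e v)

  figure-or-acyclic : ∀ X → (∃ λ G → Figure G × G ⊆ X) ⊎ Acyclic X
  figure-or-acyclic = removal-induction _ (inj₂ λ G G⊆ fG → ∉⊥ (G⊆ (proj₂ (figure-nonempty fG)))) step
    where
    step : ∀ X e → e ∈ X → (∃ λ G → Figure G × G ⊆ X - e) ⊎ Acyclic (X - e) → (∃ λ G → Figure G × G ⊆ X) ⊎ Acyclic X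
    step X e i (inj₁ (G , fG , G⊆)) = inj₁ (G , fG , λ k → p-x⊆p X e (G⊆ k))
    step X e i (inj₂ acyclic) with view e
    ... | isHalf a t eq = inj₁ (⁅ e ⁆ , inj₂ (e , (a , t , eq) , refl) , ⁅⁆⊆ i)
    ... | isLoose eq = inj₂ λ G G⊆ fG → acyclic G (⊆-avoid G⊆ λ k → figure-noloose fG e k eq) fG
    ... | joins a b j with conn? (X - e) a b
    ... | yes k with circle-through i j k
    ... | C , cC , C⊆X , _ = inj₁ (C , inj₁ cC , C⊆X)
    step X e i (inj₂ acyclic) | joins a b j | no nk = inj₂ λ G G⊆ fG → acyclic G (⊆-avoid G⊆ (avoids G⊆ fG)) fG
      where
      avoids : ∀ {G} → G ⊆ X → Figure G → e ∉ G
      avoids G⊆ (inj₁ cG) k = nk (conn-mono (-⊆-mono e G⊆) (circle-bypass cG k j))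
      avoids G⊆ (inj₂ (h , H , refl)) k with x∈⁅y⁆⇒x≡y h k
      ... | refl = ¬link-half (joins-link j) H

  module Hitting (V : Fin n → Set) (V? : ∀ v → Dec (V v)) where
    -- Trimming for the paths of thetas and handcuffs, which may meet the figures at their ends
    -- only.
    FirstHit : Fin n → List (Fin m) → List (Fin n) → Set
    FirstHit u es vs = ∃ λ z → ∃₂ λ es' vs' → Trail u es' vs' z × Unique vs' × V z
      × (∀ {e} → e ∈ₗ es' → e ∈ₗ es) × (∀ {q} → q ∈ₗ vs' → q ∈ₗ vs) × (∀ {q} → q ∈ₗ vs' → V q → q ≡ z)

    first-hit : ∀ {u es vs w} → Trail u es vs w → Unique vs → V w → FirstHit u es vs
    first-hit {u} t d vw with V? u
    ... | yes vu = u , [] , u ∷ [] , [] , [] ∷ [] , vu , (λ ()) , (λ { (here refl) → start∈ t }) , λ { (here refl) _ → refl }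
    first-hit [] d vw | no nu = contradiction vw nu
    first-hit (_∷_ {e = e} j t) d vw | no nu with first-hit t (unique-tail d) vw
    ... | z , es' , vs' , t' , d' , vz , sub , sub' , only =
      z , e ∷ es' , _ , j ∷ t' , unique-cons (λ i → unique-head d (sub' i)) d' , vz
      , (λ { (here eq) → here eq ; (there i) → there (sub i) })
      , (λ { (here eq) → here eq ; (there i) → there (sub' i) })
      , λ { (here refl) vq → contradiction vq nu ; (there i) vq → only i vq }

    LastHit : List (Fin m) → List (Fin n) → Fin n → Set
    LastHit es vs w = ∃ λ z → ∃₂ λ es' vs' → Trail z es' vs' w × Unique vs' × V z
      × (∀ {e} → e ∈ₗ es' → e ∈ₗ es) × (∀ {q} → q ∈ₗ vs' → q ∈ₗ vs) × (∀ {q} → q ∈ₗ vs' → V q → q ≡ z)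

    last-hit : ∀ {u es vs w} → Trail u es vs w → Unique vs → (∀ {q} → q ∈ₗ vs → ¬ V q) ⊎ LastHit es vs w
    last-hit {u} [] d with V? u
    ... | yes vu = inj₂ (u , [] , u ∷ [] , [] , d , vu , (λ i → i) , (λ i → i) , λ { (here refl) _ → refl })
    ... | no nu = inj₁ λ { (here refl) → nu }
    last-hit {u} (j ∷ t) d with last-hit t (unique-tail d) | V? u
    ... | inj₂ (z , es' , vs' , t' , d' , vz , sub , sub' , only) | _ = inj₂ (z , es' , vs' , t' , d' , vz , there ∘ sub , there ∘ sub' , only)
    ... | inj₁ none | yes vu = inj₂ (u , _ , _ , j ∷ t , d , vu , (λ i → i) , (λ i → i)
          , λ { (here refl) _ → refl ; (there i) vq → contradiction vq (none i) })
    ... | inj₁ none | no nu = inj₁ λ { (here refl) → nu ; (there i) → none i }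

  Plain : Subset m → Set
  Plain X = Tree X ⊎ SUUnicycle X

  Shape : Subset m → Set
  Shape X = SBUnicycle X
    ⊎ (∃ λ e → Loose e × X ≡ ⁅ e ⁆)
    ⊎ (∃ λ T → SUTheta T × WithTrees T X)
    ⊎ (∃ λ T → (Σ (Handcuff T) λ h → NegFigure (Handcuff.F1 h) ⊎ NegFigure (Handcuff.F2 h)) × WithTrees T X)

  -- The redundant edge is given unconditionally, because it alone refutes irredundance. The shape
  -- is conditional, because `X` could otherwise contain further figures or ears.
  Excess : Subset m → Set
  Excess X = ∃ λ e → e ∈ X × Redundant X e × (OnceRedundant X → Shape X)

  module Connecteds {X} (con : Connected X) (nl : NoLoose X) where
    -- An edge outside `T` with all ends returning to `T` would be redundant by `extra`; after its
    -- deletion, `f` would be redundant still.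
    attach : ∀ {T f} → T ⊆ X → f ∈ T → Redundant T f → OnceRedundant X
      → (∀ e → T ⊆ X - e → ReachesAvoiding X T e → e ∈ X → Redundant X e) → WithTrees T X
    attach {T} {f} T⊆X f∈T r once extra = with-trees T⊆X con nl (_ , f , f∈T , proj₂ (nonloose-inc (nl f (T⊆X f∈T))))
      λ e i ni reach → once e i (extra e (⊆-avoid T⊆X ni) reach i) f (⊆-avoid T⊆X ni f∈T) (redundant-mono (⊆-avoid T⊆X ni) r)

    balanced : ∀ {G y} → Potential X y → Figure G → G ⊆ X → Excess X
    balanced pot (inj₂ (h , (a , t , eq) , refl)) G⊆X = contradiction (sat-half eq (pot h (G⊆X (x∈⁅x⁆ h)))) λ ()
    balanced {G} {y} pot (inj₁ cG@((e , i) , _)) G⊆X =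
      e , G⊆X i , redundant-mono G⊆X (positive-circle-implies pG i) , λ once →
        inj₁ (G , pG , attach G⊆X i (positive-circle-implies pG i) once extra)
      where
      positive : ∀ {C} → Circle C → C ⊆ X → PosCircle C
      positive cC C⊆X = cC , balanced-circle y cC (sol-mono C⊆X pot)
      pG : PosCircle G
      pG = positive cG G⊆X
      extra : ∀ e → G ⊆ X - e → ReachesAvoiding X G e → e ∈ X → Redundant X e
      extra e G⊆ reach i with view e
      ... | isLoose eq = contradiction eq (nl e i)
      ... | isHalf a t eq = contradiction (sat-half eq (pot e i)) λ ()
      ... | joins a b j with reach a (joins-inc₁ j) | reach b (joins-inc₂ j)
      -- A link returning to `G` at both ends closes a circle through `G`, and the potential makes
      -- this circle positive.
      ... | t , vt , k | t' , vt' , k' with circle-through i j (k ◅◅ conn-mono G⊆ (figure-connected (inj₁ cG) t t' vt vt') ◅◅ conn-sym k')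
      ... | C , cC , C⊆X , e∈C = redundant-mono C⊆X (positive-circle-implies (positive cC C⊆X) e∈C)

    attach-negative : ∀ {F T f} → NegFigure F → F ⊆ T → Connected T → T ⊆ X → f ∈ T → Redundant T f → OnceRedundant X → WithTrees T X
    attach-negative nF F⊆T conT T⊆X i r once = attach T⊆X i r once λ e T⊆ reach _ →
      forced-redundant nF (λ k → T⊆ (F⊆T k)) (reaches-shrink F⊆T conT T⊆ (figure-vertex (neg-figure nF)) reach)

    -- `R` is an ear of the negative circle `F`. Each edge of `R` is redundant: it lies on the
    -- circle `P ∪ R`, so its ends reach `F` without it.
    module ThetaExcess {F P Q R u z} (cF : Circle F) (neg : signOf F ≡ s-) (F⊆X : F ⊆ X) (vu : VertexOf F u) (u≢z : u ≢ z)
      (pathP : Path P u z) (pathQ : Path Q u z) (disjPQ : Empty (P ∩ Q)) (meetPQ : ∀ w → VertexOf P w → VertexOf Q w → w ≡ u ⊎ w ≡ z)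
      (F≡ : F ≡ P ∪ Q) (pathR : Path R u z) (R⊆X─F : R ⊆ X ─ F) (meetFR : ∀ w → VertexOf F w → VertexOf R w → w ≡ u ⊎ w ≡ z) where
      T : Subset m
      T = P ∪ (Q ∪ R)
      P⊆F : P ⊆ F
      P⊆F i = subst (_ ∈_) (sym F≡) (∈∪ˡ P Q i)
      Q⊆F : Q ⊆ F
      Q⊆F i = subst (_ ∈_) (sym F≡) (∈∪ʳ P Q i)
      R⊆T : R ⊆ T
      R⊆T i = ∈∪ʳ P (Q ∪ R) (∈∪ʳ Q R i)
      F⊆T : F ⊆ T
      F⊆T i with x∈p∪q⁻ P Q (subst (_ ∈_) F≡ i)
      ... | inj₁ l = ∈∪ˡ P (Q ∪ R) l
      ... | inj₂ l = ∈∪ʳ P (Q ∪ R) (∈∪ˡ Q R l)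
      T⊆X : T ⊆ X
      T⊆X = ∪-lub (λ i → F⊆X (P⊆F i)) (∪-lub (λ i → F⊆X (Q⊆F i)) (λ i → p─q⊆p X F (R⊆X─F i)))
      outside-F : ∀ {A} → A ⊆ F → Empty (A ∩ R)
      outside-F {A} A⊆F (g , i) with x∈p∩q⁻ A R i
      ... | a , r = proj₂ (∈─⁻ X F (R⊆X─F r)) (A⊆F a)
      meet : ∀ {A} → A ⊆ F → ∀ w → VertexOf A w → VertexOf R w → w ≡ u ⊎ w ≡ z
      meet A⊆F w vA vR = meetFR w (vertex-mono A⊆F vA) vR
      sutheta : SUTheta T
      sutheta = (u , z , P , Q , R , u≢z , pathP , pathQ , pathR , disjPQ , outside-F P⊆F , outside-F Q⊆F
        , meetPQ , meet P⊆F , meet Q⊆F , refl) , F , F⊆T , cF , neg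
      reach : ∀ {w} → VertexOf T w → Conn T u w
      reach {w} (g , i , inc) with x∈p∪q⁻ P (Q ∪ R) i
      ... | inj₁ l = conn-mono F⊆T (figure-connected (inj₁ cF) u w vu (g , P⊆F l , inc))
      ... | inj₂ l with x∈p∪q⁻ Q R l
      ... | inj₁ q = conn-mono F⊆T (figure-connected (inj₁ cF) u w vu (g , Q⊆F q , inc))
      ... | inj₂ r = conn-mono R⊆T (path-vertex-conn pathR (g , r , inc))
      conT : Connected T
      conT a b va vb = conn-sym (reach va) ◅◅ reach vb
      circlePR : Circle (P ∪ R)
      circlePR = circle-join pathP pathR u≢z (outside-F P⊆F) (meet P⊆F)
      red : ∀ {f} → f ∈ R → Redundant T f
      red f∈R = forced-redundant (inj₁ (cF , neg)) (⊆-avoid F⊆T (proj₂ (∈─⁻ X F (R⊆X─F f∈R))))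
        (figure-reaches (inj₁ circlePR) (∈∪ʳ P R f∈R) (∪-lub (λ i → F⊆T (P⊆F i)) R⊆T) conT F⊆T (u , vu))
      excess : Excess X
      excess with path-end pathR u≢z
      ... | (f , f∈R) , _ = f , T⊆X (R⊆T f∈R) , redundant-mono T⊆X (red f∈R) , λ once →
        inj₂ (inj₂ (inj₁ (T , sutheta , attach-negative (inj₁ (cF , neg)) F⊆T conT T⊆X (R⊆T f∈R) (red f∈R) once)))

    theta : ∀ {F u v} → NegFigure F → F ⊆ X → VertexOf F u → VertexOf F v → u ≢ v → Conn (X ─ F) u v → Excess X
    theta (inj₂ (h , (a , t , eq) , refl)) _ (e , i , p) (f , j , q) u≢v _ with x∈⁅y⁆⇒x≡y h i | x∈⁅y⁆⇒x≡y h j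
    ... | refl | refl = contradiction (trans (inc-half eq p) (sym (inc-half eq q))) u≢v
    theta {F} {u} {v} (inj₁ (cF , neg)) F⊆X vu vv u≢v k = along (simplify k)
      where
      along : Simple (X ─ F) u v → Excess X
      along (simple [] _ _) = contradiction refl u≢v
      -- The search for the return to `F` starts after the first edge, as `u` itself is on `F`.
      along (simple (_∷_ {e = e} {vs = vs} j t) d s) = stop (Hitting.first-hit (VertexOf F) (vertex? F) t (unique-tail d) vv)
        where
        stop : Hitting.FirstHit (VertexOf F) (vertex? F) _ _ vs → Excess X
        stop (z , es , vs' , t' , d' , vz , sub , sub' , only) = split (circle-split cF u≢z vu vz)
          where
          u≢z : u ≢ z
          u≢z refl = unique-head d (sub' (end∈ t'))
          tR : Trail u (e ∷ es) (u ∷ vs') z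
          tR = j ∷ t'
          R⊆ : toSet (e ∷ es) ⊆ X ─ F
          R⊆ i with toSet⁻ {es = e ∷ es} i
          ... | here refl = s (here refl)
          ... | there l = s (there (sub l))
          meetFR : ∀ w → VertexOf F w → VertexOf (toSet (e ∷ es)) w → w ≡ u ⊎ w ≡ z
          meetFR w vF vR with trail-vertex tR vR
          ... | here eq = inj₁ eq
          ... | there i = inj₂ (only i vF)
          split : (∃₂ λ P Q → Path P u z × Path Q u z × Empty (P ∩ Q) × (∀ w → VertexOf P w → VertexOf Q w → w ≡ u ⊎ w ≡ z) × F ≡ P ∪ Q) → Excess X
          split (P , Q , pathP , pathQ , disjPQ , meetPQ , F≡) = ThetaExcess.excess cF neg F⊆X vu u≢z pathP pathQ disjPQ meetPQ F≡
            (trail-path tR (unique-cons (λ i → unique-head d (sub' i)) d')) R⊆ meetFR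

    handcuff-excess : ∀ {T} (h : Handcuff T) → NegFigure (Handcuff.F1 h) → T ⊆ X → Excess X
    handcuff-excess {T} h nF T⊆X with figure-nonempty (Handcuff.fig2 h)
    ... | e , i = e , T⊆X (F2⊆C i) , redundant-mono T⊆X (redundant₁ nF i) , λ once →
        inj₂ (inj₂ (inj₂ (T , (h , inj₁ nF) , attach-negative nF F1⊆C connected T⊆X (F2⊆C i) (redundant₁ nF i) once)))
      where open Handcuffs h

    handcuff : ∀ {F D} → NegFigure F → F ⊆ X → UniqueContact F X → Figure D → D ⊆ X ─ F → Excess X
    handcuff {F} {D} nF F⊆X contact fD D⊆ with any? (λ v → vertex? F v ×-dec vertex? D v)
    ... | yes (v , vF , vD) = handcuff-excess h nF (∪-lub F⊆X (∪-lub (λ i → p─q⊆p X F (D⊆ i)) λ i → contradiction (toSet⁻ i) λ ()))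
      where
      h : Handcuff (F ∪ D ∪ toSet [])
      h = record
        { F1 = F ; F2 = D ; P = toSet [] ; x = v ; y = v ; fig1 = neg-figure nF ; fig2 = fD ; x∈F1 = vF ; y∈F2 = vD
        ; disj = λ { (e , i) → proj₂ (∈─⁻ X F (D⊆ (proj₂ (x∈p∩q⁻ F D i)))) (proj₁ (x∈p∩q⁻ F D i)) }
        ; path = trail-path [] ([] ∷ [])
        -- Two common vertices would be connected through `D`, outside `F`, against unique contact.
        ; meet = inj₁ (refl , λ w wF wD → contact w v wF vF (conn-mono D⊆ (figure-connected fD w v wD vD)))
        ; union = refl }
    ... | no apart with figure-vertex (neg-figure nF) | figure-vertex fD
    ... | a , va | b , vb with simplify (con a b (vertex-mono F⊆X va) (vertex-mono (λ i → p─q⊆p X F (D⊆ i)) vb))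
    -- Cutting at the first vertex of `D` and then at the last vertex of `F` leaves a path that
    -- meets each figure only at its end there.
    ... | simple t d s with Hitting.first-hit (VertexOf D) (vertex? D) t d vb
    ... | y , es , vs , t' , d' , vy , sub , sub' , only with Hitting.last-hit (VertexOf F) (vertex? F) t' d'
    ... | inj₁ none = contradiction va (none (start∈ t'))
    ... | inj₂ (x , es'' , vs'' , t'' , d'' , vx , sub'' , sub''' , only') =
      handcuff-excess h nF (∪-lub F⊆X (∪-lub (λ i → p─q⊆p X F (D⊆ i)) λ i → s (sub (sub'' (toSet⁻ i)))))
      where
      h : Handcuff (F ∪ D ∪ toSet es'')
      h = record
        { F1 = F ; F2 = D ; P = toSet es'' ; x = x ; y = y ; fig1 = neg-figure nF ; fig2 = fD ; x∈F1 = vx ; y∈F2 = vy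
        ; disj = λ { (e , i) → proj₂ (∈─⁻ X F (D⊆ (proj₂ (x∈p∩q⁻ F D i)))) (proj₁ (x∈p∩q⁻ F D i)) }
        ; path = trail-path t'' d''
        ; meet = inj₂ ((λ v vF vD → apart (v , vF , vD))
            , (λ v vP vF → only' (trail-vertex t'' vP) vF) , λ v vP vD → only (sub''' (trail-vertex t'' vP)) vD)
        ; union = refl }

    -- Around a negative figure `F`, only two things prevent an unbalanced unicycle: an ear at `F`,
    -- which gives a theta, and a figure outside `F`, which gives a handcuff.
    classify : Plain X ⊎ Excess X
    classify with potential-or-negative X | figure-or-acyclic X
    ... | _ | inj₂ acyclic = inj₁ (inj₁ (con , nl , acyclic))
    ... | inj₁ (y , pot) | inj₁ (G , fG , G⊆X) = inj₂ (balanced pot fG G⊆X)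
    ... | inj₂ (F , nF , F⊆X) | inj₁ _
      with any? (λ u → any? λ v → vertex? F u ×-dec (vertex? F v ×-dec (¬? (u ≟ v) ×-dec conn? (X ─ F) u v)))
    ... | yes (u , v , vu , vv , u≢v , k) = inj₂ (theta nF F⊆X vu vv u≢v k)
    ... | no none = at (figure-or-acyclic (X ─ F))
      where
      contact : UniqueContact F X
      contact u v vu vv k with u ≟ v
      ... | yes eq = eq
      ... | no ne = contradiction (u , v , vu , vv , ne , k) none
      at : (∃ λ D → Figure D × D ⊆ X ─ F) ⊎ Acyclic (X ─ F) → Plain X ⊎ Excess X
      at (inj₁ (D , fD , D⊆)) = inj₂ (handcuff nF F⊆X contact fD D⊆)
      at (inj₂ acyclic) = inj₁ (inj₂ (F , nF , F⊆X , con , nl , acyclic , contact))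

  classify : ∀ {S v X} → IsCompEdges S v X → Plain X ⊎ Excess X
  classify isC = Connecteds.classify (Comp.connected isC) (Comp.noloose isC)

  irredundant⇒type-I : ∀ {S} → Irredundant S → TypeI S
  irredundant⇒type-I {S} irr = (λ e i L → irr e i λ _ _ → loose-sat L) , comps
    where
    comps : ∀ v X → IsCompEdges S v X → Plain X
    comps v X isC with classify isC
    ... | inj₁ plain = plain
    ... | inj₂ (e , i , r , _) = contradiction (redundant-mono (Comp.⊆S isC) r) (irr e (Comp.⊆S isC i))

  μ≡1+n⇒type-II : ∀ {S} → μ S ≡ suc n → ¬ Hyperbalanced S → TypeII S
  μ≡1+n⇒type-II {S} eq ¬hb = search (any? λ e → (e ∈? S) ×-dec loose? e)
    where
    once : OnceRedundant S
    once = μ≡1+n⇒once-redundant eq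
    -- Sign circuits in `S` are unique, so a neutral one would make `S` hyperbalanced.
    non-neutral : ∀ {S0} → S0 ⊆ S → ∀ C → C ⊆ S0 → SignCircuit C → ¬ Neutral C
    non-neutral S0⊆S C C⊆S0 sC neutral = ¬hb λ D D⊆S sD →
      subst Neutral (circuit-unique once (λ i → S0⊆S (C⊆S0 i)) D⊆S sC sD) neutral
    -- Loose edges belong to no component and come first: one of them uses up the only redundancy,
    -- so all components are then plain.
    search : Dec (∃ λ e → e ∈ S × Loose e) → TypeII S
    search (yes (l , i , L)) = ⁅ l ⁆ , inj₁ (l , i , L , refl) , (inj₂ (inj₁ (l , L , refl)) , non-neutral (⁅⁆⊆ i)) , looses , comps
      where
      irr : Irredundant (S - l)
      irr = once l i λ _ _ → loose-sat L
      looses : ∀ e → e ∈ S → Loose e → e ∈ ⁅ l ⁆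
      looses e j L' with e ≟ l
      ... | yes refl = x∈⁅x⁆ l
      ... | no ne = contradiction (λ _ _ → loose-sat L') (irr e (x∈p∧x≢y⇒x∈p-y j ne))
      comps : ∀ v X → IsCompEdges S v X → X ≡ ⁅ l ⁆ ⊎ Tree X ⊎ SUUnicycle X
      comps v X isC with classify isC
      ... | inj₁ plain = inj₂ plain
      ... | inj₂ (e , j , r , _) = contradiction (redundant-mono X⊆ r) (irr e (X⊆ j))
        where
        X⊆ : X ⊆ S - l
        X⊆ = ⊆-avoid (Comp.⊆S isC) λ k → Comp.noloose isC l k L
    search (no none) with all-or-some (λ v → classify (proj₂ (component S v)))
    ... | inj₁ plain = contradiction (trans (sym eq) (μ-type-I tI)) λ p → 1+n≰n (≤-reflexive p)
      where
      tI : TypeI S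
      tI = (λ e i L → none (e , i , L)) , λ v X isC → subst Plain (component-unique (proj₂ (component S v)) isC) (plain v)
    ... | inj₂ (v , e , i , r , shape) with component S v
    ... | X , isC = X , inj₂ (v , isC , e , i) , (shape (once-redundant-mono X⊆S once) , non-neutral X⊆S)
        , (λ l k L → contradiction (l , k , L) none) , comps
      where
      X⊆S : X ⊆ S
      X⊆S = Comp.⊆S isC
      comps : ∀ w Y → IsCompEdges S w Y → Y ≡ X ⊎ Tree Y ⊎ SUUnicycle Y
      comps w Y isC' with classify isC'
      ... | inj₁ plain = inj₂ plain
      ... | inj₂ (f , j , r' , _) with f ∈? X
      ... | yes k = inj₁ (components-meet isC' isC j k)
      -- A second component with excess contradicts `once`: `e` stays redundant after the deletion
      -- of `f`.
      ... | no nk = contradiction (redundant-mono X⊆ r) (once f (Comp.⊆S isC' j) (redundant-mono (Comp.⊆S isC') r') e (X⊆ i))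
        where
        X⊆ : X ⊆ S - f
        X⊆ = ⊆-avoid X⊆S nk

  -- The bound `R ≤ n` turns the truncated subtraction in `Rank` into a true one.
  rank⁻ : ∀ {S R : ℕ} {d} → R ≤ n → S ≡ n ∸ R + d → S + R ≡ d + n
  rank⁻ {S} {R} {d} le refl = begin
    n ∸ R + d + R ≡⟨ cong (_+ R) (+-comm (n ∸ R) d) ⟩
    d + (n ∸ R) + R ≡⟨ +-assoc d (n ∸ R) R ⟩
    d + (n ∸ R + R) ≡⟨ cong (d +_) (m∸n+n≡m le) ⟩
    d + n ∎
    where open ≡-Reasoning

  rank⁺ : ∀ {S R : ℕ} {d} → R ≤ n → S + R ≡ d + n → S ≡ n ∸ R + d
  rank⁺ {S} {R} {d} le eq = +-cancelʳ-≡ R S (n ∸ R + d) (trans eq (sym (rank⁻ le refl)))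

  independent⁻ : ∀ {S} → Independent S → (μ S ≡ n × Hyperbalanced S) ⊎ (μ S ≡ suc n × ¬ Hyperbalanced S)
  independent⁻ {S} (R , spec , d , dd , eq) with reps≡leads spec | dd
  ... | refl | inj₁ (refl , hb) = inj₁ (rank⁻ {d = 0} (∣p∣≤n R) eq , hb)
  ... | refl | inj₂ (refl , ¬hb) = inj₂ (rank⁻ {d = 1} (∣p∣≤n R) eq , ¬hb)

  independent⁺ : ∀ {S} → (μ S ≡ n × Hyperbalanced S) ⊎ (μ S ≡ suc n × ¬ Hyperbalanced S) → Independent S
  independent⁺ {S} (inj₁ (eq , hb)) = leads S , leads-spec S , 0 , inj₁ (refl , hb) , rank⁺ {d = 0} (∣p∣≤n (leads S)) eq
  independent⁺ {S} (inj₂ (eq , ¬hb)) = leads S , leads-spec S , 1 , inj₂ (refl , ¬hb) , rank⁺ {d = 1} (∣p∣≤n (leads S)) eq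

theorem7p3 : ∀ {c ℓ} (K : Field c ℓ) → CharNot2 K → (n m : ℕ) (Υ : GSG K n m) (S : Subset m)
    → Gain.Independent K Υ S ⇔ (Gain.TypeI K Υ S ⊎ Gain.TypeII K Υ S)
theorem7p3 K _ n m Υ S = mk⇔ to from
  where
  open Gain K Υ using (Independent; TypeI; TypeII)
  open Ranks K Υ
  open Independence K Υ
  open Classification K Υ
  to : Independent S → TypeI S ⊎ TypeII S
  to ind with independent⁻ ind
  ... | inj₁ (eq , _) = inj₁ (irredundant⇒type-I (μ≡n⇒irredundant eq))
  ... | inj₂ (eq , ¬hb) = inj₂ (μ≡1+n⇒type-II eq ¬hb)
  from : TypeI S ⊎ TypeII S → Independent S
  from (inj₁ tI) = independent⁺ (inj₁ (μ-type-I tI , λ C C⊆S sC → contradiction sC (irredundant⇒no-circuit (type-I⇒irredundant tI) C⊆S)))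
  from (inj₂ tII) = independent⁺ (inj₂ (μ-type-II tII , type-II-¬hyperbalanced tII))
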